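{- Let $F$ be the fork graph with vertex set $\{u,v,w,x,y\}$ and edge set $\{uv, vw, wx, wy\}$. For an integer $k\ge 1$, let $F^{(k)}_w$ be the graph obtained from $F$ by replacing the vertex $w$ by a complete graph $K_{k+1}$ on new vertices $w_0,\dots,w_k$, each of which is adjacent to $v$, $x$ and $y$ (and to each other). Then for any $k\geq 1$, \begin{align*} X_{F^{(k)}_w}=&\, (k + 1)! s_{(3,2,1^k)} + (k + 3) (k + 1)! s_{(3,1^{k+2})} -2(k + 1)! s_{(2^3,1^{k-1})} \\ &+ 5(k + 1)(k + 1)! s_{(2^2,1^{k+1})} + (k^{3} + 5 k^{2} + 14 k + 14) (k + 1)! s_{(2,1^{k+3})} \\ &+ 2 (k + 2)^{3} (k + 1)! s_{(1^{k+5})}. \end{align*} In particular, $X_{F^{(k)}_w}$ is not $s$-positive.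
   Context: For a finite simple graph $G$ with vertex set $\{v_1,\dots,v_d\}$, the chromatic symmetric function is $X_G=\sum_{\kappa} x_{\kappa(v_1)}\cdots x_{\kappa(v_d)}$, summed over all proper colorings $\kappa:V(G)\to\{1,2,\dots\}$, with commuting indeterminates. $s_\lambda$ denotes the Schur function indexed by the partition $\lambda$; $G$ is $s$-positive if all coefficients of $X_G$ in the Schur basis are non-negative. Partition notation: $(a^{m},b^{n},\dots)$ has $m$ parts equal to $a$, $n$ parts equal to $b$, etc.; e.g. $(2^3,1^{k-1})$ has three parts $2$ and $k-1$ parts $1$ (for $k=1$ this is $(2,2,2)$). -}

module Defs where

open import Data.Nat using (ℕ; zero; suc; _+_; _*_; _∸_; _≡ᵇ_; _<ᵇ_; _≤ᵇ_; _!)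
open import Data.Bool using (Bool; true; false; _∧_; _∨_; not; T)
open import Data.Fin using (Fin; toℕ)
open import Data.List using (List; []; _∷_; map; concatMap; concat; filterᵇ; length; allFin; foldr; replicate)
open import Data.Vec as Vec using (Vec)
open import Data.Integer as ℤ using (ℤ; +_)
open import Data.Product using (_×_; _,_; proj₁; proj₂; ∃)
open import Relation.Binary.PropositionalEquality using (_≡_)

all : {A : Set} → (A → Bool) → List A → Bool
all p []       = true
all p (x ∷ xs) = p x ∧ all p xs

allVecs : (n d : ℕ) → List (Vec (Fin n) d)
allVecs n zero    = Vec.[] ∷ []
allVecs n (suc d) = concatMap (λ a → map (a Vec.∷_) (allVecs n d)) (allFin n)

countᵇ : {A : Set} → (A → Bool) → List A → ℕ
countᵇ p xs = length (filterᵇ p xs)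

finEqᵇ : {n : ℕ} → Fin n → Fin n → Bool
finEqᵇ a b = toℕ a ≡ᵇ toℕ b

-- a list of colours c has content α : Fin n → ℕ, i.e. the monomial
-- ∏_{c ∈ list} x_c equals x^α = ∏_i x_i^{α i}
hasContent : {n : ℕ} → (Fin n → ℕ) → List (Fin n) → Bool
hasContent {n} α xs = all (λ c → countᵇ (finEqᵇ c) xs ≡ᵇ α c) (allFin n)

Graph : ℕ → Set
Graph d = Fin d → Fin d → Bool

properᵇ : {d n : ℕ} → Graph d → Vec (Fin n) d → Bool
properᵇ {d} adj κ =
  all (λ i → all (λ j → not (adj i j) ∨ not (finEqᵇ (Vec.lookup κ i) (Vec.lookup κ j)))
                 (allFin d))
      (allFin d)

-- Coefficient of the monomial x^α = x_1^{α 0} ⋯ x_n^{α (n-1)} in the chromatic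
-- symmetric function X_G.  Every monomial in the countably many variables
-- x_1, x_2, … is of this form for some n, and a colouring contributes to x^α
-- iff it uses exactly colour c (α c) times (so only colours < n).
chromCoeff : {d : ℕ} → Graph d → (n : ℕ) → (Fin n → ℕ) → ℕ
chromCoeff {d} G n α =
  countᵇ (λ κ → properᵇ G κ ∧ hasContent α (Vec.toList κ)) (allVecs n d)

isPartition : List ℕ → Bool
isPartition []            = true
isPartition (a ∷ [])      = 1 ≤ᵇ a
isPartition (a ∷ b ∷ rest) = (b ≤ᵇ a) ∧ isPartition (b ∷ rest)

fillings : (n : ℕ) → List ℕ → List (List (List (Fin n)))
fillings n []       = [] ∷ []
fillings n (r ∷ rs) =
  concatMap (λ row → map (Vec.toList row ∷_) (fillings n rs)) (allVecs n r)

weaklyIncᵇ : {n : ℕ} → List (Fin n) → Bool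
weaklyIncᵇ []           = true
weaklyIncᵇ (a ∷ [])     = true
weaklyIncᵇ (a ∷ b ∷ t)  = (toℕ a ≤ᵇ toℕ b) ∧ weaklyIncᵇ (b ∷ t)

colStrictᵇ : {n : ℕ} → List (Fin n) → List (Fin n) → Bool
colStrictᵇ _        []       = true
colStrictᵇ []       (_ ∷ _)  = false
colStrictᵇ (a ∷ as) (b ∷ bs) = (toℕ a <ᵇ toℕ b) ∧ colStrictᵇ as bs

isSSYTᵇ : {n : ℕ} → List (List (Fin n)) → Bool
isSSYTᵇ []              = true
isSSYTᵇ (r ∷ [])        = weaklyIncᵇ r
isSSYTᵇ (r ∷ r' ∷ rest) = weaklyIncᵇ r ∧ colStrictᵇ r r' ∧ isSSYTᵇ (r' ∷ rest)

schurCoeff : List ℕ → (n : ℕ) → (Fin n → ℕ) → ℕ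
schurCoeff λ' n α =
  countᵇ (λ T → isSSYTᵇ T ∧ hasContent α (concat T)) (fillings n λ')

schurCombCoeff : List (ℤ × List ℕ) → (n : ℕ) → (Fin n → ℕ) → ℤ
schurCombCoeff terms n α =
  foldr (λ t acc → proj₁ t ℤ.* (+ schurCoeff (proj₂ t) n α) ℤ.+ acc) (+ 0) terms

ChromEqSchur : {d : ℕ} → Graph d → List (ℤ × List ℕ) → Set
ChromEqSchur G terms =
  ∀ (n : ℕ) (α : Fin n → ℕ) → + chromCoeff G n α ≡ schurCombCoeff terms n α

SPositive : {d : ℕ} → Graph d → Set
SPositive G =
  ∃ λ (L : List (ℕ × List ℕ)) →
    T (all (λ t → isPartition (proj₂ t)) L) ×
    (∀ (n : ℕ) (α : Fin n → ℕ) →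
       chromCoeff G n α ≡ foldr (λ t acc → proj₁ t * schurCoeff (proj₂ t) n α + acc) 0 L)

-- The graph F^{(k)}_w on k+5 vertices:
--   0 = u, 1 = v, 2 = x, 3 = y, 4+i = w_i (0 ≤ i ≤ k).
-- Edges: uv; v w_i, x w_i, y w_i (all i); w_i w_j (i ≠ j).

isEdgeℕ : ℕ → ℕ → Bool
isEdgeℕ a b =
  ((a ≡ᵇ 0) ∧ (b ≡ᵇ 1))
  ∨ ((1 ≤ᵇ a) ∧ (a ≤ᵇ 3) ∧ (4 ≤ᵇ b))
  ∨ ((4 ≤ᵇ a) ∧ (a <ᵇ b))

forkBlowup : (k : ℕ) → Graph (k + 5)
forkBlowup k i j = isEdgeℕ (toℕ i) (toℕ j) ∨ isEdgeℕ (toℕ j) (toℕ i)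

forkExpansion : ℕ → List (ℤ × List ℕ)
forkExpansion k =
    (+ (f)                                        , 3 ∷ 2 ∷ replicate k 1)
  ∷ (+ ((k + 3) * f)                              , 3 ∷ replicate (k + 2) 1)
  ∷ (ℤ.- (+ (2 * f))                              , 2 ∷ 2 ∷ 2 ∷ replicate (k ∸ 1) 1)
  ∷ (+ (5 * (k + 1) * f)                          , 2 ∷ 2 ∷ replicate (k + 1) 1)
  ∷ (+ ((k * k * k + 5 * (k * k) + 14 * k + 14) * f) , 2 ∷ replicate (k + 3) 1)
  ∷ (+ (2 * ((k + 2) * (k + 2) * (k + 2)) * f)    , replicate (k + 5) 1)
  ∷ []
  where
  f : ℕ
  f = (k + 1) !

{-# OPTIONS --safe #-}
module Submission where

-- Divide X by (k+1)!.  Colouring the clique last shows that the coefficient of x^α only depends on the numbers tₛ of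
-- colours of multiplicity s: it is a sum over the stable set partitions of {u, v, x, y}.  The same holds for
--   e_{k+2} m₂₁ + (k+2) e_{k+3} p₂ + 2(3k+4) e_{k+3} e₂ + (k³+5k²+8k+7) e_{k+4} e₁ + (k+1)²(k+5) e_{k+5},
-- and the two agree for every type.  The Schur functions enter through the Pieri-type identities
--   e_p e₁ = s_{2,1^{p-1}} + e_{p+1},          e_p h₂ = s_{3,1^{p-1}} + s_{2,1^p},
--   e_p e₂ = s_{2,2,1^{p-2}} + e_{p+1} e₁,     e_p s₂₁ = s_{3,2,1^{p-2}} + s_{2,1^p} e₁,
--   e_p e₃ = s_{2,2,2,1^{p-3}} + e_{p+1} e₂,
-- which hold because a pair of columns violating semistandardness for the first time in row i can be re-sorted into
-- a longer column and a shorter one; no cancellation is needed.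
--
-- X is not Schur positive because the coefficient of x^(3,1,2,1,…) is positive and that of x^(2,2,2,1,…) is zero, while
-- changing the third 0 in the first row into a 1 turns a tableau of the former content into one of the latter.

-- Where the constants come from: a colour class contains at most one clique vertex, and none once
-- it contains v, x or y. With all multiplicities at most 3, nonzero coefficients therefore occur
-- only for (t₂, t₃) = (1,1), (0,1), (2,0), (1,0), (0,0), and t₁ + 2 t₂ + 3 t₃ = k + 5 then fixes t₁
-- in terms of k. Taken in this order, the types form a triangular system for the five coefficients:
-- each one brings in exactly one further product, namely those with m₂₁, p₂, e₂, e₁ and e_{k+5}
-- itself. Products of e_p with monomial sums are a convenient intermediate form because their
-- coefficients count choices of one or two colours subject to a condition at each colour. This is
-- the same kind of count as for the colours of u, v, x, y, so one evaluation, `patternCount`,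
-- serves both sides. The expansion has a negative coefficient. The term with (2,2,2,1^{k-1}) is
-- kept on the other side of every equation, so that everything up to the last step takes place in
-- ℕ.

open import Defs
import Algebra.Properties.CommutativeMonoid.Sum as CommutativeMonoidSum
import Algebra.Properties.CommutativeSemigroup as CommutativeSemigroupProperties
import Algebra.Properties.Semiring.Sum as SemiringSum
open import Data.Bool using (Bool; true; false; _∧_; _∨_; not; if_then_else_; T; T?)
open import Data.Bool.Properties using (T-≡; T-∧; T-∨; ∨-zeroʳ)
open import Data.Bool.Solver using (module ∨-∧-Solver)
open import Data.Empty using (⊥; ⊥-elim)
open import Data.Fin using (Fin; zero; suc; toℕ)
open import Data.Fin.Properties using (toℕ-injective) renaming (all? to allFin?)
open import Data.Integer as ℤ using () renaming (+_ to pos)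
import Data.Integer.Properties as ℤ
import Data.Integer.Tactic.RingSolver as ℤ-Solver
open import Data.List using (List; []; _∷_; _++_; map; concat; concatMap; length; allFin; tabulate; replicate; foldr; downFrom)
open import Data.List.Membership.Propositional using (_∈_)
open import Data.List.Membership.Propositional.Properties using (∈-concatMap⁺; ∈-concatMap⁻; ∈-map⁺; ∈-map⁻; ∈-allFin)
open import Data.List.Properties using (map-cong; map-∘; map-++)
open import Data.List.Relation.Binary.Permutation.Propositional using (_↭_; prep; swap; ↭-trans; ↭-sym; ↭-refl)
open import Data.List.Relation.Binary.Permutation.Propositional.Properties using (shift; ++⁺ʳ)
open import Data.List.Relation.Unary.All using (All; []; _∷_)
import Data.List.Relation.Unary.All.Properties as All
open import Data.List.Relation.Unary.Any as Any using (here; there)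
open import Data.Nat using (ℕ; zero; suc; pred; _+_; _*_; _∸_; _≤_; _<_; z≤n; s≤s; s≤s⁻¹; _≤ᵇ_; _<ᵇ_; _≡ᵇ_; _≟_; _≤?_; _<?_; _!)
open import Data.Nat.ListAction using (sum)
open import Data.Nat.ListAction.Properties using (sum-++)
open import Data.Nat.Properties hiding (eq?)
open import Data.Nat.Tactic.RingSolver using (solve-∀)
open import Data.Product using (_×_; _,_; proj₁; proj₂; ∃; ∃₂)
open import Data.Sum using (_⊎_; inj₁; inj₂; [_,_]′)
open import Data.Unit using (⊤; tt)
open import Data.Vec as Vec using (Vec; []; _∷_; toList; lookup)
open import Data.Vec.N-ary using (N-ary)
open import Function using (_∘_; id; Equivalence)
open import Relation.Binary.PropositionalEquality hiding ([_])
open import Relation.Nullary using (Dec; yes; no; does; ¬_; _×-dec_; ¬?)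
open import Relation.Nullary.Decidable using (map′; dec-true; dec-false; toSum)
open ≡-Reasoning
open ∨-∧-Solver using (solve; _:=_; _:*_; con)

module Sum = SemiringSum +-*-semiring
module Product = CommutativeMonoidSum *-1-commutativeMonoid
module *-CS = CommutativeSemigroupProperties *-commutativeSemigroup
module +-CS = CommutativeSemigroupProperties +-commutativeSemigroup

-- Indicators, sums and contents

ind : Bool → ℕ
ind true  = 1
ind false = 0

⟦_⟧ : {P : Set} → Dec P → ℕ
⟦ P? ⟧ = ind (does P?)

⟦⟧-yes : ∀ {P : Set} (P? : Dec P) → P → ⟦ P? ⟧ ≡ 1
⟦⟧-yes P? p = cong ind (dec-true P? p)

⟦⟧-no : ∀ {P : Set} (P? : Dec P) → ¬ P → ⟦ P? ⟧ ≡ 0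
⟦⟧-no P? ¬p = cong ind (dec-false P? ¬p)

⟦⟧-⇔ : ∀ {P Q : Set} (P? : Dec P) (Q? : Dec Q) → (P → Q) → (Q → P) → ⟦ P? ⟧ ≡ ⟦ Q? ⟧
⟦⟧-⇔ (yes p) Q? f g = sym (⟦⟧-yes Q? (f p))
⟦⟧-⇔ (no ¬p) Q? f g = sym (⟦⟧-no Q? (¬p ∘ g))

⟦⟧-⊎ : ∀ {P Q R : Set} (P? : Dec P) (Q? : Dec Q) (R? : Dec R) →
       (P → Q ⊎ R) → (Q → P) → (R → P) → (Q → ¬ R) → ⟦ P? ⟧ ≡ ⟦ Q? ⟧ + ⟦ R? ⟧
⟦⟧-⊎ P? (yes q) (yes r) f g h d = ⊥-elim (d q r)
⟦⟧-⊎ P? (yes q) (no _)  f g h d = ⟦⟧-yes P? (g q)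
⟦⟧-⊎ P? (no _)  (yes r) f g h d = ⟦⟧-yes P? (h r)
⟦⟧-⊎ P? (no ¬q) (no ¬r) f g h d = ⟦⟧-no P? (λ p → [ ¬q , ¬r ]′ (f p))

⟦⟧-× : ∀ {P Q : Set} (P? : Dec P) (Q? : Dec Q) → ⟦ P? ×-dec Q? ⟧ ≡ ⟦ P? ⟧ * ⟦ Q? ⟧
⟦⟧-× (yes _) Q? = sym (+-identityʳ _)
⟦⟧-× (no _)  Q? = refl

-- Opaque, so that unification treats ∑ as injective.
opaque
  ∑ : ∀ {n} → (Fin n → ℕ) → ℕ
  ∑ = Sum.sum

  ∑-empty : (f : Fin 0 → ℕ) → ∑ f ≡ 0
  ∑-empty f = refl

  ∑-suc : ∀ {n} (f : Fin (suc n) → ℕ) → ∑ f ≡ f zero + ∑ (f ∘ suc)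
  ∑-suc f = refl

  ∑-cong : ∀ {n} {f g : Fin n → ℕ} → (∀ c → f c ≡ g c) → ∑ f ≡ ∑ g
  ∑-cong = Sum.sum-cong-≗

  ∑-+ : ∀ {n} (f g : Fin n → ℕ) → ∑ (λ c → f c + g c) ≡ ∑ f + ∑ g
  ∑-+ = Sum.∑-distrib-+

  ∑-swap : ∀ {m n} (f : Fin m → Fin n → ℕ) → ∑ (λ a → ∑ (f a)) ≡ ∑ (λ b → ∑ (λ a → f a b))
  ∑-swap = Sum.∑-comm

  *-∑ : ∀ {n} x (f : Fin n → ℕ) → x * ∑ f ≡ ∑ (λ c → x * f c)
  *-∑ = Sum.*-distribˡ-sum

  ∑-zero : ∀ {n} (f : Fin n → ℕ) → (∀ c → f c ≡ 0) → ∑ f ≡ 0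
  ∑-zero {n} f eq = trans (∑-cong eq) (Sum.sum-replicate-zero n)

∑≡0⇒≡0 : ∀ {n} (f : Fin n → ℕ) → ∑ f ≡ 0 → ∀ c → f c ≡ 0
∑≡0⇒≡0 f eq zero    = m+n≡0⇒m≡0 (f zero) (trans (sym (∑-suc f)) eq)
∑≡0⇒≡0 f eq (suc c) = ∑≡0⇒≡0 (f ∘ suc) (m+n≡0⇒n≡0 (f zero) (trans (sym (∑-suc f)) eq)) c

-- Routed through `finEqᵇ`, so that `does (eq? a b)` is definitionally the Boolean test of the
-- statement.
eq? : ∀ {n} (a b : Fin n) → Dec (a ≡ b)
eq? a b = map′ (λ t → toℕ-injective (≡ᵇ⇒≡ (toℕ a) (toℕ b) t)) (λ { refl → ≡⇒≡ᵇ (toℕ a) (toℕ a) refl }) (T? (finEqᵇ a b))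

∑-δ : ∀ {n} (z : Fin n) (g : Fin n → ℕ) → ∑ (λ c → ⟦ eq? c z ⟧ * g c) ≡ g z
∑-δ zero    g = trans (∑-suc _) (trans (cong (1 * g zero +_) (∑-zero _ λ _ → refl)) (trans (+-identityʳ _) (+-identityʳ _)))
∑-δ (suc z) g = trans (∑-suc _) (∑-δ z (g ∘ suc))

cnt : ∀ {n} → Fin n → List (Fin n) → ℕ
cnt c xs = countᵇ (finEqᵇ c) xs

cnt-∷ : ∀ {n} (c a : Fin n) xs → cnt c (a ∷ xs) ≡ ⟦ eq? c a ⟧ + cnt c xs
cnt-∷ c a xs with finEqᵇ c a
... | true  = refl
... | false = refl

cnt-++ : ∀ {n} (c : Fin n) xs ys → cnt c (xs ++ ys) ≡ cnt c xs + cnt c ys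
cnt-++ c []       ys = refl
cnt-++ c (x ∷ xs) ys = begin
  cnt c (x ∷ xs ++ ys)                ≡⟨ cnt-∷ c x (xs ++ ys) ⟩
  ⟦ eq? c x ⟧ + cnt c (xs ++ ys)       ≡⟨ cong (⟦ eq? c x ⟧ +_) (cnt-++ c xs ys) ⟩
  ⟦ eq? c x ⟧ + (cnt c xs + cnt c ys)  ≡⟨ +-assoc ⟦ eq? c x ⟧ _ _ ⟨
  ⟦ eq? c x ⟧ + cnt c xs + cnt c ys    ≡⟨ cong (_+ cnt c ys) (cnt-∷ c x xs) ⟨
  cnt c (x ∷ xs) + cnt c ys            ∎

cnt-↭ : ∀ {n} (c : Fin n) {xs ys} → xs ↭ ys → cnt c xs ≡ cnt c ys
cnt-↭ c _↭_.refl = refl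
cnt-↭ c (prep {xs} {ys} x p) rewrite cnt-∷ c x xs | cnt-∷ c x ys = cong (⟦ eq? c x ⟧ +_) (cnt-↭ c p)
cnt-↭ c (swap {xs} {ys} x y p)
  rewrite cnt-∷ c x (y ∷ xs) | cnt-∷ c y xs | cnt-∷ c y (x ∷ ys) | cnt-∷ c x ys | cnt-↭ c p = begin
  ⟦ eq? c x ⟧ + (⟦ eq? c y ⟧ + cnt c ys)  ≡⟨ +-assoc ⟦ eq? c x ⟧ _ _ ⟨
  ⟦ eq? c x ⟧ + ⟦ eq? c y ⟧ + cnt c ys    ≡⟨ cong (_+ cnt c ys) (+-comm ⟦ eq? c x ⟧ _) ⟩
  ⟦ eq? c y ⟧ + ⟦ eq? c x ⟧ + cnt c ys    ≡⟨ +-assoc ⟦ eq? c y ⟧ _ _ ⟩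
  ⟦ eq? c y ⟧ + (⟦ eq? c x ⟧ + cnt c ys)  ∎
cnt-↭ c (_↭_.trans p q) = trans (cnt-↭ c p) (cnt-↭ c q)

cnt-zero-map-suc : ∀ {n} (xs : List (Fin n)) → cnt zero (map suc xs) ≡ 0
cnt-zero-map-suc []       = refl
cnt-zero-map-suc (x ∷ xs) = cnt-zero-map-suc xs

cnt-suc-map-suc : ∀ {n} (c : Fin n) xs → cnt (suc c) (map suc xs) ≡ cnt c xs
cnt-suc-map-suc c []       = refl
cnt-suc-map-suc c (x ∷ xs) = begin
  cnt (suc c) (map suc (x ∷ xs))           ≡⟨ cnt-∷ (suc c) (suc x) (map suc xs) ⟩
  ⟦ eq? c x ⟧ + cnt (suc c) (map suc xs)   ≡⟨ cong (⟦ eq? c x ⟧ +_) (cnt-suc-map-suc c xs) ⟩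
  ⟦ eq? c x ⟧ + cnt c xs                   ≡⟨ cnt-∷ c x xs ⟨
  cnt c (x ∷ xs)                           ∎

∑-cnt : ∀ {n} (zs : List (Fin n)) → ∑ (λ c → cnt c zs) ≡ length zs
∑-cnt []       = ∑-zero _ λ _ → refl
∑-cnt (z ∷ zs) = begin
  ∑ (λ c → cnt c (z ∷ zs))                       ≡⟨ ∑-cong (λ c → trans (cnt-∷ c z zs) (cong (_+ cnt c zs) (sym (*-identityʳ _)))) ⟩
  ∑ (λ c → ⟦ eq? c z ⟧ * 1 + cnt c zs)            ≡⟨ ∑-+ _ _ ⟩
  ∑ (λ c → ⟦ eq? c z ⟧ * 1) + ∑ (λ c → cnt c zs)  ≡⟨ cong₂ _+_ (∑-δ z (λ _ → 1)) (∑-cnt zs) ⟩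
  suc (length zs)                                 ∎

all⁻ : ∀ {A : Set} (p : A → Bool) xs → T (all p xs) → All (T ∘ p) xs
all⁻ p []       t = []
all⁻ p (x ∷ xs) t with p x in eq
... | true = subst T (sym eq) tt ∷ all⁻ p xs t

all⁺ : ∀ {A : Set} (p : A → Bool) {xs} → All (T ∘ p) xs → T (all p xs)
all⁺ p []         = tt
all⁺ p {x ∷ _} (t ∷ ts) with p x
... | true = all⁺ p ts

allFin⁻ : ∀ {n} (p : Fin n → Bool) → T (all p (allFin n)) → ∀ c → T (p c)
allFin⁻ p t = All.tabulate⁻ (all⁻ p _ t)

allFin⁺ : ∀ {n} (p : Fin n → Bool) → (∀ c → T (p c)) → T (all p (allFin n))
allFin⁺ p h = all⁺ p (All.tabulate⁺ h)

Content : ∀ {n} → (Fin n → ℕ) → List (Fin n) → Set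
Content α xs = ∀ c → cnt c xs ≡ α c

content? : ∀ {n} (α : Fin n → ℕ) xs → Dec (Content α xs)
content? α xs = allFin? (λ c → cnt c xs ≟ α c)

H : ∀ {n} → (Fin n → ℕ) → List (Fin n) → ℕ
H α xs = ⟦ content? α xs ⟧

hasContent⁻ : ∀ {n} (α : Fin n → ℕ) xs → T (hasContent α xs) → Content α xs
hasContent⁻ α xs t c = ≡ᵇ⇒≡ (cnt c xs) (α c) (allFin⁻ (λ c → cnt c xs ≡ᵇ α c) t c)

hasContent⁺ : ∀ {n} (α : Fin n → ℕ) xs → Content α xs → T (hasContent α xs)
hasContent⁺ α xs h = allFin⁺ (λ c → cnt c xs ≡ᵇ α c) (λ c → ≡⇒≡ᵇ (cnt c xs) (α c) (h c))

ind-hasContent : ∀ {n} (α : Fin n → ℕ) xs → ind (hasContent α xs) ≡ H α xs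
ind-hasContent α xs = ⟦⟧-⇔ (T? (hasContent α xs)) (content? α xs) (hasContent⁻ α xs) (hasContent⁺ α xs)

H-↭ : ∀ {n} (α : Fin n → ℕ) {xs ys} → xs ↭ ys → H α xs ≡ H α ys
H-↭ α {xs} {ys} p = ⟦⟧-⇔ (content? α xs) (content? α ys)
  (λ h c → trans (sym (cnt-↭ c p)) (h c)) (λ h c → trans (cnt-↭ c p) (h c))

sub : ∀ {n} → (Fin n → ℕ) → List (Fin n) → Fin n → ℕ
sub α zs c = α c ∸ cnt c zs

H-++ : ∀ {n} (α : Fin n → ℕ) zs xs → (∀ c → cnt c zs ≤ α c) → H α (zs ++ xs) ≡ H (sub α zs) xs
H-++ α zs xs zs≤α = ⟦⟧-⇔ (content? α (zs ++ xs)) (content? (sub α zs) xs)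
  (λ h c → trans (sym (m+n∸m≡n (cnt c zs) (cnt c xs))) (cong (_∸ cnt c zs) (trans (sym (cnt-++ c zs xs)) (h c))))
  (λ h c → trans (cnt-++ c zs xs) (trans (cong (cnt c zs +_) (h c)) (m+[n∸m]≡n (zs≤α c))))

H-++-zero : ∀ {n} (α : Fin n → ℕ) zs xs → ¬ (∀ c → cnt c zs ≤ α c) → H α (zs ++ xs) ≡ 0
H-++-zero α zs xs zs≰α = ⟦⟧-no (content? α (zs ++ xs))
  (λ h → zs≰α (λ c → ≤-trans (m≤m+n _ _) (≤-reflexive (trans (sym (cnt-++ c zs xs)) (h c)))))

∑-sub : ∀ {n} (α : Fin n → ℕ) zs → (∀ c → cnt c zs ≤ α c) → ∑ α ≡ length zs + ∑ (sub α zs)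
∑-sub α zs zs≤α = begin
  ∑ α                                    ≡⟨ ∑-cong (λ c → m+[n∸m]≡n (zs≤α c)) ⟨
  ∑ (λ c → cnt c zs + sub α zs c)        ≡⟨ ∑-+ _ _ ⟩
  ∑ (λ c → cnt c zs) + ∑ (sub α zs)      ≡⟨ cong (_+ ∑ (sub α zs)) (∑-cnt zs) ⟩
  length zs + ∑ (sub α zs)               ∎

-- Strictly increasing columns and words of prescribed content

-- The sum of f over the strictly increasing columns of length m with entries ≥ lo.
col : ∀ {n} → ℕ → ℕ → (List (Fin n) → ℕ) → ℕ
col zero    lo f = f []
col (suc m) lo f = ∑ λ a → ind (lo ≤ᵇ toℕ a) * col m (suc (toℕ a)) (f ∘ (a ∷_))

col-cong : ∀ {n} m lo {f g : List (Fin n) → ℕ} → (∀ xs → f xs ≡ g xs) → col m lo f ≡ col m lo g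
col-cong zero    lo eq = eq []
col-cong (suc m) lo eq = ∑-cong λ a → cong (ind (lo ≤ᵇ toℕ a) *_) (col-cong m _ (eq ∘ (a ∷_)))

*-col : ∀ {n} m lo x (f : List (Fin n) → ℕ) → col m lo (λ xs → x * f xs) ≡ x * col m lo f
*-col zero    lo x f = refl
*-col (suc m) lo x f = begin
  ∑ (λ a → ind (lo ≤ᵇ toℕ a) * col m (suc (toℕ a)) (λ xs → x * f (a ∷ xs)))
    ≡⟨ ∑-cong (λ a → begin
         ind (lo ≤ᵇ toℕ a) * col m (suc (toℕ a)) (λ xs → x * f (a ∷ xs))
           ≡⟨ cong (ind (lo ≤ᵇ toℕ a) *_) (*-col m _ x (f ∘ (a ∷_))) ⟩
         ind (lo ≤ᵇ toℕ a) * (x * col m (suc (toℕ a)) (f ∘ (a ∷_)))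
           ≡⟨ *-CS.x∙yz≈y∙xz (ind (lo ≤ᵇ toℕ a)) x _ ⟩
         x * (ind (lo ≤ᵇ toℕ a) * col m (suc (toℕ a)) (f ∘ (a ∷_))) ∎) ⟩
  ∑ (λ a → x * (ind (lo ≤ᵇ toℕ a) * col m (suc (toℕ a)) (f ∘ (a ∷_))))
    ≡⟨ *-∑ x _ ⟨
  x * col (suc m) lo f ∎

col-zero : ∀ {n} m lo (f : List (Fin n) → ℕ) → (∀ xs → f xs ≡ 0) → col m lo f ≡ 0
col-zero m lo f eq = trans (col-cong m lo eq) (*-col m lo 0 (λ _ → 0))

col-suc : ∀ {n} m lo (f : List (Fin (suc n)) → ℕ) → col m (suc lo) f ≡ col m lo (f ∘ map suc)
col-suc zero    lo      f = refl
col-suc (suc m) zero    f = trans (∑-suc _) (∑-cong λ a → cong (1 *_) (col-suc m _ (f ∘ (suc a ∷_))))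
col-suc (suc m) (suc l) f = trans (∑-suc _) (∑-cong λ a → cong (ind (suc l ≤ᵇ toℕ a) *_) (col-suc m _ (f ∘ (suc a ∷_))))

col-split : ∀ {n} m (f : List (Fin (suc n)) → ℕ) →
  col (suc m) 0 f ≡ col m 0 (λ xs → f (zero ∷ map suc xs)) + col (suc m) 0 (f ∘ map suc)
col-split m f = trans (∑-suc _) (cong₂ _+_
  (trans (+-identityʳ _) (col-suc m 0 (f ∘ (zero ∷_))))
  (∑-cong λ a → cong (1 *_) (col-suc m (suc (toℕ a)) (f ∘ (suc a ∷_)))))

H-map-suc : ∀ {n} (β : Fin (suc n) → ℕ) xs → H β (map suc xs) ≡ ⟦ β zero ≟ 0 ⟧ * H (β ∘ suc) xs
H-map-suc β xs = trans
  (⟦⟧-⇔ (content? β (map suc xs)) ((β zero ≟ 0) ×-dec content? (β ∘ suc) xs)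
    (λ h → trans (sym (h zero)) (cnt-zero-map-suc xs) , λ c → trans (sym (cnt-suc-map-suc c xs)) (h (suc c)))
    (λ { (h₀ , h) zero → trans (cnt-zero-map-suc xs) (sym h₀) ; (h₀ , h) (suc c) → trans (cnt-suc-map-suc c xs) (h c) }))
  (⟦⟧-× (β zero ≟ 0) (content? (β ∘ suc) xs))

H-zero∷map-suc : ∀ {n} (β : Fin (suc n) → ℕ) xs → H β (zero ∷ map suc xs) ≡ ⟦ β zero ≟ 1 ⟧ * H (β ∘ suc) xs
H-zero∷map-suc β xs = trans
  (⟦⟧-⇔ (content? β (zero ∷ map suc xs)) ((β zero ≟ 1) ×-dec content? (β ∘ suc) xs)
    (λ h → trans (sym (h zero)) (cong suc (cnt-zero-map-suc xs)) , λ c → trans (sym (cnt-suc-map-suc c xs)) (h (suc c)))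
    (λ { (h₀ , h) zero → trans (cong suc (cnt-zero-map-suc xs)) (sym h₀) ; (h₀ , h) (suc c) → trans (cnt-suc-map-suc c xs) (h c) }))
  (⟦⟧-× (β zero ≟ 1) (content? (β ∘ suc) xs))

≤1? : ∀ {n} (β : Fin n → ℕ) → Dec (∀ c → β c ≤ 1)
≤1? β = allFin? (λ c → β c ≤? 1)

-- A strictly increasing column is determined by its content, which may be any 0/1-vector of the right size.
col-H : ∀ {n} p (β : Fin n → ℕ) → col p 0 (H β) ≡ ⟦ ≤1? β ⟧ * ⟦ ∑ β ≟ p ⟧
col-H {zero}  (suc p) β = trans (∑-empty _) (sym (trans (cong (λ s → ⟦ ≤1? β ⟧ * ⟦ s ≟ suc p ⟧) (∑-empty β)) (*-zeroʳ ⟦ ≤1? β ⟧)))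
col-H {n}     zero    β = trans
  (⟦⟧-⇔ (content? β []) (≤1? β ×-dec (∑ β ≟ 0))
    (λ h → (λ c → subst (_≤ 1) (h c) z≤n) , ∑-zero β (sym ∘ h))
    (λ { (_ , e) c → sym (∑≡0⇒≡0 β e c) }))
  (⟦⟧-× (≤1? β) (∑ β ≟ 0))
col-H {suc n} (suc p) β = begin
  col (suc p) 0 (H β)
    ≡⟨ col-split p (H β) ⟩
  col p 0 (λ xs → H β (zero ∷ map suc xs)) + col (suc p) 0 (H β ∘ map suc)
    ≡⟨ cong₂ _+_ (trans (col-cong p 0 (H-zero∷map-suc β)) (*-col p 0 ⟦ β zero ≟ 1 ⟧ (H (β ∘ suc))))
                 (trans (col-cong (suc p) 0 (H-map-suc β)) (*-col (suc p) 0 ⟦ β zero ≟ 0 ⟧ (H (β ∘ suc)))) ⟩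
  ⟦ β zero ≟ 1 ⟧ * col p 0 (H (β ∘ suc)) + ⟦ β zero ≟ 0 ⟧ * col (suc p) 0 (H (β ∘ suc))
    ≡⟨ cong₂ (λ x y → ⟦ β zero ≟ 1 ⟧ * x + ⟦ β zero ≟ 0 ⟧ * y) (col-H p (β ∘ suc)) (col-H (suc p) (β ∘ suc)) ⟩
  ⟦ β zero ≟ 1 ⟧ * (⟦ ≤1? (β ∘ suc) ⟧ * ⟦ ∑ (β ∘ suc) ≟ p ⟧) + ⟦ β zero ≟ 0 ⟧ * (⟦ ≤1? (β ∘ suc) ⟧ * ⟦ ∑ (β ∘ suc) ≟ suc p ⟧)
    ≡⟨ first (β zero) ⟩
  ⟦ (β zero ≤? 1) ×-dec ≤1? (β ∘ suc) ⟧ * ⟦ β zero + r ≟ suc p ⟧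
    ≡⟨ cong (λ s → ⟦ (β zero ≤? 1) ×-dec ≤1? (β ∘ suc) ⟧ * ⟦ s ≟ suc p ⟧) (∑-suc β) ⟨
  ⟦ (β zero ≤? 1) ×-dec ≤1? (β ∘ suc) ⟧ * ⟦ ∑ β ≟ suc p ⟧
    ≡⟨ cong (_* ⟦ ∑ β ≟ suc p ⟧) (⟦⟧-⇔ ((β zero ≤? 1) ×-dec ≤1? (β ∘ suc)) (≤1? β)
         (λ { (h₀ , h) zero → h₀ ; (h₀ , h) (suc c) → h c }) (λ h → h zero , h ∘ suc)) ⟩
  ⟦ ≤1? β ⟧ * ⟦ ∑ β ≟ suc p ⟧ ∎
  where
  r = ∑ (β ∘ suc)
  first : ∀ b → ⟦ b ≟ 1 ⟧ * (⟦ ≤1? (β ∘ suc) ⟧ * ⟦ r ≟ p ⟧) + ⟦ b ≟ 0 ⟧ * (⟦ ≤1? (β ∘ suc) ⟧ * ⟦ r ≟ suc p ⟧)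
                ≡ ⟦ (b ≤? 1) ×-dec ≤1? (β ∘ suc) ⟧ * ⟦ b + r ≟ suc p ⟧
  first 0             = +-identityʳ _
  first 1             = trans (+-identityʳ _) (+-identityʳ _)
  first (suc (suc b)) = refl

-- The quotient of x^α by the monomial of `zs` exists and is squarefree: exactly what a factor e_p
-- can supply.
Fits : ∀ {n} → (Fin n → ℕ) → List (Fin n) → Set
Fits α zs = ∀ c → cnt c zs ≤ α c × α c ≤ suc (cnt c zs)

fits? : ∀ {n} (α : Fin n → ℕ) zs → Dec (Fits α zs)
fits? α zs = allFin? (λ c → (cnt c zs ≤? α c) ×-dec (α c ≤? suc (cnt c zs)))

col-H-++ : ∀ {n} p (α : Fin n → ℕ) zs →
  col p 0 (λ xs → H α (zs ++ xs)) ≡ ⟦ fits? α zs ⟧ * ⟦ ∑ α ≟ length zs + p ⟧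
col-H-++ p α zs with allFin? (λ c → cnt c zs ≤? α c)
... | no zs≰α = trans (col-zero p 0 _ (λ xs → H-++-zero α zs xs zs≰α))
                 (cong (_* ⟦ ∑ α ≟ length zs + p ⟧) (sym (⟦⟧-no (fits? α zs) (λ h → zs≰α (proj₁ ∘ h)))))
... | yes zs≤α = begin
  col p 0 (λ xs → H α (zs ++ xs))                  ≡⟨ col-cong p 0 (λ xs → H-++ α zs xs zs≤α) ⟩
  col p 0 (H (sub α zs))                           ≡⟨ col-H p (sub α zs) ⟩
  ⟦ ≤1? (sub α zs) ⟧ * ⟦ ∑ (sub α zs) ≟ p ⟧        ≡⟨ cong₂ _*_
    (⟦⟧-⇔ (≤1? (sub α zs)) (fits? α zs)
       (λ h c → zs≤α c , subst (_≤ suc (cnt c zs)) (m+[n∸m]≡n (zs≤α c)) (≤-trans (+-monoʳ-≤ (cnt c zs) (h c)) (≤-reflexive (+-comm (cnt c zs) 1))))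
       (λ h c → m≤n+o⇒m∸n≤o (α c) (cnt c zs) (≤-trans (proj₂ (h c)) (≤-reflexive (+-comm 1 (cnt c zs))))))
    (⟦⟧-⇔ (∑ (sub α zs) ≟ p) (∑ α ≟ length zs + p)
       (λ e → trans (∑-sub α zs zs≤α) (cong (length zs +_) e))
       (λ e → +-cancelˡ-≡ (length zs) _ _ (trans (sym (∑-sub α zs zs≤α)) e))) ⟩
  ⟦ fits? α zs ⟧ * ⟦ ∑ α ≟ length zs + p ⟧         ∎

∑v : ∀ {n} d → (Vec (Fin n) d → ℕ) → ℕ
∑v zero    f = f []
∑v (suc d) f = ∑ λ a → ∑v d (f ∘ (a ∷_))

∑v-cong : ∀ {n} d {f g : Vec (Fin n) d → ℕ} → (∀ xs → f xs ≡ g xs) → ∑v d f ≡ ∑v d g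
∑v-cong zero    eq = eq []
∑v-cong (suc d) eq = ∑-cong λ a → ∑v-cong d (eq ∘ (a ∷_))

*-∑v : ∀ {n} d x (f : Vec (Fin n) d → ℕ) → ∑v d (λ xs → x * f xs) ≡ x * ∑v d f
*-∑v zero    x f = refl
*-∑v (suc d) x f = trans (∑-cong λ a → *-∑v d x (f ∘ (a ∷_))) (sym (*-∑ x _))

∑v-zero : ∀ {n} d (f : Vec (Fin n) d → ℕ) → (∀ xs → f xs ≡ 0) → ∑v d f ≡ 0
∑v-zero d f eq = trans (∑v-cong d eq) (*-∑v d 0 (λ _ → 0))

-- Used for the clique, whose vertices are distinguishable. A first letter a leaves p! words if β a
-- = 1 and none if β a = 0; `C * β a` covers both cases, and ∑ β = p + 1 turns p! into (p + 1)!.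
words : ∀ {n} p (β : Fin n → ℕ) → (∀ c → β c ≤ 1) → ∑v p (H β ∘ toList) ≡ ⟦ ∑ β ≟ p ⟧ * p !
words zero β β≤1 = begin
  H β []                       ≡⟨ col-H 0 β ⟩
  ⟦ ≤1? β ⟧ * ⟦ ∑ β ≟ 0 ⟧      ≡⟨ cong (_* ⟦ ∑ β ≟ 0 ⟧) (⟦⟧-yes (≤1? β) β≤1) ⟩
  1 * ⟦ ∑ β ≟ 0 ⟧              ≡⟨ *-comm 1 _ ⟩
  ⟦ ∑ β ≟ 0 ⟧ * 1              ∎
words (suc p) β β≤1 = begin
  ∑ (λ a → ∑v p (λ xs → H β (a ∷ toList xs)))  ≡⟨ ∑-cong first ⟩
  ∑ (λ a → C * β a)                            ≡⟨ *-∑ C β ⟨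
  C * ∑ β                                      ≡⟨ last (∑ β ≟ suc p) ⟩
  ⟦ ∑ β ≟ suc p ⟧ * suc p !                    ∎
  where
  C = ⟦ ∑ β ≟ suc p ⟧ * p !
  last : (e : Dec (∑ β ≡ suc p)) → ⟦ e ⟧ * p ! * ∑ β ≡ ⟦ e ⟧ * suc p !
  last (yes e) rewrite e = trans (cong (_* suc p) (+-identityʳ (p !))) (trans (*-comm (p !) (suc p)) (sym (+-identityʳ _)))
  last (no _)  = refl
  first : ∀ a → ∑v p (λ xs → H β (a ∷ toList xs)) ≡ C * β a
  first a with allFin? (λ c → cnt c (a ∷ []) ≤? β c)
  ... | no a≰β = trans (∑v-zero p _ (λ xs → H-++-zero β (a ∷ []) (toList xs) a≰β))
                   (sym (trans (cong (C *_) (n≤0⇒n≡0 (≮⇒≥ β≯0))) (*-zeroʳ C)))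
    where
    β≯0 : ¬ (1 ≤ β a)
    β≯0 1≤βa = a≰β (λ c → subst (_≤ β c) (sym (cnt-∷ c a [])) (go c (eq? c a)))
      where
      go : ∀ c (e : Dec (c ≡ a)) → ⟦ e ⟧ + 0 ≤ β c
      go c (yes refl) = 1≤βa
      go c (no _)     = z≤n
  ... | yes a≤β = begin
    ∑v p (λ xs → H β (a ∷ toList xs))      ≡⟨ ∑v-cong p (λ xs → H-++ β (a ∷ []) (toList xs) a≤β) ⟩
    ∑v p (H (sub β (a ∷ [])) ∘ toList)     ≡⟨ words p (sub β (a ∷ [])) (λ c → ≤-trans (m∸n≤m (β c) (cnt c (a ∷ []))) (β≤1 c)) ⟩
    ⟦ ∑ (sub β (a ∷ [])) ≟ p ⟧ * p !       ≡⟨ cong (_* p !) (⟦⟧-⇔ (∑ (sub β (a ∷ [])) ≟ p) (∑ β ≟ suc p)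
                                               (λ e → trans (∑-sub β (a ∷ []) a≤β) (cong suc e))
                                               (λ e → suc-injective (trans (sym (∑-sub β (a ∷ []) a≤β)) e))) ⟩
    C                                      ≡⟨ *-identityʳ C ⟨
    C * 1                                  ≡⟨ cong (C *_) (≤-antisym (subst (_≤ β a) (trans (cnt-∷ a a []) (cong (_+ 0) (⟦⟧-yes (eq? a a) refl))) (a≤β a)) (β≤1 a)) ⟩
    C * β a                                ∎

-- Schur coefficients as nested sums

ind-∧ : ∀ a b → ind (a ∧ b) ≡ ind a * ind b
ind-∧ true  b = sym (+-identityʳ _)
ind-∧ false b = refl

sumL : {A : Set} → (A → ℕ) → List A → ℕ
sumL f xs = sum (map f xs)

sumL-cong : {A : Set} {f g : A → ℕ} → (∀ x → f x ≡ g x) → ∀ xs → sumL f xs ≡ sumL g xs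
sumL-cong eq xs = cong sum (map-cong eq xs)

countᵇ-sumL : {A : Set} (p : A → Bool) (xs : List A) → countᵇ p xs ≡ sumL (ind ∘ p) xs
countᵇ-sumL p []       = refl
countᵇ-sumL p (x ∷ xs) with p x
... | true  = cong suc (countᵇ-sumL p xs)
... | false = countᵇ-sumL p xs

*-sumL : {A : Set} (k : ℕ) (f : A → ℕ) (xs : List A) → sumL (λ x → k * f x) xs ≡ k * sumL f xs
*-sumL k f []       = sym (*-zeroʳ k)
*-sumL k f (x ∷ xs) = trans (cong (k * f x +_) (*-sumL k f xs)) (sym (*-distribˡ-+ k (f x) _))

sumL-map : {A B : Set} (f : B → ℕ) (g : A → B) (xs : List A) → sumL f (map g xs) ≡ sumL (f ∘ g) xs
sumL-map f g xs = cong sum (sym (map-∘ xs))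

sumL-concatMap : {A B : Set} (f : B → ℕ) (g : A → List B) (xs : List A) →
                 sumL f (concatMap g xs) ≡ sumL (sumL f ∘ g) xs
sumL-concatMap f g []       = refl
sumL-concatMap f g (x ∷ xs) = begin
  sum (map f (g x ++ concatMap g xs))             ≡⟨ cong sum (map-++ f (g x) _) ⟩
  sum (map f (g x) ++ map f (concatMap g xs))     ≡⟨ sum-++ (map f (g x)) _ ⟩
  sumL f (g x) + sumL f (concatMap g xs)          ≡⟨ cong (sumL f (g x) +_) (sumL-concatMap f g xs) ⟩
  sumL f (g x) + sumL (sumL f ∘ g) xs             ∎

sumL-tabulate : ∀ {A : Set} {n} (f : A → ℕ) (g : Fin n → A) → sumL f (tabulate g) ≡ ∑ (f ∘ g)
sumL-tabulate {n = zero}  f g = sym (∑-empty _)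
sumL-tabulate {n = suc n} f g = trans (cong (f (g zero) +_) (sumL-tabulate f (g ∘ suc))) (sym (∑-suc (f ∘ g)))

sumL-allVecs : ∀ {n} d (f : Vec (Fin n) d → ℕ) → sumL f (allVecs n d) ≡ ∑v d f
sumL-allVecs zero    f = +-identityʳ _
sumL-allVecs {n} (suc d) f = begin
  sumL f (allVecs n (suc d))
    ≡⟨ sumL-concatMap f (λ a → map (a ∷_) (allVecs n d)) (allFin n) ⟩
  sumL (λ a → sumL f (map (a ∷_) (allVecs n d))) (allFin n)
    ≡⟨ sumL-tabulate _ id ⟩
  ∑ (λ a → sumL f (map (a ∷_) (allVecs n d)))
    ≡⟨ ∑-cong (λ a → trans (sumL-map f (a ∷_) (allVecs n d)) (sumL-allVecs d (f ∘ (a ∷_)))) ⟩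
  ∑v (suc d) f ∎

sumL-fillings : ∀ {n} r rs (f : List (List (Fin n)) → ℕ) →
  sumL f (fillings n (r ∷ rs)) ≡ ∑v r (λ row → sumL (f ∘ (toList row ∷_)) (fillings n rs))
sumL-fillings {n} r rs f = begin
  sumL f (fillings n (r ∷ rs))
    ≡⟨ sumL-concatMap f (λ row → map (toList row ∷_) (fillings n rs)) (allVecs n r) ⟩
  sumL (λ row → sumL f (map (toList row ∷_) (fillings n rs))) (allVecs n r)
    ≡⟨ sumL-allVecs r _ ⟩
  ∑v r (λ row → sumL f (map (toList row ∷_) (fillings n rs)))
    ≡⟨ ∑v-cong r (λ row → sumL-map f (toList row ∷_) (fillings n rs)) ⟩
  ∑v r (λ row → sumL (f ∘ (toList row ∷_)) (fillings n rs)) ∎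

-- The tableaux whose first row is the given one and whose remaining rows have lengths rs.
tableaux : ∀ {n} → List (Fin n) → List ℕ → (List (Fin n) → ℕ) → ℕ
tableaux {n} row rs f = sumL (λ T → ind (isSSYTᵇ (row ∷ T)) * f (concat T)) (fillings n rs)

tableaux-∷ : ∀ {n} (row : List (Fin n)) r rs f →
  tableaux row (r ∷ rs) f
    ≡ ∑v r (λ row′ → ind (weaklyIncᵇ row) * ind (colStrictᵇ row (toList row′)) * tableaux (toList row′) rs (f ∘ (toList row′ ++_)))
tableaux-∷ {n} row r rs f = trans (sumL-fillings r rs _) (∑v-cong r λ row′ → trans
  (sumL-cong (λ T → trans
    (cong (_* f (toList row′ ++ concat T)) (begin
      ind (weaklyIncᵇ row ∧ colStrictᵇ row (toList row′) ∧ isSSYTᵇ (toList row′ ∷ T))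
        ≡⟨ trans (ind-∧ (weaklyIncᵇ row) _) (cong (ind (weaklyIncᵇ row) *_) (ind-∧ (colStrictᵇ row (toList row′)) _)) ⟩
      ind (weaklyIncᵇ row) * (ind (colStrictᵇ row (toList row′)) * ind (isSSYTᵇ (toList row′ ∷ T)))
        ≡⟨ *-assoc (ind (weaklyIncᵇ row)) _ _ ⟨
      ind (weaklyIncᵇ row) * ind (colStrictᵇ row (toList row′)) * ind (isSSYTᵇ (toList row′ ∷ T)) ∎))
    (*-assoc (ind (weaklyIncᵇ row) * ind (colStrictᵇ row (toList row′))) _ _))
    (fillings n rs))
  (*-sumL (ind (weaklyIncᵇ row) * ind (colStrictᵇ row (toList row′))) _ (fillings n rs)))

-- Rows of length one are weakly increasing, and column strictness compares them only with the first
-- entry of the row above, so they form a strict column with entries greater than `d`.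
tableaux-1ᵐ : ∀ {n} (d : Fin n) ds m f →
  tableaux (d ∷ ds) (replicate m 1) f ≡ ind (weaklyIncᵇ (d ∷ ds)) * col m (suc (toℕ d)) f
tableaux-1ᵐ d ds zero f = +-identityʳ _
tableaux-1ᵐ d ds (suc m) f = trans (tableaux-∷ (d ∷ ds) 1 (replicate m 1) f) (trans
  (∑-cong λ a → trans
    (cong₂ _*_ (cong (ind (weaklyIncᵇ (d ∷ ds)) *_) (trans (ind-∧ (toℕ d <ᵇ toℕ a) true) (*-identityʳ (ind (toℕ d <ᵇ toℕ a)))))
               (trans (tableaux-1ᵐ a [] m (f ∘ (a ∷_))) (+-identityʳ _)))
    (*-assoc (ind (weaklyIncᵇ (d ∷ ds))) _ _))
  (sym (*-∑ (ind (weaklyIncᵇ (d ∷ ds))) _)))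

schurCoeff-∷ : ∀ {n} r rs (α : Fin n → ℕ) →
  schurCoeff (r ∷ rs) n α ≡ ∑v r (λ row → tableaux (toList row) rs (H α ∘ (toList row ++_)))
schurCoeff-∷ {n} r rs α = begin
  schurCoeff (r ∷ rs) n α
    ≡⟨ countᵇ-sumL _ (fillings n (r ∷ rs)) ⟩
  sumL (λ T → ind (isSSYTᵇ T ∧ hasContent α (concat T))) (fillings n (r ∷ rs))
    ≡⟨ sumL-cong (λ T → trans (ind-∧ (isSSYTᵇ T) _) (cong (ind (isSSYTᵇ T) *_) (ind-hasContent α (concat T)))) (fillings n (r ∷ rs)) ⟩
  sumL (λ T → ind (isSSYTᵇ T) * H α (concat T)) (fillings n (r ∷ rs))
    ≡⟨ sumL-fillings r rs _ ⟩
  ∑v r (λ row → tableaux (toList row) rs (H α ∘ (toList row ++_))) ∎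

-- Pieri-type identities

∑ⁿ : ∀ {n} k → N-ary k (Fin n) ℕ → ℕ
∑ⁿ zero    x = x
∑ⁿ (suc k) F = ∑ λ a → ∑ⁿ k (F a)

Pointwise : ∀ {n} k → (ℕ → ℕ → Set) → N-ary k (Fin n) ℕ → N-ary k (Fin n) ℕ → Set
Pointwise zero    R x y = R x y
Pointwise (suc k) R F G = ∀ a → Pointwise k R (F a) (G a)

PointwiseSum : ∀ {n} k → (F G H : N-ary k (Fin n) ℕ) → Set
PointwiseSum zero    x y z = x ≡ y + z
PointwiseSum (suc k) F G H = ∀ a → PointwiseSum k (F a) (G a) (H a)

∑ⁿ-cong : ∀ {n} k {F G : N-ary k (Fin n) ℕ} → Pointwise k _≡_ F G → ∑ⁿ k F ≡ ∑ⁿ k G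
∑ⁿ-cong zero    eq = eq
∑ⁿ-cong (suc k) eq = ∑-cong λ a → ∑ⁿ-cong k (eq a)

*-∑ⁿ : ∀ {n} k x {F G : N-ary k (Fin n) ℕ} → Pointwise k (λ y z → x * y ≡ z) F G → x * ∑ⁿ k F ≡ ∑ⁿ k G
*-∑ⁿ zero    x eq = eq
*-∑ⁿ (suc k) x eq = trans (*-∑ x _) (∑-cong λ a → *-∑ⁿ k x (eq a))

∑ⁿ-+ : ∀ {n} k {F G H : N-ary k (Fin n) ℕ} → PointwiseSum k F G H → ∑ⁿ k F ≡ ∑ⁿ k G + ∑ⁿ k H
∑ⁿ-+ zero    eq = eq
∑ⁿ-+ (suc k) eq = trans (∑-cong λ a → ∑ⁿ-+ k (eq a)) (∑-+ _ _)

⟦⟧-merge : ∀ {P Q : Set} (P? : Dec P) (Q? : Dec Q) x → ⟦ P? ⟧ * (⟦ Q? ⟧ * x) ≡ ⟦ P? ×-dec Q? ⟧ * x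
⟦⟧-merge P? Q? x = trans (sym (*-assoc ⟦ P? ⟧ ⟦ Q? ⟧ x)) (cong (_* x) (sym (⟦⟧-× P? Q?)))

-- The engine of the Pieri-type identities: the index set is cut in two, and the summand may be
-- rewritten differently on each part.
⟦⟧-split : ∀ {P Q R : Set} (P? : Dec P) (Q? : Dec Q) (R? : Dec R) →
  (P → Q ⊎ R) → (Q → P) → (R → P) → (Q → ¬ R) → ∀ {x y z} → x ≡ y → x ≡ z → ⟦ P? ⟧ * x ≡ ⟦ Q? ⟧ * y + ⟦ R? ⟧ * z
⟦⟧-split P? Q? R? f g h d {x} refl refl = trans (cong (_* x) (⟦⟧-⊎ P? Q? R? f g h d)) (*-distribʳ-+ x ⟦ Q? ⟧ ⟦ R? ⟧)

module _ {n : ℕ} where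

  infix 5 _≼?_ _≺?_

  -- These decisions compute to `≤ᵇ` and `<ᵇ`, the tests that occur in `col` and `isSSYTᵇ`.
  _≼?_ : (a b : Fin n) → Dec (toℕ a ≤ toℕ b)
  a ≼? b = toℕ a ≤? toℕ b

  _≺?_ : (a b : Fin n) → Dec (toℕ a < toℕ b)
  a ≺? b = toℕ a <? toℕ b

  col-1 : ∀ m (F : List (Fin n) → ℕ) → col (1 + m) 0 F ≡ ∑ λ a → col m (suc (toℕ a)) (F ∘ (a ∷_))
  col-1 m F = ∑-cong λ a → +-identityʳ _

  col-above-2 : ∀ m (x : Fin n) (F : List (Fin n) → ℕ) →
    col (2 + m) (suc (toℕ x)) F ≡ ∑ λ y → ∑ λ z → ⟦ x ≺? y ×-dec y ≺? z ⟧ * col m (suc (toℕ z)) (λ A → F (y ∷ z ∷ A))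
  col-above-2 m x F = ∑-cong λ y → *-∑ⁿ 1 ⟦ x ≺? y ⟧ λ z → ⟦⟧-merge (x ≺? y) (y ≺? z) _

  col-above-3 : ∀ m (x : Fin n) (F : List (Fin n) → ℕ) →
    col (3 + m) (suc (toℕ x)) F ≡ ∑ λ y → ∑ λ z → ∑ λ w →
      ⟦ x ≺? y ×-dec y ≺? z ×-dec z ≺? w ⟧ * col m (suc (toℕ w)) (λ A → F (y ∷ z ∷ w ∷ A))
  col-above-3 m x F = ∑-cong λ y →
    trans (cong (⟦ x ≺? y ⟧ *_) (col-above-2 m y (F ∘ (y ∷_)))) (*-∑ⁿ 2 ⟦ x ≺? y ⟧ λ z w → ⟦⟧-merge (x ≺? y) (y ≺? z ×-dec z ≺? w) _)

  module _ (f : List (Fin n) → ℕ) where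

    -- For f = H α: the coefficient of x^α in e_p · ∏_{z ∈ zs} x_z.
    e : ℕ → List (Fin n) → ℕ
    e p zs = col p 0 (λ A → f (zs ++ A))

    -- s-μ m sums f over the semistandard tableaux of shape (μ, 1^m); a, a′, a″ is the beginning of the first column.
    s-2 s-3 s-22 s-32 s-222 : ℕ → ℕ
    s-2 m = ∑ λ a → ∑ λ b → ⟦ a ≼? b ⟧ * col m (suc (toℕ a)) (λ A → f (a ∷ b ∷ A))
    s-3 m = ∑ λ a → ∑ λ b → ∑ λ c → ⟦ a ≼? b ×-dec b ≼? c ⟧ * col m (suc (toℕ a)) (λ A → f (a ∷ b ∷ c ∷ A))
    s-22 m = ∑ λ a → ∑ λ b → ∑ λ a′ → ∑ λ b′ →
      ⟦ a ≼? b ×-dec a′ ≼? b′ ×-dec a ≺? a′ ×-dec b ≺? b′ ⟧ * col m (suc (toℕ a′)) (λ A → f (a ∷ b ∷ a′ ∷ b′ ∷ A))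
    s-32 m = ∑ λ a → ∑ λ b → ∑ λ c → ∑ λ a′ → ∑ λ b′ →
      ⟦ a ≼? b ×-dec b ≼? c ×-dec a′ ≼? b′ ×-dec a ≺? a′ ×-dec b ≺? b′ ⟧ * col m (suc (toℕ a′)) (λ A → f (a ∷ b ∷ c ∷ a′ ∷ b′ ∷ A))
    s-222 m = ∑ λ a → ∑ λ b → ∑ λ a′ → ∑ λ b′ → ∑ λ a″ → ∑ λ b″ →
      ⟦ a ≼? b ×-dec a′ ≼? b′ ×-dec a″ ≼? b″ ×-dec a ≺? a′ ×-dec b ≺? b′ ×-dec a′ ≺? a″ ×-dec b′ ≺? b″ ⟧
        * col m (suc (toℕ a″)) (λ A → f (a ∷ b ∷ a′ ∷ b′ ∷ a″ ∷ b″ ∷ A))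

  module Pieri (f : List (Fin n) → ℕ) (f-↭ : ∀ {xs ys} → xs ↭ ys → f xs ≡ f ys) where

    -- Re-sorting two columns keeps the entries and changes only the order in which they are read;
    -- this absorbs the change.
    col-↭ : ∀ m lo {xs ys} → xs ↭ ys → col m lo (λ A → f (xs ++ A)) ≡ col m lo (λ A → f (ys ++ A))
    col-↭ m lo p = col-cong m lo λ A → f-↭ (++⁺ʳ A p)

    e-1 : ∀ m zs → e f (1 + m) zs ≡ ∑ λ a → col m (suc (toℕ a)) (λ A → f (zs ++ a ∷ A))
    e-1 m zs = col-1 m (λ A → f (zs ++ A))

    -- The box `b` is compared with the top `a` of the column: a ≤ b makes it the second box of the
    -- first row, b < a puts it on top of the column.
    e·e₁ : ∀ m → ∑ (λ b → e f (1 + m) (b ∷ [])) ≡ s-2 f m + e f (2 + m) []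
    e·e₁ m = begin
      ∑ (λ b → e f (1 + m) (b ∷ []))
        ≡⟨ ∑-cong (λ b → e-1 m (b ∷ [])) ⟩
      ∑ (λ b → ∑ λ a → X b a)
        ≡⟨ ∑ⁿ-+ 2 (λ b a → trans (sym (+-identityʳ (X b a))) (⟦⟧-split (yes tt) (a ≼? b) (b ≺? a)
             (λ _ → ≤-<-connex (toℕ a) (toℕ b)) _ _ ≤⇒≯ (col-↭ m _ (swap b a ↭-refl)) refl)) ⟩
      ∑ (λ b → ∑ λ a → ⟦ a ≼? b ⟧ * col m (suc (toℕ a)) (λ A → f (a ∷ b ∷ A))) + ∑ (λ b → ∑ λ a → ⟦ b ≺? a ⟧ * X b a)
        ≡⟨ cong₂ _+_ (∑-swap _) (sym (col-1 (1 + m) f)) ⟩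
      s-2 f m + e f (2 + m) [] ∎
      where
      X : Fin n → Fin n → ℕ
      X b a = col m (suc (toℕ a)) (λ A → f (b ∷ a ∷ A))

    -- As in `e·e₁`, with `c` carried along: when `b` moves on top of the column, `c` stays to its
    -- right because b ≤ c.
    e·h₂ : ∀ m → ∑ (λ b → ∑ λ c → ⟦ b ≼? c ⟧ * e f (1 + m) (b ∷ c ∷ [])) ≡ s-3 f m + s-2 f (1 + m)
    e·h₂ m = begin
      ∑ (λ b → ∑ λ c → ⟦ b ≼? c ⟧ * e f (1 + m) (b ∷ c ∷ []))
        ≡⟨ ∑ⁿ-cong 2 (λ b c → trans (cong (⟦ b ≼? c ⟧ *_) (e-1 m (b ∷ c ∷ []))) (*-∑ ⟦ b ≼? c ⟧ _)) ⟩
      ∑ (λ b → ∑ λ c → ∑ λ a → ⟦ b ≼? c ⟧ * X b c a)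
        ≡⟨ ∑ⁿ-+ 3 (λ b c a → ⟦⟧-split (b ≼? c) (a ≼? b ×-dec b ≼? c) (b ≼? c ×-dec b ≺? a)
             (λ b≤c → Data.Sum.map (_, b≤c) (b≤c ,_) (≤-<-connex (toℕ a) (toℕ b))) proj₂ proj₁
             (λ (a≤b , _) (_ , b<a) → ≤⇒≯ a≤b b<a) (col-↭ m _ (shift a (b ∷ c ∷ []) [])) refl) ⟩
      ∑ (λ b → ∑ λ c → ∑ λ a → ⟦ a ≼? b ×-dec b ≼? c ⟧ * col m (suc (toℕ a)) (λ A → f (a ∷ b ∷ c ∷ A)))
        + ∑ (λ b → ∑ λ c → ∑ λ a → ⟦ b ≼? c ×-dec b ≺? a ⟧ * X b c a)
        ≡⟨ cong₂ _+_ (trans (∑ⁿ-cong 1 λ _ → ∑-swap _) (∑-swap _))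
                     (∑ⁿ-cong 2 λ b c → sym (*-∑ⁿ 1 ⟦ b ≼? c ⟧ λ a → ⟦⟧-merge (b ≼? c) (b ≺? a) _)) ⟩
      s-3 f m + s-2 f (1 + m) ∎
      where
      X : Fin n → Fin n → Fin n → ℕ
      X b c a = col m (suc (toℕ a)) (λ A → f (b ∷ c ∷ a ∷ A))

    -- Adjacent transpositions of summation variables; composites of them bring each part into the
    -- variable order of its target.
    ∑-swap₁ : {F : N-ary 3 (Fin n) ℕ} → ∑ⁿ 3 F ≡ ∑ λ a → ∑ λ c → ∑ λ b → F a b c
    ∑-swap₁ = ∑-cong λ _ → ∑-swap _

    ∑-swap₂ : {F : N-ary 4 (Fin n) ℕ} → ∑ⁿ 4 F ≡ ∑ λ a → ∑ λ b → ∑ λ d → ∑ λ c → F a b c d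
    ∑-swap₂ = ∑ⁿ-cong 2 λ _ _ → ∑-swap _

    ∑-swap₃ : {F : N-ary 5 (Fin n) ℕ} → ∑ⁿ 5 F ≡ ∑ λ a → ∑ λ b → ∑ λ c → ∑ λ e → ∑ λ d → F a b c d e
    ∑-swap₃ = ∑ⁿ-cong 3 λ _ _ _ → ∑-swap _

    ∑-swap₄ : {F : N-ary 6 (Fin n) ℕ} → ∑ⁿ 6 F ≡ ∑ λ a → ∑ λ b → ∑ λ c → ∑ λ d → ∑ λ u → ∑ λ e → F a b c d e u
    ∑-swap₄ = ∑ⁿ-cong 4 λ _ _ _ _ → ∑-swap _

    e-3 : ∀ m zs → e f (3 + m) zs ≡ ∑ λ x → ∑ λ y → ∑ λ w → ⟦ x ≺? y ×-dec y ≺? w ⟧ * col m (suc (toℕ w)) (λ A → f (zs ++ x ∷ y ∷ w ∷ A))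
    e-3 m zs = trans (e-1 (2 + m) zs) (∑-cong λ x → col-above-2 m x (λ A → f (zs ++ x ∷ A)))

    e-4 : ∀ m zs → e f (4 + m) zs ≡ ∑ λ x → ∑ λ y → ∑ λ w → ∑ λ v →
      ⟦ x ≺? y ×-dec y ≺? w ×-dec w ≺? v ⟧ * col m (suc (toℕ v)) (λ A → f (zs ++ x ∷ y ∷ w ∷ v ∷ A))
    e-4 m zs = trans (e-1 (3 + m) zs) (∑-cong λ x → col-above-3 m x (λ A → f (zs ++ x ∷ A)))

    -- If b < a, the long column becomes b, a, a′, ... and z = b′ is left over; if a ≤ b but b′ <
    -- a′, it becomes b, b′, a′, ... and z = a is left over. With x the top of the new long column,
    -- the first case has x < z and the second z ≤ x, so `R₁` and `R₂` together make up e_{m+3} e₁.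
    e·e₂ : ∀ m → ∑ (λ b → ∑ λ b′ → ⟦ b ≺? b′ ⟧ * e f (2 + m) (b ∷ b′ ∷ [])) ≡ s-22 f m + ∑ (λ z → e f (3 + m) (z ∷ []))
    e·e₂ m = begin
      ∑ (λ b → ∑ λ b′ → ⟦ b ≺? b′ ⟧ * e f (2 + m) (b ∷ b′ ∷ []))
        ≡⟨ ∑ⁿ-cong 2 (λ b b′ → trans (cong (⟦ b ≺? b′ ⟧ *_) (e-1 (1 + m) (b ∷ b′ ∷ [])))
                                     (*-∑ⁿ 2 ⟦ b ≺? b′ ⟧ λ a a′ → ⟦⟧-merge (b ≺? b′) (a ≺? a′) _)) ⟩
      ∑ (λ b → ∑ λ b′ → ∑ λ a → ∑ λ a′ → ⟦ b ≺? b′ ×-dec a ≺? a′ ⟧ * X b b′ a a′)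
        ≡⟨ ∑ⁿ-+ 4 (λ b b′ a a′ → ⟦⟧-split (b ≺? b′ ×-dec a ≺? a′) (a ≼? b ×-dec b ≺? b′ ×-dec a ≺? a′) (b ≺? a ×-dec a ≺? a′ ×-dec b ≺? b′)
             (λ (p , q) → Data.Sum.map (_, p , q) (_, q , p) (≤-<-connex (toℕ a) (toℕ b)))
             proj₂ (λ (_ , q , p) → p , q) (λ (a≤b , _) (b<a , _) → ≤⇒≯ a≤b b<a)
             refl (col-↭ m _ (swap b b′ ↭-refl))) ⟩
      ∑ (λ b → ∑ λ b′ → ∑ λ a → ∑ λ a′ → ⟦ a ≼? b ×-dec b ≺? b′ ×-dec a ≺? a′ ⟧ * X b b′ a a′)
        + ∑ (λ b → ∑ λ b′ → ∑ λ a → ∑ λ a′ → ⟦ b ≺? a ×-dec a ≺? a′ ×-dec b ≺? b′ ⟧ * X b′ b a a′)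
        ≡⟨ cong₂ _+_ (∑ⁿ-+ 4 (λ b b′ a a′ → ⟦⟧-split (a ≼? b ×-dec b ≺? b′ ×-dec a ≺? a′)
             (a ≼? b ×-dec a′ ≼? b′ ×-dec a ≺? a′ ×-dec b ≺? b′) (a ≼? b ×-dec b ≺? b′ ×-dec b′ ≺? a′)
             (λ (r , p , q) → Data.Sum.map (λ s → r , s , q , p) (λ s → r , p , s) (≤-<-connex (toℕ a′) (toℕ b′)))
             -- In the violating case a < a′ is recovered from a ≤ b < b′ < a′.
             (λ (r , _ , q , p) → r , p , q) (λ (r , p , s) → r , p , ≤-<-trans r (<-trans p s))
             (λ (_ , a′≤b′ , _) (_ , _ , b′<a′) → ≤⇒≯ a′≤b′ b′<a′)
             (col-↭ m _ (↭-trans (shift a (b ∷ b′ ∷ []) (a′ ∷ [])) (prep a (prep b (swap b′ a′ ↭-refl)))))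
             (col-↭ m _ (shift a (b ∷ b′ ∷ []) (a′ ∷ []))))) (∑-swap _) ⟩
      ∑ (λ b → ∑ λ b′ → ∑ λ a → ∑ λ a′ → ⟦ a ≼? b ×-dec a′ ≼? b′ ×-dec a ≺? a′ ×-dec b ≺? b′ ⟧ * col m (suc (toℕ a′)) (λ A → f (a ∷ b ∷ a′ ∷ b′ ∷ A)))
        + ∑ (λ b → ∑ λ b′ → ∑ λ a → ∑ λ a′ → ⟦ a ≼? b ×-dec b ≺? b′ ×-dec b′ ≺? a′ ⟧ * X a b b′ a′) + R₁
        ≡⟨ cong (_+ R₁) (cong₂ _+_ (trans ∑-swap₁ (trans (∑-swap _) ∑-swap₂)) (trans ∑-swap₁ (∑-swap _))) ⟩
      s-22 f m + R₂ + R₁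
        ≡⟨ trans (+-assoc (s-22 f m) R₂ R₁) (cong (s-22 f m +_) (sym right)) ⟩
      s-22 f m + ∑ (λ z → e f (3 + m) (z ∷ [])) ∎
      where
      X : Fin n → Fin n → Fin n → Fin n → ℕ
      X b b′ a a′ = col m (suc (toℕ a′)) (λ A → f (b ∷ b′ ∷ a ∷ a′ ∷ A))
      R₁ = ∑ (λ z → ∑ λ x → ∑ λ y → ∑ λ w → ⟦ x ≺? y ×-dec y ≺? w ×-dec x ≺? z ⟧ * X z x y w)
      R₂ = ∑ (λ z → ∑ λ x → ∑ λ y → ∑ λ w → ⟦ z ≼? x ×-dec x ≺? y ×-dec y ≺? w ⟧ * X z x y w)
      right : ∑ (λ z → e f (3 + m) (z ∷ [])) ≡ R₂ + R₁
      right = trans (∑-cong λ z → e-3 m (z ∷ [])) (∑ⁿ-+ 4 λ z x y w →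
        ⟦⟧-split (x ≺? y ×-dec y ≺? w) (z ≼? x ×-dec x ≺? y ×-dec y ≺? w) (x ≺? y ×-dec y ≺? w ×-dec x ≺? z)
          (λ (p , q) → Data.Sum.map (_, p , q) (λ s → p , q , s) (≤-<-connex (toℕ z) (toℕ x)))
          proj₂ (λ (p , q , _) → p , q) (λ (z≤x , _) (_ , _ , x<z) → ≤⇒≯ z≤x x<z) refl refl)

    -- The re-sorting of `e·e₂`, applied to the first column b < b′ of the small tableau. In both
    -- violating cases `b` becomes the top of the long column, and `c` stays beside it; hence the
    -- factor s_{2,1^{m+2}}.
    e·s₂₁ : ∀ m → ∑ (λ b → ∑ λ c → ∑ λ b′ → ⟦ b ≼? c ×-dec b ≺? b′ ⟧ * e f (2 + m) (b ∷ c ∷ b′ ∷ []))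
                  ≡ s-32 f m + ∑ (λ z → s-2 (f ∘ (z ∷_)) (2 + m))
    e·s₂₁ m = begin
      ∑ (λ b → ∑ λ c → ∑ λ b′ → ⟦ b ≼? c ×-dec b ≺? b′ ⟧ * e f (2 + m) (b ∷ c ∷ b′ ∷ []))
        ≡⟨ ∑ⁿ-cong 3 (λ b c b′ → trans (cong (⟦ b ≼? c ×-dec b ≺? b′ ⟧ *_) (e-1 (1 + m) (b ∷ c ∷ b′ ∷ [])))
                                       (*-∑ⁿ 2 ⟦ b ≼? c ×-dec b ≺? b′ ⟧ λ a a′ → ⟦⟧-merge (b ≼? c ×-dec b ≺? b′) (a ≺? a′) _)) ⟩
      ∑ (λ b → ∑ λ c → ∑ λ b′ → ∑ λ a → ∑ λ a′ → ⟦ (b ≼? c ×-dec b ≺? b′) ×-dec a ≺? a′ ⟧ * X b c b′ a a′)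
        ≡⟨ ∑ⁿ-+ 5 (λ b c b′ a a′ → ⟦⟧-split ((b ≼? c ×-dec b ≺? b′) ×-dec a ≺? a′)
             (a ≼? b ×-dec b ≼? c ×-dec b ≺? b′ ×-dec a ≺? a′) (b ≼? c ×-dec b ≺? a ×-dec a ≺? a′ ×-dec b ≺? b′)
             (λ ((r , p) , q) → Data.Sum.map (λ s → s , r , p , q) (λ s → r , s , q , p) (≤-<-connex (toℕ a) (toℕ b)))
             (λ (_ , r , p , q) → (r , p) , q) (λ (r , _ , q , p) → (r , p) , q) (λ (a≤b , _) (_ , b<a , _) → ≤⇒≯ a≤b b<a)
             refl (col-↭ m _ (shift b′ (b ∷ c ∷ []) (a ∷ a′ ∷ [])))) ⟩
      ∑ (λ b → ∑ λ c → ∑ λ b′ → ∑ λ a → ∑ λ a′ → ⟦ a ≼? b ×-dec b ≼? c ×-dec b ≺? b′ ×-dec a ≺? a′ ⟧ * X b c b′ a a′)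
        + ∑ (λ b → ∑ λ c → ∑ λ b′ → ∑ λ a → ∑ λ a′ → ⟦ b ≼? c ×-dec b ≺? a ×-dec a ≺? a′ ×-dec b ≺? b′ ⟧ * X b′ b c a a′)
        ≡⟨ cong₂ _+_ (∑ⁿ-+ 5 (λ b c b′ a a′ → ⟦⟧-split (a ≼? b ×-dec b ≼? c ×-dec b ≺? b′ ×-dec a ≺? a′)
             (a ≼? b ×-dec b ≼? c ×-dec a′ ≼? b′ ×-dec a ≺? a′ ×-dec b ≺? b′) (a ≼? b ×-dec b ≼? c ×-dec b ≺? b′ ×-dec b′ ≺? a′)
             (λ (t , r , p , q) → Data.Sum.map (λ s → t , r , s , q , p) (λ s → t , r , p , s) (≤-<-connex (toℕ a′) (toℕ b′)))
             (λ (t , r , _ , q , p) → t , r , p , q) (λ (t , r , p , s) → t , r , p , ≤-<-trans t (<-trans p s))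
             (λ (_ , _ , a′≤b′ , _) (_ , _ , _ , b′<a′) → ≤⇒≯ a′≤b′ b′<a′)
             (col-↭ m _ (↭-trans (shift a (b ∷ c ∷ b′ ∷ []) (a′ ∷ [])) (prep a (prep b (prep c (swap b′ a′ ↭-refl))))))
             (col-↭ m _ (shift a (b ∷ c ∷ b′ ∷ []) (a′ ∷ []))))) (trans ∑-swap₁ (∑-swap _)) ⟩
      ∑ (λ b → ∑ λ c → ∑ λ b′ → ∑ λ a → ∑ λ a′ → ⟦ a ≼? b ×-dec b ≼? c ×-dec a′ ≼? b′ ×-dec a ≺? a′ ×-dec b ≺? b′ ⟧
            * col m (suc (toℕ a′)) (λ A → f (a ∷ b ∷ c ∷ a′ ∷ b′ ∷ A)))
        + ∑ (λ b → ∑ λ c → ∑ λ b′ → ∑ λ a → ∑ λ a′ → ⟦ a ≼? b ×-dec b ≼? c ×-dec b ≺? b′ ×-dec b′ ≺? a′ ⟧ * X a b c b′ a′) + R₁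
        ≡⟨ cong (_+ R₁) (cong₂ _+_ (trans ∑-swap₂ (trans ∑-swap₁ (trans (∑-swap _) ∑-swap₃))) (trans ∑-swap₂ (trans ∑-swap₁ (∑-swap _)))) ⟩
      s-32 f m + R₂ + R₁
        ≡⟨ trans (+-assoc (s-32 f m) R₂ R₁) (cong (s-32 f m +_) (sym right)) ⟩
      s-32 f m + ∑ (λ z → s-2 (f ∘ (z ∷_)) (2 + m)) ∎
      where
      X : Fin n → Fin n → Fin n → Fin n → Fin n → ℕ
      X b c b′ a a′ = col m (suc (toℕ a′)) (λ A → f (b ∷ c ∷ b′ ∷ a ∷ a′ ∷ A))
      R₁ = ∑ (λ z → ∑ λ x → ∑ λ c → ∑ λ y → ∑ λ w → ⟦ x ≼? c ×-dec x ≺? y ×-dec y ≺? w ×-dec x ≺? z ⟧ * X z x c y w)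
      R₂ = ∑ (λ z → ∑ λ x → ∑ λ c → ∑ λ y → ∑ λ w → ⟦ z ≼? x ×-dec x ≼? c ×-dec x ≺? y ×-dec y ≺? w ⟧ * X z x c y w)
      right : ∑ (λ z → s-2 (f ∘ (z ∷_)) (2 + m)) ≡ R₂ + R₁
      right = trans
        (∑ⁿ-cong 3 λ z x c → trans (cong (⟦ x ≼? c ⟧ *_) (col-above-2 m x (λ A → f (z ∷ x ∷ c ∷ A))))
                                   (*-∑ⁿ 2 ⟦ x ≼? c ⟧ λ y w → ⟦⟧-merge (x ≼? c) (x ≺? y ×-dec y ≺? w) _))
        (∑ⁿ-+ 5 λ z x c y w → ⟦⟧-split (x ≼? c ×-dec x ≺? y ×-dec y ≺? w)
          (z ≼? x ×-dec x ≼? c ×-dec x ≺? y ×-dec y ≺? w) (x ≼? c ×-dec x ≺? y ×-dec y ≺? w ×-dec x ≺? z)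
          (λ (r , p , q) → Data.Sum.map (_, r , p , q) (λ s → r , p , q , s) (≤-<-connex (toℕ z) (toℕ x)))
          proj₂ (λ (r , p , q , _) → r , p , q) (λ (z≤x , _) (_ , _ , _ , x<z) → ≤⇒≯ z≤x x<z) refl refl)

    -- A first violation in row 1, 2 or 3 leaves the short column b′ b″, a b″ or a a′. Relative to
    -- the new long column x < x′ < x″ < w, a short column y < y′ then satisfies x < y (`R₁`), or y
    -- ≤ x and x′ < y′ (`R₂`), or y ≤ x and y′ ≤ x′ (`R₃`); these cases are exclusive and
    -- exhaustive.
    e·e₃ : ∀ m → ∑ (λ b → ∑ λ b′ → ∑ λ b″ → ⟦ b ≺? b′ ×-dec b′ ≺? b″ ⟧ * e f (3 + m) (b ∷ b′ ∷ b″ ∷ []))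
                 ≡ s-222 f m + ∑ (λ b → ∑ λ b′ → ⟦ b ≺? b′ ⟧ * e f (4 + m) (b ∷ b′ ∷ []))
    e·e₃ m = begin
      ∑ (λ b → ∑ λ b′ → ∑ λ b″ → ⟦ b ≺? b′ ×-dec b′ ≺? b″ ⟧ * e f (3 + m) (b ∷ b′ ∷ b″ ∷ []))
        ≡⟨ ∑ⁿ-cong 3 (λ b b′ b″ → trans (cong (⟦ b ≺? b′ ×-dec b′ ≺? b″ ⟧ *_) (e-3 m (b ∷ b′ ∷ b″ ∷ [])))
             (*-∑ⁿ 3 ⟦ b ≺? b′ ×-dec b′ ≺? b″ ⟧ λ a a′ a″ → ⟦⟧-merge (b ≺? b′ ×-dec b′ ≺? b″) (a ≺? a′ ×-dec a′ ≺? a″) _)) ⟩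
      ∑ (λ b → ∑ λ b′ → ∑ λ b″ → ∑ λ a → ∑ λ a′ → ∑ λ a″ →
          ⟦ (b ≺? b′ ×-dec b′ ≺? b″) ×-dec a ≺? a′ ×-dec a′ ≺? a″ ⟧ * X b b′ b″ a a′ a″)
        ≡⟨ ∑ⁿ-+ 6 (λ b b′ b″ a a′ a″ → ⟦⟧-split ((b ≺? b′ ×-dec b′ ≺? b″) ×-dec a ≺? a′ ×-dec a′ ≺? a″)
             (a ≼? b ×-dec b ≺? b′ ×-dec b′ ≺? b″ ×-dec a ≺? a′ ×-dec a′ ≺? a″)
             (b′ ≺? b″ ×-dec b ≺? a ×-dec a ≺? a′ ×-dec a′ ≺? a″ ×-dec b ≺? b′)
             (λ ((p , p′) , q , q′) → Data.Sum.map (λ s → s , p , p′ , q , q′) (λ s → p′ , s , q , q′ , p) (≤-<-connex (toℕ a) (toℕ b)))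
             (λ (_ , p , p′ , q , q′) → (p , p′) , q , q′) (λ (p′ , _ , q , q′ , p) → (p , p′) , q , q′)
             (λ (a≤b , _) (_ , b<a , _) → ≤⇒≯ a≤b b<a)
             refl (col-↭ m _ (↭-sym (shift b (b′ ∷ b″ ∷ []) (a ∷ a′ ∷ a″ ∷ []))))) ⟩
      ∑ (λ b → ∑ λ b′ → ∑ λ b″ → ∑ λ a → ∑ λ a′ → ∑ λ a″ →
          ⟦ a ≼? b ×-dec b ≺? b′ ×-dec b′ ≺? b″ ×-dec a ≺? a′ ×-dec a′ ≺? a″ ⟧ * X b b′ b″ a a′ a″)
        + ∑ (λ b → ∑ λ b′ → ∑ λ b″ → ∑ λ a → ∑ λ a′ → ∑ λ a″ →
          ⟦ b′ ≺? b″ ×-dec b ≺? a ×-dec a ≺? a′ ×-dec a′ ≺? a″ ×-dec b ≺? b′ ⟧ * X b′ b″ b a a′ a″)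
        ≡⟨ cong₂ _+_ (∑ⁿ-+ 6 (λ b b′ b″ a a′ a″ → ⟦⟧-split (a ≼? b ×-dec b ≺? b′ ×-dec b′ ≺? b″ ×-dec a ≺? a′ ×-dec a′ ≺? a″)
             (a ≼? b ×-dec a′ ≼? b′ ×-dec b ≺? b′ ×-dec b′ ≺? b″ ×-dec a ≺? a′ ×-dec a′ ≺? a″)
             (a ≼? b ×-dec b ≺? b′ ×-dec b′ ≺? a′ ×-dec a′ ≺? a″ ×-dec b′ ≺? b″)
             (λ (r , p , p′ , q , q′) → Data.Sum.map (λ s → r , s , p , p′ , q , q′) (λ s → r , p , s , q′ , p′) (≤-<-connex (toℕ a′) (toℕ b′)))
             (λ (r , _ , p , p′ , q , q′) → r , p , p′ , q , q′)
             (λ (r , p , s , q′ , p′) → r , p , p′ , ≤-<-trans r (<-trans p s) , q′)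
             (λ (_ , a′≤b′ , _) (_ , _ , b′<a′ , _) → ≤⇒≯ a′≤b′ b′<a′)
             refl
             (col-↭ m _ (↭-trans (shift a (b ∷ b′ ∷ b″ ∷ []) (a′ ∷ a″ ∷ [])) (prep a (shift b″ (b ∷ b′ ∷ []) (a′ ∷ a″ ∷ [])))))))
             (trans (∑-swap _) ∑-swap₁) ⟩
      ∑ (λ b → ∑ λ b′ → ∑ λ b″ → ∑ λ a → ∑ λ a′ → ∑ λ a″ →
          ⟦ a ≼? b ×-dec a′ ≼? b′ ×-dec b ≺? b′ ×-dec b′ ≺? b″ ×-dec a ≺? a′ ×-dec a′ ≺? a″ ⟧ * X b b′ b″ a a′ a″)
        + ∑ (λ b → ∑ λ b′ → ∑ λ b″ → ∑ λ a → ∑ λ a′ → ∑ λ a″ →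
          ⟦ a ≼? b ×-dec b ≺? b′ ×-dec b′ ≺? a′ ×-dec a′ ≺? a″ ×-dec b′ ≺? b″ ⟧ * X a b″ b b′ a′ a″) + R₁
        ≡⟨ cong (_+ R₁) (cong₂ _+_ (∑ⁿ-+ 6 (λ b b′ b″ a a′ a″ → ⟦⟧-split
             (a ≼? b ×-dec a′ ≼? b′ ×-dec b ≺? b′ ×-dec b′ ≺? b″ ×-dec a ≺? a′ ×-dec a′ ≺? a″)
             (a ≼? b ×-dec a′ ≼? b′ ×-dec a″ ≼? b″ ×-dec a ≺? a′ ×-dec b ≺? b′ ×-dec a′ ≺? a″ ×-dec b′ ≺? b″)
             (a ≺? a′ ×-dec a ≼? b ×-dec a′ ≼? b′ ×-dec b ≺? b′ ×-dec b′ ≺? b″ ×-dec b″ ≺? a″)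
             (λ (r , r′ , p , p′ , q , q′) → Data.Sum.map (λ s → r , r′ , s , q , p , q′ , p′) (λ s → q , r , r′ , p , p′ , s) (≤-<-connex (toℕ a″) (toℕ b″)))
             (λ (r , r′ , _ , q , p , q′ , p′) → r , r′ , p , p′ , q , q′)
             (λ (q , r , r′ , p , p′ , s) → r , r′ , p , p′ , q , ≤-<-trans r′ (<-trans p′ s))
             (λ (_ , _ , a″≤b″ , _) (_ , _ , _ , _ , _ , b″<a″) → ≤⇒≯ a″≤b″ b″<a″)
             (col-↭ m _ (↭-trans (shift a (b ∷ b′ ∷ b″ ∷ []) (a′ ∷ a″ ∷ []))
               (prep a (prep b (↭-trans (shift a′ (b′ ∷ b″ ∷ []) (a″ ∷ [])) (prep a′ (prep b′ (swap b″ a″ ↭-refl))))))))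
             (col-↭ m _ (↭-trans (shift a (b ∷ b′ ∷ b″ ∷ []) (a′ ∷ a″ ∷ [])) (prep a (shift a′ (b ∷ b′ ∷ b″ ∷ []) (a″ ∷ [])))))))
             (trans ∑-swap₂ (trans ∑-swap₁ (trans (∑-swap _) (trans ∑-swap₂ ∑-swap₁))))) ⟩
      ∑ (λ b → ∑ λ b′ → ∑ λ b″ → ∑ λ a → ∑ λ a′ → ∑ λ a″ →
          ⟦ a ≼? b ×-dec a′ ≼? b′ ×-dec a″ ≼? b″ ×-dec a ≺? a′ ×-dec b ≺? b′ ×-dec a′ ≺? a″ ×-dec b′ ≺? b″ ⟧
            * col m (suc (toℕ a″)) (λ A → f (a ∷ b ∷ a′ ∷ b′ ∷ a″ ∷ b″ ∷ A)))
        + ∑ (λ b → ∑ λ b′ → ∑ λ b″ → ∑ λ a → ∑ λ a′ → ∑ λ a″ →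
          ⟦ a ≺? a′ ×-dec a ≼? b ×-dec a′ ≼? b′ ×-dec b ≺? b′ ×-dec b′ ≺? b″ ×-dec b″ ≺? a″ ⟧ * X a a′ b b′ b″ a″)
        + R₂ + R₁
        ≡⟨ cong (λ s → s + R₂ + R₁) (cong₂ _+_
             (trans ∑-swap₂ (trans ∑-swap₁ (trans (∑-swap _) (trans ∑-swap₃ (trans ∑-swap₂ ∑-swap₄)))))
             (trans ∑-swap₂ (trans ∑-swap₁ (trans (∑-swap _) (trans ∑-swap₃ (trans ∑-swap₂ ∑-swap₁)))))) ⟩
      s-222 f m + R₃ + R₂ + R₁
        ≡⟨ trans (cong (_+ R₁) (+-assoc (s-222 f m) R₃ R₂)) (trans (+-assoc (s-222 f m) (R₃ + R₂) R₁) (cong (s-222 f m +_) (sym right))) ⟩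
      s-222 f m + ∑ (λ b → ∑ λ b′ → ⟦ b ≺? b′ ⟧ * e f (4 + m) (b ∷ b′ ∷ [])) ∎
      where
      X : Fin n → Fin n → Fin n → Fin n → Fin n → Fin n → ℕ
      X b b′ b″ a a′ a″ = col m (suc (toℕ a″)) (λ A → f (b ∷ b′ ∷ b″ ∷ a ∷ a′ ∷ a″ ∷ A))
      R₁ = ∑ (λ y → ∑ λ y′ → ∑ λ x → ∑ λ x′ → ∑ λ x″ → ∑ λ w →
        ⟦ y ≺? y′ ×-dec x ≺? x′ ×-dec x′ ≺? x″ ×-dec x″ ≺? w ×-dec x ≺? y ⟧ * X y y′ x x′ x″ w)
      R₂ = ∑ (λ y → ∑ λ y′ → ∑ λ x → ∑ λ x′ → ∑ λ x″ → ∑ λ w →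
        ⟦ y ≼? x ×-dec x ≺? x′ ×-dec x′ ≺? x″ ×-dec x″ ≺? w ×-dec x′ ≺? y′ ⟧ * X y y′ x x′ x″ w)
      R₃ = ∑ (λ y → ∑ λ y′ → ∑ λ x → ∑ λ x′ → ∑ λ x″ → ∑ λ w →
        ⟦ y ≺? y′ ×-dec y ≼? x ×-dec y′ ≼? x′ ×-dec x ≺? x′ ×-dec x′ ≺? x″ ×-dec x″ ≺? w ⟧ * X y y′ x x′ x″ w)
      right : ∑ (λ b → ∑ λ b′ → ⟦ b ≺? b′ ⟧ * e f (4 + m) (b ∷ b′ ∷ [])) ≡ R₃ + R₂ + R₁
      right = trans
        (∑ⁿ-cong 2 λ y y′ → trans (cong (⟦ y ≺? y′ ⟧ *_) (e-4 m (y ∷ y′ ∷ [])))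
          (*-∑ⁿ 4 ⟦ y ≺? y′ ⟧ λ x x′ x″ w → ⟦⟧-merge (y ≺? y′) (x ≺? x′ ×-dec x′ ≺? x″ ×-dec x″ ≺? w) _))
        (trans (∑ⁿ-+ 6 λ y y′ x x′ x″ w → ⟦⟧-split (y ≺? y′ ×-dec x ≺? x′ ×-dec x′ ≺? x″ ×-dec x″ ≺? w)
            (y ≼? x ×-dec y ≺? y′ ×-dec x ≺? x′ ×-dec x′ ≺? x″ ×-dec x″ ≺? w)
            (y ≺? y′ ×-dec x ≺? x′ ×-dec x′ ≺? x″ ×-dec x″ ≺? w ×-dec x ≺? y)
            (λ (p , q , r , s) → Data.Sum.map (_, p , q , r , s) (λ t → p , q , r , s , t) (≤-<-connex (toℕ y) (toℕ x)))
            proj₂ (λ (p , q , r , s , t) → p , q , r , s)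
            (λ (y≤x , _) (_ , _ , _ , _ , x<y) → ≤⇒≯ y≤x x<y) refl refl)
          (cong (_+ R₁) (∑ⁿ-+ 6 λ y y′ x x′ x″ w → ⟦⟧-split (y ≼? x ×-dec y ≺? y′ ×-dec x ≺? x′ ×-dec x′ ≺? x″ ×-dec x″ ≺? w)
            (y ≺? y′ ×-dec y ≼? x ×-dec y′ ≼? x′ ×-dec x ≺? x′ ×-dec x′ ≺? x″ ×-dec x″ ≺? w)
            (y ≼? x ×-dec x ≺? x′ ×-dec x′ ≺? x″ ×-dec x″ ≺? w ×-dec x′ ≺? y′)
            (λ (t , p , q , r , s) → Data.Sum.map (λ u → p , t , u , q , r , s) (λ u → t , q , r , s , u) (≤-<-connex (toℕ y′) (toℕ x′)))
            (λ (p , t , _ , q , r , s) → t , p , q , r , s)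
            -- y < y′ is recovered from y ≤ x < x′ < y′.
            (λ (t , q , r , s , u) → t , ≤-<-trans t (<-trans q u) , q , r , s)
            (λ (_ , _ , y′≤x′ , _) (_ , _ , _ , _ , x′<y′) → ≤⇒≯ y′≤x′ x′<y′) refl refl)))

-- Expressing Schur functions through products with e_p

ind-rows₂ : ∀ w c w′ x → ind w * ind c * (ind w′ * x) ≡ ind (w ∧ c ∧ w′) * x
ind-rows₂ true  true  w′ x = +-identityʳ _
ind-rows₂ true  false w′ x = refl
ind-rows₂ false c     w′ x = refl

ind-rows₃ : ∀ w c w′ c′ w″ x → ind w * ind c * (ind w′ * ind c′ * (ind w″ * x)) ≡ ind (w ∧ c ∧ w′ ∧ c′ ∧ w″) * x
ind-rows₃ w c w′ c′ w″ x = trans (cong (ind w * ind c *_) (trans (ind-rows₂ w′ c′ w″ x) (sym (+-identityʳ _))))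
  (trans (ind-rows₂ w c true (ind (w′ ∧ c′ ∧ w″) * x)) (trans (sym (*-assoc (ind (w ∧ c ∧ true)) _ x)) (cong (_* x)
    (trans (sym (ind-∧ (w ∧ c ∧ true) _)) (cong ind (solve 5 (λ w c w′ c′ w″ → (w :* (c :* con true)) :* (w′ :* (c′ :* w″)) := w :* (c :* (w′ :* (c′ :* w″)))) refl w c w′ c′ w″))))))

module _ {n : ℕ} (α : Fin n → ℕ) where

  schur-1ᵐ : ∀ m → schurCoeff (replicate (suc m) 1) n α ≡ e (H α) (suc m) []
  schur-1ᵐ m = trans (schurCoeff-∷ 1 (replicate m 1) α) (∑-cong λ a → tableaux-1ᵐ a [] m _)

  schur-2 : ∀ m → schurCoeff (2 ∷ replicate m 1) n α ≡ s-2 (H α) m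
  schur-2 m = trans (schurCoeff-∷ 2 (replicate m 1) α) (∑ⁿ-cong 2 λ a b → trans (tableaux-1ᵐ a (b ∷ []) m _)
    (cong (λ u → ind u * X a b) (solve 1 (λ p → p :* con true := p) refl (toℕ a ≤ᵇ toℕ b))))
    where
    X : Fin n → Fin n → ℕ
    X a b = col m (suc (toℕ a)) (λ A → H α (a ∷ b ∷ A))

  schur-3 : ∀ m → schurCoeff (3 ∷ replicate m 1) n α ≡ s-3 (H α) m
  schur-3 m = trans (schurCoeff-∷ 3 (replicate m 1) α) (∑ⁿ-cong 3 λ a b c → trans (tableaux-1ᵐ a (b ∷ c ∷ []) m _)
    (cong (λ u → ind u * X a b c) (solve 2 (λ p q → p :* (q :* con true) := p :* q) refl (toℕ a ≤ᵇ toℕ b) (toℕ b ≤ᵇ toℕ c))))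
    where
    X : Fin n → Fin n → Fin n → ℕ
    X a b c = col m (suc (toℕ a)) (λ A → H α (a ∷ b ∷ c ∷ A))

  -- Only the order of the comparisons differs: `isSSYTᵇ` produces them row by row, `s-22` lists the
  -- row conditions first; the Boolean solver permutes them.
  schur-22 : ∀ m → schurCoeff (2 ∷ 2 ∷ replicate m 1) n α ≡ s-22 (H α) m
  schur-22 m = trans (schurCoeff-∷ 2 (2 ∷ replicate m 1) α) (∑ⁿ-cong 2 λ a b →
    trans (tableaux-∷ (a ∷ b ∷ []) 2 (replicate m 1) (λ A → H α (a ∷ b ∷ A))) (∑ⁿ-cong 2 λ a′ b′ → begin
      _ ≡⟨ cong (ind (W a b) * ind (C a b a′ b′) *_) (tableaux-1ᵐ a′ (b′ ∷ []) m _) ⟩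
      _ ≡⟨ ind-rows₂ (W a b) (C a b a′ b′) (W a′ b′) (X a b a′ b′) ⟩
      _ ≡⟨ cong (λ u → ind u * X a b a′ b′) (solve 4 (λ p q r s → (p :* con true) :* ((q :* (r :* con true)) :* (s :* con true)) := p :* (s :* (q :* r))) refl
             (toℕ a ≤ᵇ toℕ b) (toℕ a <ᵇ toℕ a′) (toℕ b <ᵇ toℕ b′) (toℕ a′ ≤ᵇ toℕ b′)) ⟩
      _ ∎))
    where
    W : Fin n → Fin n → Bool
    W a b = weaklyIncᵇ (a ∷ b ∷ [])
    C : Fin n → Fin n → Fin n → Fin n → Bool
    C a b a′ b′ = colStrictᵇ (a ∷ b ∷ []) (a′ ∷ b′ ∷ [])
    X : Fin n → Fin n → Fin n → Fin n → ℕ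
    X a b a′ b′ = col m (suc (toℕ a′)) (λ A → H α (a ∷ b ∷ a′ ∷ b′ ∷ A))

  schur-32 : ∀ m → schurCoeff (3 ∷ 2 ∷ replicate m 1) n α ≡ s-32 (H α) m
  schur-32 m = trans (schurCoeff-∷ 3 (2 ∷ replicate m 1) α) (∑ⁿ-cong 3 λ a b c →
    trans (tableaux-∷ (a ∷ b ∷ c ∷ []) 2 (replicate m 1) (λ A → H α (a ∷ b ∷ c ∷ A))) (∑ⁿ-cong 2 λ a′ b′ → begin
      _ ≡⟨ cong (ind (weaklyIncᵇ (a ∷ b ∷ c ∷ [])) * ind (C a b c a′ b′) *_) (tableaux-1ᵐ a′ (b′ ∷ []) m _) ⟩
      _ ≡⟨ ind-rows₂ (weaklyIncᵇ (a ∷ b ∷ c ∷ [])) (C a b c a′ b′) (weaklyIncᵇ (a′ ∷ b′ ∷ [])) (X a b c a′ b′) ⟩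
      _ ≡⟨ cong (λ u → ind u * X a b c a′ b′) (solve 5 (λ p t q r s → (p :* (t :* con true)) :* ((q :* (r :* con true)) :* (s :* con true)) := p :* (t :* (s :* (q :* r)))) refl
             (toℕ a ≤ᵇ toℕ b) (toℕ b ≤ᵇ toℕ c) (toℕ a <ᵇ toℕ a′) (toℕ b <ᵇ toℕ b′) (toℕ a′ ≤ᵇ toℕ b′)) ⟩
      _ ∎))
    where
    C : Fin n → Fin n → Fin n → Fin n → Fin n → Bool
    C a b c a′ b′ = colStrictᵇ (a ∷ b ∷ c ∷ []) (a′ ∷ b′ ∷ [])
    X : Fin n → Fin n → Fin n → Fin n → Fin n → ℕ
    X a b c a′ b′ = col m (suc (toℕ a′)) (λ A → H α (a ∷ b ∷ c ∷ a′ ∷ b′ ∷ A))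

  schur-222 : ∀ m → schurCoeff (2 ∷ 2 ∷ 2 ∷ replicate m 1) n α ≡ s-222 (H α) m
  schur-222 m = trans (schurCoeff-∷ 2 (2 ∷ 2 ∷ replicate m 1) α) (∑ⁿ-cong 2 λ a b →
    trans (tableaux-∷ (a ∷ b ∷ []) 2 (2 ∷ replicate m 1) (λ A → H α (a ∷ b ∷ A))) (∑ⁿ-cong 2 λ a′ b′ →
    trans (cong (ind (W a b) * ind (C a b a′ b′) *_) (tableaux-∷ (a′ ∷ b′ ∷ []) 2 (replicate m 1) (λ A → H α (a ∷ b ∷ a′ ∷ b′ ∷ A))))
      (*-∑ⁿ 2 (ind (W a b) * ind (C a b a′ b′)) λ a″ b″ → begin
      _ ≡⟨ cong (λ y → ind (W a b) * ind (C a b a′ b′) * (ind (W a′ b′) * ind (C a′ b′ a″ b″) * y)) (tableaux-1ᵐ a″ (b″ ∷ []) m _) ⟩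
      _ ≡⟨ ind-rows₃ (W a b) (C a b a′ b′) (W a′ b′) (C a′ b′ a″ b″) (W a″ b″) (X a b a′ b′ a″ b″) ⟩
      _ ≡⟨ cong (λ u → ind u * X a b a′ b′ a″ b″) (solve 7
             (λ p q r s t u v → (p :* con true) :* ((q :* (r :* con true)) :* ((s :* con true) :* ((t :* (u :* con true)) :* (v :* con true))))
               := p :* (s :* (v :* (q :* (r :* (t :* u)))))) refl
             (toℕ a ≤ᵇ toℕ b) (toℕ a <ᵇ toℕ a′) (toℕ b <ᵇ toℕ b′) (toℕ a′ ≤ᵇ toℕ b′) (toℕ a′ <ᵇ toℕ a″) (toℕ b′ <ᵇ toℕ b″) (toℕ a″ ≤ᵇ toℕ b″)) ⟩
      _ ∎)))
    where
    W : Fin n → Fin n → Bool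
    W a b = weaklyIncᵇ (a ∷ b ∷ [])
    C : Fin n → Fin n → Fin n → Fin n → Bool
    C a b a′ b′ = colStrictᵇ (a ∷ b ∷ []) (a′ ∷ b′ ∷ [])
    X : Fin n → Fin n → Fin n → Fin n → Fin n → Fin n → ℕ
    X a b a′ b′ a″ b″ = col m (suc (toℕ a″)) (λ A → H α (a ∷ b ∷ a′ ∷ b′ ∷ a″ ∷ b″ ∷ A))

-- Symmetric functions of degree two and three as sums over tuples

≢⇒≺ : ∀ {n} {b c : Fin n} → ¬ b ≡ c → toℕ b < toℕ c ⊎ toℕ c < toℕ b
≢⇒≺ b≢c = Data.Sum.map (λ b≤c → ≤∧≢⇒< b≤c (b≢c ∘ toℕ-injective)) (λ c≤b → ≤∧≢⇒< c≤b (b≢c ∘ sym ∘ toℕ-injective)) (≤-total _ _)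

-- h₂ = p₂ + e₂, with `g b c` in place of x_b x_c.
∑∑-≼ : ∀ {n} (g : Fin n → Fin n → ℕ) →
  ∑ (λ b → ∑ λ c → ⟦ b ≼? c ⟧ * g b c) ≡ ∑ (λ b → g b b) + ∑ (λ b → ∑ λ c → ⟦ b ≺? c ⟧ * g b c)
∑∑-≼ g = trans
  (∑ⁿ-+ 2 λ b c → ⟦⟧-split (b ≼? c) (eq? c b) (b ≺? c)
    (λ b≤c → Data.Sum.swap (Data.Sum.map id (sym ∘ toℕ-injective) (m≤n⇒m<n∨m≡n b≤c)))
    (λ { refl → ≤-refl }) <⇒≤ (λ { refl → <-irrefl refl }) refl refl)
  (cong₂ _+_ (∑-cong λ b → ∑-δ b (g b)) refl)

-- e₁² - p₂ = 2 e₂: every unordered pair occurs in two orders.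
∑∑-≢ : ∀ {n} (g : Fin n → Fin n → ℕ) → (∀ b c → g b c ≡ g c b) →
  ∑ (λ b → ∑ λ c → ⟦ ¬? (eq? b c) ⟧ * g b c) ≡ 2 * ∑ (λ b → ∑ λ c → ⟦ b ≺? c ⟧ * g b c)
∑∑-≢ {n} g g-sym = begin
  ∑ (λ b → ∑ λ c → ⟦ ¬? (eq? b c) ⟧ * g b c)
    ≡⟨ ∑ⁿ-+ 2 (λ b c → ⟦⟧-split (¬? (eq? b c)) (b ≺? c) (c ≺? b) ≢⇒≺ (λ { b<c refl → <-irrefl refl b<c }) (λ { c<b refl → <-irrefl refl c<b }) <-asym refl (g-sym b c)) ⟩
  S + ∑ (λ b → ∑ λ c → ⟦ c ≺? b ⟧ * g c b)
    ≡⟨ cong (S +_) (∑-swap _) ⟩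
  S + S
    ≡⟨ cong (S +_) (+-identityʳ S) ⟨
  2 * S ∎
  where
  S = ∑ (λ b → ∑ λ c → ⟦ b ≺? c ⟧ * g b c)

-- e₁² = p₂ + 2 e₂.
∑∑-sym : ∀ {n} (g : Fin n → Fin n → ℕ) → (∀ b c → g b c ≡ g c b) →
  ∑ (λ b → ∑ λ c → g b c) ≡ ∑ (λ b → g b b) + 2 * ∑ (λ b → ∑ λ c → ⟦ b ≺? c ⟧ * g b c)
∑∑-sym g g-sym = trans
  (∑ⁿ-+ 2 λ b c → trans (sym (+-identityʳ (g b c))) (⟦⟧-split (yes tt) (eq? c b) (¬? (eq? b c))
    (λ _ → Data.Sum.map sym id (toSum (eq? b c))) _ _ (λ { refl b≢b → b≢b refl }) refl refl))
  (cong₂ _+_ (∑-cong λ b → ∑-δ b (g b)) (∑∑-≢ g g-sym))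

-- s₂₁ = m₂₁ + 2 e₃
∑∑∑-s₂₁ : ∀ {n} (g : Fin n → Fin n → Fin n → ℕ) → (∀ b c d → g b c d ≡ g c b d) → (∀ b c d → g b c d ≡ g b d c) →
  ∑ (λ b → ∑ λ c → ∑ λ d → ⟦ b ≼? c ×-dec b ≺? d ⟧ * g b c d)
    ≡ ∑ (λ b → ∑ λ d → ⟦ ¬? (eq? b d) ⟧ * g b b d) + 2 * ∑ (λ b → ∑ λ c → ∑ λ d → ⟦ b ≺? c ×-dec c ≺? d ⟧ * g b c d)
∑∑∑-s₂₁ {n} g g₁₂ g₂₃ = begin
  ∑ (λ b → ∑ λ c → ∑ λ d → ⟦ b ≼? c ×-dec b ≺? d ⟧ * g b c d)
    ≡⟨ ∑ⁿ-+ 3 (λ b c d → ⟦⟧-split (b ≼? c ×-dec b ≺? d) (eq? c b ×-dec b ≺? d) (b ≺? c ×-dec b ≺? d)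
         (λ (b≤c , b<d) → Data.Sum.swap (Data.Sum.map (_, b<d) (λ eq → sym (toℕ-injective eq) , b<d) (m≤n⇒m<n∨m≡n b≤c)))
         (λ { (refl , b<d) → ≤-refl , b<d }) (λ (b<c , b<d) → <⇒≤ b<c , b<d) (λ { (refl , _) (b<b , _) → <-irrefl refl b<b }) refl refl) ⟩
  ∑ (λ b → ∑ λ c → ∑ λ d → ⟦ eq? c b ×-dec b ≺? d ⟧ * g b c d) + ∑ (λ b → ∑ λ c → ∑ λ d → ⟦ b ≺? c ×-dec b ≺? d ⟧ * g b c d)
    -- `D` and `D′` are the halves b < d and d < b of m₂₁. The second one comes from the terms with
    -- b < c = d, read with the repeated entry first.
    ≡⟨ cong₂ _+_ diagonal rest ⟩
  D + (D′ + (S + S))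
    ≡⟨ +-assoc D D′ (S + S) ⟨
  D + D′ + (S + S)
    ≡⟨ cong₂ _+_ (sym offDiagonal) (cong (S +_) (sym (+-identityʳ S))) ⟩
  ∑ (λ b → ∑ λ d → ⟦ ¬? (eq? b d) ⟧ * g b b d) + 2 * S ∎
  where
  D = ∑ (λ b → ∑ λ d → ⟦ b ≺? d ⟧ * g b b d)
  D′ = ∑ (λ b → ∑ λ d → ⟦ d ≺? b ⟧ * g b b d)
  S = ∑ (λ b → ∑ λ c → ∑ λ d → ⟦ b ≺? c ×-dec c ≺? d ⟧ * g b c d)
  diagonal : ∑ (λ b → ∑ λ c → ∑ λ d → ⟦ eq? c b ×-dec b ≺? d ⟧ * g b c d) ≡ D
  diagonal = ∑-cong λ b → trans
    (∑-cong λ c → sym (*-∑ⁿ 1 ⟦ eq? c b ⟧ λ d → ⟦⟧-merge (eq? c b) (b ≺? d) (g b c d)))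
    (∑-δ b λ c → ∑ λ d → ⟦ b ≺? d ⟧ * g b c d)
  offDiagonal : ∑ (λ b → ∑ λ d → ⟦ ¬? (eq? b d) ⟧ * g b b d) ≡ D + D′
  offDiagonal = ∑ⁿ-+ 2 λ b d → ⟦⟧-split (¬? (eq? b d)) (b ≺? d) (d ≺? b) ≢⇒≺
    (λ { b<c refl → <-irrefl refl b<c }) (λ { c<b refl → <-irrefl refl c<b }) <-asym refl refl
  rest : ∑ (λ b → ∑ λ c → ∑ λ d → ⟦ b ≺? c ×-dec b ≺? d ⟧ * g b c d) ≡ D′ + (S + S)
  rest = begin
    ∑ (λ b → ∑ λ c → ∑ λ d → ⟦ b ≺? c ×-dec b ≺? d ⟧ * g b c d)
      ≡⟨ ∑ⁿ-+ 3 (λ b c d → ⟦⟧-split (b ≺? c ×-dec b ≺? d) (eq? d c ×-dec b ≺? c) (¬? (eq? d c) ×-dec b ≺? c ×-dec b ≺? d)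
           (λ (p , q) → Data.Sum.map (_, p) (_, p , q) (toSum (eq? d c)))
           (λ { (refl , p) → p , p }) proj₂ (λ { (d≡c , _) (d≢c , _) → d≢c d≡c }) refl refl) ⟩
    ∑ (λ b → ∑ λ c → ∑ λ d → ⟦ eq? d c ×-dec b ≺? c ⟧ * g b c d) + ∑ (λ b → ∑ λ c → ∑ λ d → ⟦ ¬? (eq? d c) ×-dec b ≺? c ×-dec b ≺? d ⟧ * g b c d)
      ≡⟨ cong₂ _+_
           (trans (∑ⁿ-cong 2 λ b c → trans (∑-cong λ d → sym (⟦⟧-merge (eq? d c) (b ≺? c) (g b c d))) (trans (∑-δ c λ d → ⟦ b ≺? c ⟧ * g b c d)
              (cong (⟦ b ≺? c ⟧ *_) (trans (g₁₂ b c c) (g₂₃ c b c))))) (∑-swap _))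
           (∑ⁿ-+ 3 (λ b c d → ⟦⟧-split (¬? (eq? d c) ×-dec b ≺? c ×-dec b ≺? d) (b ≺? c ×-dec c ≺? d) (b ≺? d ×-dec d ≺? c)
             (λ (d≢c , p , q) → Data.Sum.swap (Data.Sum.map (q ,_) (p ,_) (≢⇒≺ d≢c)))
             (λ (p , r) → (λ { refl → <-irrefl refl r }) , p , <-trans p r) (λ (q , r) → (λ { refl → <-irrefl refl r }) , <-trans q r , q)
             (λ (_ , p) (_ , q) → <-asym p q) refl (g₂₃ b c d))) ⟩
    ∑ (λ c → ∑ λ b → ⟦ b ≺? c ⟧ * g c c b) + (S + ∑ (λ b → ∑ λ c → ∑ λ d → ⟦ b ≺? d ×-dec d ≺? c ⟧ * g b d c))
      ≡⟨ cong (λ x → D′ + (S + x)) (∑-cong λ b → ∑-swap _) ⟩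
    D′ + (S + S) ∎

-- `x` stands for a sum over ordered pairs, 2 e_{k+3} e₂; hence 3k + 4 in place of 2(3k + 4).
combination : ℕ → (m p x e₁ e₀ : ℕ) → ℕ
combination k m p x e₁ e₀ =
  m + (k + 2) * p + (3 * k + 4) * x + (k * k * k + 5 * (k * k) + 8 * k + 7) * e₁ + (k + 1) * (k + 1) * (k + 5) * e₀

combination-cong : ∀ k {m p x e₁ e₀ m′ p′ x′ e₁′ e₀′} → m ≡ m′ → p ≡ p′ → x ≡ x′ → e₁ ≡ e₁′ → e₀ ≡ e₀′ →
  combination k m p x e₁ e₀ ≡ combination k m′ p′ x′ e₁′ e₀′
combination-cong k refl refl refl refl refl = refl

combination-zero : ∀ k → combination k 0 0 0 0 0 ≡ 0
combination-zero = zeros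
  where
  zeros : ∀ k → 0 + (k + 2) * 0 + (3 * k + 4) * 0 + (k * k * k + 5 * (k * k) + 8 * k + 7) * 0 + (k + 1) * (k + 1) * (k + 5) * 0 ≡ 0
  zeros = solve-∀

-- Here h is the auxiliary product s_{2,1^{k+2}} e₁. Cancelling it between the first two equations
-- gives m + 2 s₂₂₂ + e₁ = s₃₂ + p, the third becomes p + s₂₂ + e₀ = s₃, and a polynomial identity
-- remains.
solve-for-schur : ∀ k {m p x₂ x₃ e₀ e₁ h s₂ s₃ s₂₂ s₃₂ s₂₂₂} →
  m + 2 * x₃ ≡ s₃₂ + h → p + 2 * x₂ ≡ h + e₁ → p + x₂ ≡ s₃ + s₂ → x₃ ≡ s₂₂₂ + x₂ → x₂ ≡ s₂₂ + e₁ → e₁ ≡ s₂ + e₀ →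
  combination k m p (2 * x₂) e₁ e₀ + 2 * s₂₂₂
    ≡ s₃₂ + (k + 3) * s₃ + 5 * (k + 1) * s₂₂ + (k * k * k + 5 * (k * k) + 14 * k + 14) * s₂ + 2 * ((k + 2) * (k + 2) * (k + 2)) * e₀
solve-for-schur k {m} {p} {e₀ = e₀} {h = h} {s₂} {s₃} {s₂₂} {s₃₂} {s₂₂₂} eq₁ eq₂ eq₃ refl refl refl = begin
  combination k m p (2 * x₂) e₁ e₀ + 2 * s₂₂₂
    -- One copy of e₁ is split off (7 becomes 6) for `eq₃₂`; the p obtained in exchange raises k + 2
    -- to k + 3, the coefficient of s₃.
    ≡⟨ gather k m p x₂ e₁ e₀ s₂₂₂ ⟩
  (m + 2 * s₂₂₂ + e₁) + ((k + 2) * p + (3 * k + 4) * (2 * x₂) + (k * k * k + 5 * (k * k) + 8 * k + 6) * e₁ + (k + 1) * (k + 1) * (k + 5) * e₀)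
    ≡⟨ cong (_+ ((k + 2) * p + (3 * k + 4) * (2 * x₂) + (k * k * k + 5 * (k * k) + 8 * k + 6) * e₁ + (k + 1) * (k + 1) * (k + 5) * e₀)) eq₃₂ ⟩
  (s₃₂ + p) + ((k + 2) * p + (3 * k + 4) * (2 * x₂) + (k * k * k + 5 * (k * k) + 8 * k + 6) * e₁ + (k + 1) * (k + 1) * (k + 5) * e₀)
    ≡⟨ compare k p s₃₂ s₂₂ s₂ e₀ ⟩
  s₃₂ + (k + 3) * (p + s₂₂ + e₀) + 5 * (k + 1) * s₂₂ + (k * k * k + 5 * (k * k) + 14 * k + 14) * s₂ + 2 * ((k + 2) * (k + 2) * (k + 2)) * e₀
    ≡⟨ cong (λ s → s₃₂ + (k + 3) * s + 5 * (k + 1) * s₂₂ + (k * k * k + 5 * (k * k) + 14 * k + 14) * s₂ + 2 * ((k + 2) * (k + 2) * (k + 2)) * e₀) eq₃′ ⟩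
  s₃₂ + (k + 3) * s₃ + 5 * (k + 1) * s₂₂ + (k * k * k + 5 * (k * k) + 14 * k + 14) * s₂ + 2 * ((k + 2) * (k + 2) * (k + 2)) * e₀ ∎
  where
  e₁ = s₂ + e₀
  x₂ = s₂₂ + e₁
  gather : ∀ k m p x₂ e₁ e₀ s₂₂₂ →
    m + (k + 2) * p + (3 * k + 4) * (2 * x₂) + (k * k * k + 5 * (k * k) + 8 * k + 7) * e₁ + (k + 1) * (k + 1) * (k + 5) * e₀ + 2 * s₂₂₂
      ≡ (m + 2 * s₂₂₂ + e₁) + ((k + 2) * p + (3 * k + 4) * (2 * x₂) + (k * k * k + 5 * (k * k) + 8 * k + 6) * e₁ + (k + 1) * (k + 1) * (k + 5) * e₀)
  gather = solve-∀
  compare : ∀ k p s₃₂ s₂₂ s₂ e₀ →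
    (s₃₂ + p) + ((k + 2) * p + (3 * k + 4) * (2 * (s₂₂ + (s₂ + e₀))) + (k * k * k + 5 * (k * k) + 8 * k + 6) * (s₂ + e₀) + (k + 1) * (k + 1) * (k + 5) * e₀)
      ≡ s₃₂ + (k + 3) * (p + s₂₂ + e₀) + 5 * (k + 1) * s₂₂ + (k * k * k + 5 * (k * k) + 14 * k + 14) * s₂ + 2 * ((k + 2) * (k + 2) * (k + 2)) * e₀
  compare = solve-∀
  eq₃′ : p + s₂₂ + e₀ ≡ s₃
  eq₃′ = +-cancelʳ-≡ s₂ (p + s₂₂ + e₀) s₃ (trans (rearrange p s₂₂ s₂ e₀) eq₃)
    where
    rearrange : ∀ p s₂₂ s₂ e₀ → p + s₂₂ + e₀ + s₂ ≡ p + (s₂₂ + (s₂ + e₀))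
    rearrange = solve-∀
  eq₃₂ : m + 2 * s₂₂₂ + e₁ ≡ s₃₂ + p
  eq₃₂ = +-cancelʳ-≡ (2 * x₂) _ _ (begin
    m + 2 * s₂₂₂ + e₁ + 2 * x₂     ≡⟨ left m s₂₂₂ e₁ x₂ ⟩
    m + 2 * (s₂₂₂ + x₂) + e₁       ≡⟨ cong (_+ e₁) eq₁ ⟩
    s₃₂ + h + e₁                   ≡⟨ +-assoc s₃₂ h e₁ ⟩
    s₃₂ + (h + e₁)                 ≡⟨ cong (s₃₂ +_) eq₂ ⟨
    s₃₂ + (p + 2 * x₂)             ≡⟨ +-assoc s₃₂ p _ ⟨
    s₃₂ + p + 2 * x₂               ∎)
    where
    left : ∀ m s₂₂₂ e₁ x₂ → m + 2 * s₂₂₂ + e₁ + 2 * x₂ ≡ m + 2 * (s₂₂₂ + x₂) + e₁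
    left = solve-∀

-- e_{k+2} m₂₁ + (k+2) e_{k+3} p₂ + 2(3k+4) e_{k+3} e₂ + (k³+5k²+8k+7) e_{k+4} e₁ + (k+1)²(k+5) e_{k+5}
e-form : ∀ {n} → (List (Fin n) → ℕ) → ℕ → ℕ
e-form f k = combination k
  (∑ λ b → ∑ λ d → ⟦ ¬? (eq? b d) ⟧ * e f (2 + k) (b ∷ b ∷ d ∷ []))
  (∑ λ b → e f (3 + k) (b ∷ b ∷ []))
  (∑ λ b → ∑ λ d → ⟦ ¬? (eq? b d) ⟧ * e f (3 + k) (b ∷ d ∷ []))
  (∑ λ b → e f (4 + k) (b ∷ []))
  (e f (5 + k) [])

module _ {n : ℕ} (f : List (Fin n) → ℕ) (f-↭ : ∀ {xs ys} → xs ↭ ys → f xs ≡ f ys) where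
  open Pieri f f-↭

  e-form-schur : ∀ q → let k = suc q in
    e-form f k + 2 * s-222 f q
    ≡ s-32 f k + (k + 3) * s-3 f (2 + k) + 5 * (k + 1) * s-22 f (1 + k)
      + (k * k * k + 5 * (k * k) + 14 * k + 14) * s-2 f (3 + k) + 2 * ((k + 2) * (k + 2) * (k + 2)) * e f (5 + k) []
  e-form-schur q = trans
    (cong (λ x → combination k M P x E₁ (e f (5 + k) []) + 2 * s-222 f q) (∑∑-≢ g₂ g₂-sym))
    (solve-for-schur k {M} {P} {e₁ = E₁}
      (trans (sym (∑∑∑-s₂₁ g₃ (λ b c d → col-↭ (2 + k) 0 (swap b c (↭-refl {x = d ∷ []}))) (λ b c d → col-↭ (2 + k) 0 (prep b (swap c d (↭-refl {x = []})))))) (e·s₂₁ k))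
      -- `e·e₁` is applied under a further factor x_z, that is to `f ∘ (z ∷_)`: e_{k+3} e₁² =
      -- (s_{2,1^{k+2}} + e_{k+4}) e₁.
      (trans (sym (∑∑-sym g₂ g₂-sym)) (∑ⁿ-+ 1 λ z → Pieri.e·e₁ (f ∘ (z ∷_)) (f-↭ ∘ prep z) (2 + k)))
      (trans (sym (∑∑-≼ g₂)) (e·h₂ (2 + k)))
      (e·e₃ q)
      (e·e₂ (1 + k))
      (e·e₁ (3 + k)))
    where
    k = suc q
    g₂ : Fin n → Fin n → ℕ
    g₂ b c = e f (3 + k) (b ∷ c ∷ [])
    g₂-sym : ∀ b c → g₂ b c ≡ g₂ c b
    g₂-sym b c = col-↭ (3 + k) 0 (swap b c (↭-refl {x = []}))
    g₃ : Fin n → Fin n → Fin n → ℕ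
    g₃ b c d = e f (2 + k) (b ∷ c ∷ d ∷ [])
    M = ∑ (λ b → ∑ λ d → ⟦ ¬? (eq? b d) ⟧ * e f (2 + k) (b ∷ b ∷ d ∷ []))
    P = ∑ (λ b → e f (3 + k) (b ∷ b ∷ []))
    E₁ = ∑ (λ b → e f (4 + k) (b ∷ []))

-- Counting by set partitions and multiplicities

opaque
  ∏ : ∀ {n} → (Fin n → ℕ) → ℕ
  ∏ = Product.sum

  ∏-empty : (f : Fin 0 → ℕ) → ∏ f ≡ 1
  ∏-empty f = refl

  ∏-suc : ∀ {n} (f : Fin (suc n) → ℕ) → ∏ f ≡ f zero * ∏ (f ∘ suc)
  ∏-suc f = refl

  ∏-cong : ∀ {n} {f g : Fin n → ℕ} → (∀ c → f c ≡ g c) → ∏ f ≡ ∏ g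
  ∏-cong = Product.sum-cong-≗

∏-split : ∀ {n} z (f : Fin n → ℕ) → ∏ f ≡ f z * ∏ (λ c → if finEqᵇ c z then 1 else f c)
∏-split zero    f = trans (∏-suc f) (cong (f zero *_) (sym (trans (∏-suc _) (+-identityʳ _))))
∏-split (suc z) f = begin
  ∏ f                                              ≡⟨ ∏-suc f ⟩
  f zero * ∏ (f ∘ suc)                             ≡⟨ cong (f zero *_) (∏-split z (f ∘ suc)) ⟩
  f zero * (f (suc z) * ∏ _)                       ≡⟨ *-CS.x∙yz≈y∙xz (f zero) (f (suc z)) _ ⟩
  f (suc z) * (f zero * ∏ _)                       ≡⟨ cong (f (suc z) *_) (∏-suc _) ⟨
  f (suc z) * ∏ (λ c → if finEqᵇ c (suc z) then 1 else f c) ∎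

∏-ind : ∀ {n} (x : Fin n → ℕ) → ∏ (λ c → ind (x c ≡ᵇ 0)) ≡ ind (∑ x ≡ᵇ 0)
∏-ind {zero}  x = trans (∏-empty _) (cong (λ s → ind (s ≡ᵇ 0)) (sym (∑-empty x)))
∏-ind {suc n} x = trans (∏-suc _) (trans (cong (ind (x zero ≡ᵇ 0) *_) (∏-ind (x ∘ suc)))
  (trans (first (x zero)) (cong (λ s → ind (s ≡ᵇ 0)) (sym (∑-suc x)))))
  where
  first : ∀ y → ind (y ≡ᵇ 0) * ind (∑ (x ∘ suc) ≡ᵇ 0) ≡ ind (y + ∑ (x ∘ suc) ≡ᵇ 0)
  first zero    = +-identityʳ _
  first (suc y) = refl

finEqᵇ-refl : ∀ {n} (a : Fin n) → finEqᵇ a a ≡ true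
finEqᵇ-refl a = dec-true (eq? a a) refl

finEqᵇ⇒≡ : ∀ {n} (a b : Fin n) → finEqᵇ a b ≡ true → a ≡ b
finEqᵇ⇒≡ a b eq with eq? a b
... | yes a≡b = a≡b
... | no  a≢b with trans (sym eq) (dec-false (eq? a b) a≢b)
...   | ()

finEqᵇ-sym : ∀ {n} (a b : Fin n) → finEqᵇ a b ≡ finEqᵇ b a
finEqᵇ-sym a b with eq? a b
... | yes refl = refl
... | no a≢b = trans (dec-false (eq? a b) a≢b) (sym (dec-false (eq? b a) (a≢b ∘ sym)))

mem : ∀ {n} → Fin n → List (Fin n) → Bool
mem c []       = false
mem c (z ∷ zs) = finEqᵇ c z ∨ mem c zs

Distinct : ∀ {n} → List (Fin n) → Set
Distinct []       = ⊤
Distinct (z ∷ zs) = mem z zs ≡ false × Distinct zs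

∑∉ : ∀ {n} → List (Fin n) → (Fin n → ℕ) → ℕ
∑∉ zs g = ∑ λ c → ind (not (mem c zs)) * g c

∑∉-cong : ∀ {n} (zs : List (Fin n)) {f g : Fin n → ℕ} → (∀ c → mem c zs ≡ false → f c ≡ g c) → ∑∉ zs f ≡ ∑∉ zs g
∑∉-cong zs {f} {g} eq = ∑-cong pointwise
  where
  pointwise : ∀ c → ind (not (mem c zs)) * f c ≡ ind (not (mem c zs)) * g c
  pointwise c with mem c zs in c∉zs
  ... | true  = refl
  ... | false = cong (1 *_) (eq c c∉zs)

∑∉-+ : ∀ {n} (zs : List (Fin n)) f g → ∑∉ zs (λ c → f c + g c) ≡ ∑∉ zs f + ∑∉ zs g
∑∉-+ zs f g = trans (∑-cong λ c → *-distribˡ-+ (ind (not (mem c zs))) (f c) (g c)) (∑-+ _ _)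

∑∉-* : ∀ {n} (zs : List (Fin n)) x f → ∑∉ zs (λ c → x * f c) ≡ x * ∑∉ zs f
∑∉-* zs x f = trans (∑-cong λ c → *-CS.x∙yz≈y∙xz (ind (not (mem c zs))) x (f c)) (sym (*-∑ x _))

∑∉-∷ : ∀ {n} (z : Fin n) zs g → mem z zs ≡ false → ∑∉ zs g ≡ g z + ∑∉ (z ∷ zs) g
∑∉-∷ z zs g z∉zs = trans (∑-cong pointwise) (trans (∑-+ _ _) (cong (_+ ∑∉ (z ∷ zs) g) (∑-δ z g)))
  where
  pointwise : ∀ c → ind (not (mem c zs)) * g c ≡ ind (finEqᵇ c z) * g c + ind (not (mem c (z ∷ zs))) * g c
  pointwise c with finEqᵇ c z in eq
  ... | false = refl
  ... | true rewrite finEqᵇ⇒≡ c z eq | z∉zs = sym (+-identityʳ _)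

∑-distinct : ∀ {n} (zs : List (Fin n)) g → Distinct zs → ∑ g ≡ sumL g zs + ∑∉ zs g
∑-distinct []       g _              = ∑-cong λ c → sym (+-identityʳ (g c))
∑-distinct (z ∷ zs) g (z∉zs , distinct) = begin
  ∑ g                                    ≡⟨ ∑-distinct zs g distinct ⟩
  sumL g zs + ∑∉ zs g                    ≡⟨ cong (sumL g zs +_) (∑∉-∷ z zs g z∉zs) ⟩
  sumL g zs + (g z + ∑∉ (z ∷ zs) g)      ≡⟨ +-CS.x∙yz≈yx∙z (sumL g zs) (g z) _ ⟩
  g z + sumL g zs + ∑∉ (z ∷ zs) g        ∎

-- A weight ev (p₁ , p₂ , p₃) depending on the multiplicity of a colour and supported on {1, 2, 3}.
Weight : Set
Weight = ℕ × ℕ × ℕ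

ev : Weight → ℕ → ℕ
ev (p , q , r) 1 = p
ev (p , q , r) 2 = q
ev (p , q , r) 3 = r
ev _           _ = 0

anyTrue : ∀ {d} → Vec Bool d → Bool
anyTrue []       = false
anyTrue (b ∷ bs) = b ∨ anyTrue bs

-- The weight of a partially built colour class: the bits say which of the d vertices still to be
-- coloured join it, while the vertices already coloured have been absorbed by `_▷_`.
Φ : ℕ → Set
Φ d = Vec Bool d → Weight

_▷_ : ∀ {d} → Φ (suc d) → Bool → Φ d
(φ ▷ b) bs = φ (b ∷ bs)

bits : ∀ {n d} → Fin n → Vec (Fin n) d → Vec Bool d
bits c κ = Vec.map (finEqᵇ c) κ

-- A colour missed by the distinguished vertices can only come from the clique, or from the factor
-- e_p, and so occurs at most once.
free : ∀ {d} → Φ d → Vec Bool d → ℕ → ℕ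
free φ₀ bs m = if anyTrue bs then ev (φ₀ bs) m else ind (m ≤ᵇ 1)

-- Each entry puts the next vertex into one of the existing blocks: that block sees `true`, all
-- others `false`.
marks : ∀ {d} → List (Φ (suc d)) → List (List (Φ d))
marks []       = []
marks (φ ∷ φs) = ((φ ▷ true) ∷ map (_▷ false) φs) ∷ map ((φ ▷ false) ∷_) (marks φs)

-- A new block is pushed to the front of the list. Its weight, later found at the head, is moved to
-- the argument `new`, where colours are still to be chosen.
openBlock : {A : Set} → (List A → List A → ℕ) → List A → List A → ℕ
openBlock K []       new = 0
openBlock K (p ∷ ps) new = K ps (p ∷ new)

-- The sum, over the ways of distributing d further vertices among the blocks φs and new blocks,
-- of K applied to the resulting weights of the old blocks and of the new ones.
overPartitions : ∀ d → List (Φ d) → Φ d → (List Weight → List Weight → ℕ) → ℕ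
overPartitions zero    φs φ₀ K = K (map (λ φ → φ []) φs) []
overPartitions (suc d) φs φ₀ K =
  sumL (λ φs′ → overPartitions d φs′ (φ₀ ▷ false) K) (marks φs)
  + overPartitions d ((φ₀ ▷ true) ∷ map (_▷ false) φs) (φ₀ ▷ false) (openBlock K)

overPartitions-cong : ∀ d φs φ₀ {K L} → (∀ ps new → K ps new ≡ L ps new) → overPartitions d φs φ₀ K ≡ overPartitions d φs φ₀ L
overPartitions-cong zero    φs φ₀ eq = eq _ _
overPartitions-cong (suc d) φs φ₀ {K} {L} eq = cong₂ _+_
  (sumL-cong (λ φs′ → overPartitions-cong d φs′ (φ₀ ▷ false) eq) (marks φs))
  (overPartitions-cong d _ _ openBlock-eq)
  where
  openBlock-eq : ∀ ps new → openBlock K ps new ≡ openBlock L ps new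
  openBlock-eq []       new = refl
  openBlock-eq (p ∷ ps) new = eq ps (p ∷ new)

∑∉-sumL : ∀ {n} {A : Set} (zs : List (Fin n)) (f : Fin n → A → ℕ) xs → ∑∉ zs (λ a → sumL (f a) xs) ≡ sumL (λ x → ∑∉ zs (λ a → f a x)) xs
∑∉-sumL zs f []       = ∑-zero _ λ c → *-zeroʳ (ind (not (mem c zs)))
∑∉-sumL zs f (x ∷ xs) = trans (∑∉-+ zs (λ a → f a x) (λ a → sumL (f a) xs)) (cong (∑∉ zs (λ a → f a x) +_) (∑∉-sumL zs f xs))

-- A new block gets its colour when it is opened, but its weight is known only after the later
-- vertices are placed. Exchanging the sums separates set partitions from colours.
overPartitions-∑∉ : ∀ {n} d φs φ₀ (zs : List (Fin n)) (K : Fin n → List Weight → List Weight → ℕ) →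
  ∑∉ zs (λ a → overPartitions d φs φ₀ (K a)) ≡ overPartitions d φs φ₀ (λ ps new → ∑∉ zs (λ a → K a ps new))
overPartitions-∑∉ zero    φs φ₀ zs K = refl
overPartitions-∑∉ (suc d) φs φ₀ zs K = trans (∑∉-+ zs _ _) (cong₂ _+_
  (trans (∑∉-sumL zs _ (marks φs)) (sumL-cong (λ φs′ → overPartitions-∑∉ d φs′ _ zs K) (marks φs)))
  (trans (overPartitions-∑∉ d _ _ zs (openBlock ∘ K)) (overPartitions-cong d _ _ openBlock-∑∉)))
  where
  openBlock-∑∉ : ∀ ps new → ∑∉ zs (λ a → openBlock (K a) ps new) ≡ openBlock (λ ps new → ∑∉ zs (λ a → K a ps new)) ps new
  openBlock-∑∉ []       new = ∑-zero _ λ c → *-zeroʳ (ind (not (mem c zs)))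
  openBlock-∑∉ (p ∷ ps) new = refl

module _ {n : ℕ} (α : Fin n → ℕ) where

  -- The association list holds the colours used so far with the patterns of their classes; ρ weighs
  -- the remaining colours.
  assign : ∀ {d} → List (Fin n × Φ d) → (Fin n → Vec Bool d → ℕ) → Fin n → Vec Bool d → ℕ
  assign []             ρ c bs = ρ c bs
  assign ((z , φ) ∷ as) ρ c bs = if finEqᵇ c z then ev (φ bs) (α c) else assign as ρ c bs

  total : ∀ d → List (Fin n × Φ d) → Φ d → ℕ
  total d as φ₀ = ∑v d λ κ → ∏ λ c → assign as (λ c bs → free φ₀ bs (α c)) c (bits c κ)

  evs : List (Fin n) → List Weight → ℕ
  evs []       []       = 1
  evs (z ∷ zs) (p ∷ ps) = ev p (α z) * evs zs ps
  evs _        _        = 0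

  blocks : List Weight → List (Fin n) → ℕ
  blocks []       zs = ∏ λ c → if mem c zs then 1 else ind (α c ≤ᵇ 1)
  blocks (p ∷ ps) zs = ∑∉ zs λ z → ev p (α z) * blocks ps (z ∷ zs)

  assign-∉ : ∀ {d} (as : List (Fin n × Φ d)) ρ c bs → mem c (map proj₁ as) ≡ false → assign as ρ c bs ≡ ρ c bs
  assign-∉ []             ρ c bs c∉as = refl
  assign-∉ ((z , φ) ∷ as) ρ c bs c∉as with finEqᵇ c z
  ... | false = assign-∉ as ρ c bs c∉as

  assign-cong : ∀ {d} (as : List (Fin n × Φ d)) ρ σ c bs → ρ c bs ≡ σ c bs → assign as ρ c bs ≡ assign as σ c bs
  assign-cong []             ρ σ c bs eq = eq
  assign-cong ((z , φ) ∷ as) ρ σ c bs eq with finEqᵇ c z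
  ... | true  = refl
  ... | false = assign-cong as ρ σ c bs eq

  ∏-assign : ∀ (as : List (Fin n × Φ 0)) (ρ : Fin n → ℕ) → Distinct (map proj₁ as) →
    ∏ (λ c → assign as (λ c _ → ρ c) c []) ≡ evs (map proj₁ as) (map (λ φ → φ []) (map proj₂ as)) * ∏ (λ c → if mem c (map proj₁ as) then 1 else ρ c)
  ∏-assign []             ρ _ = sym (+-identityʳ _)
  ∏-assign ((z , φ) ∷ as) ρ (z∉as , distinct) = begin
    ∏ (λ c → assign ((z , φ) ∷ as) (λ c _ → ρ c) c [])
      ≡⟨ ∏-split z _ ⟩
    assign ((z , φ) ∷ as) (λ c _ → ρ c) z [] * ∏ (λ c → if finEqᵇ c z then 1 else assign ((z , φ) ∷ as) (λ c _ → ρ c) c [])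
      ≡⟨ cong₂ _*_ (cong (λ b → if b then ev (φ []) (α z) else assign as (λ c _ → ρ c) z []) (finEqᵇ-refl z)) (∏-cong skip) ⟩
    ev (φ []) (α z) * ∏ (λ c → assign as (λ c _ → ρ′ c) c [])
      ≡⟨ cong (ev (φ []) (α z) *_) (∏-assign as ρ′ distinct) ⟩
    ev (φ []) (α z) * (evs zs ps * ∏ (λ c → if mem c zs then 1 else ρ′ c))
      ≡⟨ *-assoc (ev (φ []) (α z)) _ _ ⟨
    ev (φ []) (α z) * evs zs ps * ∏ (λ c → if mem c zs then 1 else ρ′ c)
      ≡⟨ cong (ev (φ []) (α z) * evs zs ps *_) (∏-cong merge) ⟩
    ev (φ []) (α z) * evs zs ps * ∏ (λ c → if mem c (z ∷ zs) then 1 else ρ c) ∎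
    where
    zs = map proj₁ as
    ps = map (λ φ → φ []) (map proj₂ as)
    ρ′ : Fin n → ℕ
    ρ′ c = if finEqᵇ c z then 1 else ρ c
    skip : ∀ c → (if finEqᵇ c z then 1 else assign ((z , φ) ∷ as) (λ c _ → ρ c) c []) ≡ assign as (λ c _ → ρ′ c) c []
    skip c with finEqᵇ c z in eq
    ... | false = assign-cong as _ _ c [] (cong (λ b → if b then 1 else ρ c) (sym eq))
    ... | true rewrite finEqᵇ⇒≡ c z eq = sym (trans (assign-∉ as _ z [] z∉as) (cong (λ b → if b then 1 else ρ z) (finEqᵇ-refl z)))
    merge : ∀ c → (if mem c zs then 1 else ρ′ c) ≡ (if mem c (z ∷ zs) then 1 else ρ c)
    merge c with finEqᵇ c z | mem c zs
    ... | true  | true  = refl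
    ... | true  | false = refl
    ... | false | _     = refl

  place : ∀ {d} → Fin n → List (Fin n × Φ (suc d)) → List (Fin n × Φ d)
  place a = map λ { (z , φ) → z , φ ▷ finEqᵇ z a }

  places-place : ∀ {d} a (as : List (Fin n × Φ (suc d))) → map proj₁ (place a as) ≡ map proj₁ as
  places-place a []       = refl
  places-place a (_ ∷ as) = cong (_ ∷_) (places-place a as)

  place-∉ : ∀ {d} a (as : List (Fin n × Φ (suc d))) → mem a (map proj₁ as) ≡ false → map proj₂ (place a as) ≡ map (_▷ false) (map proj₂ as)
  place-∉ a []             a∉as = refl
  place-∉ a ((z , φ) ∷ as) a∉as with finEqᵇ a z in eq
  ... | false = cong₂ _∷_ (cong (φ ▷_) (trans (finEqᵇ-sym z a) eq)) (place-∉ a as a∉as)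

  sumL-place : ∀ {d} (as : List (Fin n × Φ (suc d))) (F : List (Φ d) → ℕ) → Distinct (map proj₁ as) →
    sumL (λ z → F (map proj₂ (place z as))) (map proj₁ as) ≡ sumL F (marks (map proj₂ as))
  sumL-place []             F _ = refl
  sumL-place ((z , φ) ∷ as) F (z∉as , distinct) = cong₂ _+_
    (cong₂ (λ b φs → F ((φ ▷ b) ∷ φs)) (finEqᵇ-refl z) (place-∉ z as z∉as))
    (begin
      sumL (λ a → F ((φ ▷ finEqᵇ z a) ∷ map proj₂ (place a as))) zs
        ≡⟨ sumL-∉ zs z∉as ⟩
      sumL (λ a → F ((φ ▷ false) ∷ map proj₂ (place a as))) zs
        ≡⟨ sumL-place as (F ∘ ((φ ▷ false) ∷_)) distinct ⟩
      sumL (F ∘ ((φ ▷ false) ∷_)) (marks (map proj₂ as))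
        ≡⟨ sumL-map F ((φ ▷ false) ∷_) (marks (map proj₂ as)) ⟨
      sumL F (map ((φ ▷ false) ∷_) (marks (map proj₂ as))) ∎)
    where
    zs = map proj₁ as
    sumL-∉ : ∀ ys → mem z ys ≡ false →
      sumL (λ a → F ((φ ▷ finEqᵇ z a) ∷ map proj₂ (place a as))) ys ≡ sumL (λ a → F ((φ ▷ false) ∷ map proj₂ (place a as))) ys
    sumL-∉ []       z∉ys = refl
    sumL-∉ (y ∷ ys) z∉ys with finEqᵇ z y
    ... | false = cong (F _ +_) (sumL-∉ ys z∉ys)

  assign-∈ : ∀ {d} a (as : List (Fin n × Φ (suc d))) φ₀ c bs → mem a (map proj₁ as) ≡ true →
    assign as (λ c bs → free φ₀ bs (α c)) c (finEqᵇ c a ∷ bs) ≡ assign (place a as) (λ c bs → free (φ₀ ▷ false) bs (α c)) c bs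
  assign-∈ a as φ₀ c bs a∈as = go as λ c∉as → cong (λ b → free φ₀ (b ∷ bs) (α c)) (c≢a c∉as)
    where
    c≢a : mem c (map proj₁ as) ≡ false → finEqᵇ c a ≡ false
    c≢a c∉as with finEqᵇ c a in eq
    ... | false = refl
    ... | true with trans (sym a∈as) (trans (cong (λ x → mem x (map proj₁ as)) (sym (finEqᵇ⇒≡ c a eq))) c∉as)
    ...   | ()
    go : ∀ as → (mem c (map proj₁ as) ≡ false → free φ₀ (finEqᵇ c a ∷ bs) (α c) ≡ free (φ₀ ▷ false) bs (α c)) →
      assign as (λ c bs → free φ₀ bs (α c)) c (finEqᵇ c a ∷ bs) ≡ assign (place a as) (λ c bs → free (φ₀ ▷ false) bs (α c)) c bs
    go []             h = h refl
    go ((z , φ) ∷ as) h with finEqᵇ c z in eq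
    ... | true  = cong (λ x → ev (φ (finEqᵇ x a ∷ bs)) (α c)) (finEqᵇ⇒≡ c z eq)
    ... | false = go as h

  assign-new : ∀ {d} a (as : List (Fin n × Φ (suc d))) φ₀ c bs → mem a (map proj₁ as) ≡ false →
    assign as (λ c bs → free φ₀ bs (α c)) c (finEqᵇ c a ∷ bs) ≡ assign ((a , φ₀ ▷ true) ∷ place a as) (λ c bs → free (φ₀ ▷ false) bs (α c)) c bs
  assign-new a as φ₀ c bs a∉as with finEqᵇ c a in eq
  ... | true  = assign-∉ as _ c (true ∷ bs) (trans (cong (λ x → mem x (map proj₁ as)) (finEqᵇ⇒≡ c a eq)) a∉as)
  ... | false = go as
    where
    go : ∀ as → assign as (λ c bs → free φ₀ bs (α c)) c (false ∷ bs) ≡ assign (place a as) (λ c bs → free (φ₀ ▷ false) bs (α c)) c bs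
    go []             = refl
    go ((z , φ) ∷ as) with finEqᵇ c z in eq′
    ... | true  = cong (λ b → ev (φ (b ∷ bs)) (α c)) (trans (sym eq) (cong (λ x → finEqᵇ x a) (finEqᵇ⇒≡ c z eq′)))
    ... | false = go as

  -- Induction on the vertices: the colour of the next one either lies in `zs` and marks an old
  -- block, or is new and opens a block with pattern `φ₀ ▷ true`. Only the set partition is left to
  -- sum over; the colours of new blocks are chosen at the end by `blocks`.
  total-overPartitions : ∀ d as φ₀ → Distinct (map proj₁ as) →
    total d as φ₀ ≡ overPartitions d (map proj₂ as) φ₀ (λ ps new → evs (map proj₁ as) ps * blocks new (map proj₁ as))
  total-overPartitions zero    as φ₀ distinct = trans
    (∏-cong λ c → assign-cong as _ (λ c _ → ind (α c ≤ᵇ 1)) c [] refl) (∏-assign as (λ c → ind (α c ≤ᵇ 1)) distinct)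
  total-overPartitions (suc d) as φ₀ distinct = begin
    total (suc d) as φ₀
      ≡⟨ ∑-distinct zs _ distinct ⟩
    sumL step zs + ∑∉ zs step
      ≡⟨ cong₂ _+_ (sumL-∈ zs (λ z∈zs → z∈zs)) (∑∉-cong zs new) ⟩
    sumL (λ z → overPartitions d (map proj₂ (place z as)) (φ₀ ▷ false) K) zs
      + ∑∉ zs (λ a → overPartitions d φs′ (φ₀ ▷ false) (λ ps new → evs (a ∷ zs) ps * blocks new (a ∷ zs)))
      ≡⟨ cong₂ _+_ (sumL-place as (λ φs → overPartitions d φs (φ₀ ▷ false) K) distinct)
           (trans (overPartitions-∑∉ d φs′ (φ₀ ▷ false) zs _) (overPartitions-cong d φs′ (φ₀ ▷ false) open-new)) ⟩
    overPartitions (suc d) (map proj₂ as) φ₀ K ∎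
    where
    zs = map proj₁ as
    φs′ = (φ₀ ▷ true) ∷ map (_▷ false) (map proj₂ as)
    K : List Weight → List Weight → ℕ
    K ps new = evs zs ps * blocks new zs
    step : Fin n → ℕ
    step a = ∑v d λ κ → ∏ λ c → assign as (λ c bs → free φ₀ bs (α c)) c (finEqᵇ c a ∷ bits c κ)
    old : ∀ z → mem z zs ≡ true → step z ≡ overPartitions d (map proj₂ (place z as)) (φ₀ ▷ false) K
    old z z∈zs = begin
      step z
        ≡⟨ ∑v-cong d (λ κ → ∏-cong λ c → assign-∈ z as φ₀ c (bits c κ) z∈zs) ⟩
      total d (place z as) (φ₀ ▷ false)
        ≡⟨ total-overPartitions d (place z as) (φ₀ ▷ false) (subst Distinct (sym (places-place z as)) distinct) ⟩
      overPartitions d (map proj₂ (place z as)) (φ₀ ▷ false) (λ ps new → evs (map proj₁ (place z as)) ps * blocks new (map proj₁ (place z as)))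
        ≡⟨ cong (λ zs → overPartitions d (map proj₂ (place z as)) (φ₀ ▷ false) (λ ps new → evs zs ps * blocks new zs)) (places-place z as) ⟩
      overPartitions d (map proj₂ (place z as)) (φ₀ ▷ false) K ∎
    sumL-∈ : ∀ ys → (∀ {z} → mem z ys ≡ true → mem z zs ≡ true) →
      sumL step ys ≡ sumL (λ z → overPartitions d (map proj₂ (place z as)) (φ₀ ▷ false) K) ys
    sumL-∈ []       ys⊆zs = refl
    sumL-∈ (y ∷ ys) ys⊆zs = cong₂ _+_ (old y (ys⊆zs (cong (_∨ mem y ys) (finEqᵇ-refl y))))
      (sumL-∈ ys λ {z} z∈ys → ys⊆zs (trans (cong (finEqᵇ z y ∨_) z∈ys) (∨-zeroʳ (finEqᵇ z y))))
    new : ∀ a → mem a zs ≡ false → step a ≡ overPartitions d φs′ (φ₀ ▷ false) (λ ps new → evs (a ∷ zs) ps * blocks new (a ∷ zs))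
    new a a∉zs = begin
      step a
        ≡⟨ ∑v-cong d (λ κ → ∏-cong λ c → assign-new a as φ₀ c (bits c κ) a∉zs) ⟩
      total d ((a , φ₀ ▷ true) ∷ place a as) (φ₀ ▷ false)
        ≡⟨ total-overPartitions d ((a , φ₀ ▷ true) ∷ place a as) (φ₀ ▷ false)
             (subst (λ ys → mem a ys ≡ false × Distinct ys) (sym (places-place a as)) (a∉zs , distinct)) ⟩
      overPartitions d ((φ₀ ▷ true) ∷ map proj₂ (place a as)) (φ₀ ▷ false)
        (λ ps new → evs (a ∷ map proj₁ (place a as)) ps * blocks new (a ∷ map proj₁ (place a as)))
        ≡⟨ cong₂ (λ φs zs → overPartitions d ((φ₀ ▷ true) ∷ φs) (φ₀ ▷ false) (λ ps new → evs (a ∷ zs) ps * blocks new (a ∷ zs)))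
             (place-∉ a as a∉zs) (places-place a as) ⟩
      overPartitions d φs′ (φ₀ ▷ false) (λ ps new → evs (a ∷ zs) ps * blocks new (a ∷ zs)) ∎
    open-new : ∀ ps new → ∑∉ zs (λ a → evs (a ∷ zs) ps * blocks new (a ∷ zs)) ≡ openBlock K ps new
    open-new []       new = ∑-zero _ λ c → *-zeroʳ (ind (not (mem c zs)))
    open-new (p ∷ ps) new = trans
      (∑-cong λ a → cong (ind (not (mem a zs)) *_) (*-CS.xy∙z≈y∙xz (ev p (α a)) (evs zs ps) (blocks new (a ∷ zs))))
      (∑∉-* zs (evs zs ps) (λ a → ev p (α a) * blocks new (a ∷ zs)))

  multiplicity : ℕ → List (Fin n) → ℕ
  multiplicity s zs = ∑∉ zs λ c → ind (α c ≡ᵇ s)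

  large : List (Fin n) → ℕ
  large zs = ∑∉ zs λ c → ind (4 ≤ᵇ α c)

-- The value of blocks ps zs when tₛ of the colours outside zs have multiplicity s, and t₄ of them multiplicity ≥ 4.
blockCount : List Weight → (t₁ t₂ t₃ t₄ : ℕ) → ℕ
blockCount []                 t₁ t₂ t₃ t₄ = ind (t₄ + t₃ + t₂ ≡ᵇ 0)
blockCount ((p , q , r) ∷ ps) t₁ t₂ t₃ t₄ =
  p * (t₁ * blockCount ps (pred t₁) t₂ t₃ t₄) + q * (t₂ * blockCount ps t₁ (pred t₂) t₃ t₄) + r * (t₃ * blockCount ps t₁ t₂ (pred t₃) t₄)

module _ {n : ℕ} (α : Fin n → ℕ) where

  -- Choosing a colour of multiplicity s uses up one of the tₛ and leaves the other counts
  -- unchanged, so the sum over colours collapses to tₛ equal terms with tₛ lowered by one.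
  blocks-blockCount : ∀ ps zs → blocks α ps zs ≡ blockCount ps (multiplicity α 1 zs) (multiplicity α 2 zs) (multiplicity α 3 zs) (large α zs)
  blocks-blockCount [] zs = begin
    ∏ (λ c → if mem c zs then 1 else ind (α c ≤ᵇ 1))
      ≡⟨ ∏-cong (λ c → pointwise (mem c zs) (α c)) ⟩
    ∏ (λ c → ind (x c ≡ᵇ 0))
      ≡⟨ ∏-ind x ⟩
    ind (∑ x ≡ᵇ 0)
      ≡⟨ cong (λ s → ind (s ≡ᵇ 0)) (trans (∑∉-+ zs _ _) (cong (_+ multiplicity α 2 zs) (∑∉-+ zs _ _))) ⟩
    ind (large α zs + multiplicity α 3 zs + multiplicity α 2 zs ≡ᵇ 0) ∎
    where
    x : Fin n → ℕ
    x c = ind (not (mem c zs)) * (ind (4 ≤ᵇ α c) + ind (α c ≡ᵇ 3) + ind (α c ≡ᵇ 2))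
    pointwise : ∀ b m → (if b then 1 else ind (m ≤ᵇ 1)) ≡ ind (ind (not b) * (ind (4 ≤ᵇ m) + ind (m ≡ᵇ 3) + ind (m ≡ᵇ 2)) ≡ᵇ 0)
    pointwise true  m = refl
    pointwise false 0 = refl
    pointwise false 1 = refl
    pointwise false 2 = refl
    pointwise false 3 = refl
    pointwise false (suc (suc (suc (suc m)))) = refl
  blocks-blockCount ((p , q , r) ∷ ps) zs = begin
    ∑∉ zs (λ z → ev (p , q , r) (α z) * blocks α ps (z ∷ zs))
      ≡⟨ ∑∉-cong zs (λ z z∉zs → trans (cong (ev (p , q , r) (α z) *_) (blocks-blockCount ps (z ∷ zs)))
           (pointwise (α z) (∑∉-∷ z zs (λ c → ind (α c ≡ᵇ 1)) z∉zs) (∑∉-∷ z zs (λ c → ind (α c ≡ᵇ 2)) z∉zs)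
                            (∑∉-∷ z zs (λ c → ind (α c ≡ᵇ 3)) z∉zs) (∑∉-∷ z zs (λ c → ind (4 ≤ᵇ α c)) z∉zs))) ⟩
    ∑∉ zs (λ z → C₁ * ind (α z ≡ᵇ 1) + C₂ * ind (α z ≡ᵇ 2) + C₃ * ind (α z ≡ᵇ 3))
      ≡⟨ trans (∑∉-+ zs _ _) (cong₂ _+_ (trans (∑∉-+ zs _ _) (cong₂ _+_ (∑∉-* zs C₁ _) (∑∉-* zs C₂ _))) (∑∉-* zs C₃ _)) ⟩
    C₁ * t₁ + C₂ * t₂ + C₃ * t₃
      ≡⟨ cong₂ _+_ (cong₂ _+_ (*-CS.xy∙z≈x∙zy p _ t₁) (*-CS.xy∙z≈x∙zy q _ t₂)) (*-CS.xy∙z≈x∙zy r _ t₃) ⟩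
    blockCount ((p , q , r) ∷ ps) t₁ t₂ t₃ t₄ ∎
    where
    t₁ = multiplicity α 1 zs
    t₂ = multiplicity α 2 zs
    t₃ = multiplicity α 3 zs
    t₄ = large α zs
    C₁ = p * blockCount ps (pred t₁) t₂ t₃ t₄
    C₂ = q * blockCount ps t₁ (pred t₂) t₃ t₄
    C₃ = r * blockCount ps t₁ t₂ (pred t₃) t₄
    counts : ∀ {t₁ t₂ t₃ t₄ u₁ u₂ u₃ u₄} → t₁ ≡ u₁ → t₂ ≡ u₂ → t₃ ≡ u₃ → t₄ ≡ u₄ → blockCount ps u₁ u₂ u₃ u₄ ≡ blockCount ps t₁ t₂ t₃ t₄
    counts refl refl refl refl = refl
    only₁ : ∀ x y z → x ≡ x * 1 + y * 0 + z * 0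
    only₁ = solve-∀
    only₂ : ∀ x y z → y ≡ x * 0 + y * 1 + z * 0
    only₂ = solve-∀
    only₃ : ∀ x y z → z ≡ x * 0 + y * 0 + z * 1
    only₃ = solve-∀
    pointwise : ∀ m {u₁ u₂ u₃ u₄} → t₁ ≡ ind (m ≡ᵇ 1) + u₁ → t₂ ≡ ind (m ≡ᵇ 2) + u₂ → t₃ ≡ ind (m ≡ᵇ 3) + u₃ → t₄ ≡ ind (4 ≤ᵇ m) + u₄ →
      ev (p , q , r) m * blockCount ps u₁ u₂ u₃ u₄ ≡ C₁ * ind (m ≡ᵇ 1) + C₂ * ind (m ≡ᵇ 2) + C₃ * ind (m ≡ᵇ 3)
    pointwise 0 e₁ e₂ e₃ e₄ = sym (cong₂ _+_ (cong₂ _+_ (*-zeroʳ C₁) (*-zeroʳ C₂)) (*-zeroʳ C₃))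
    pointwise 1 e₁ e₂ e₃ e₄ = trans (cong (p *_) (counts (cong pred e₁) e₂ e₃ e₄)) (only₁ C₁ C₂ C₃)
    pointwise 2 e₁ e₂ e₃ e₄ = trans (cong (q *_) (counts e₁ (cong pred e₂) e₃ e₄)) (only₂ C₁ C₂ C₃)
    pointwise 3 e₁ e₂ e₃ e₄ = trans (cong (r *_) (counts e₁ e₂ (cong pred e₃) e₄)) (only₃ C₁ C₂ C₃)
    pointwise (suc (suc (suc (suc m)))) e₁ e₂ e₃ e₄ = sym (cong₂ _+_ (cong₂ _+_ (*-zeroʳ C₁) (*-zeroʳ C₂)) (*-zeroʳ C₃))

-- Started without old blocks, every block is new, and α enters only through its type.
patternCount : ∀ d → Φ d → (t₁ t₂ t₃ t₄ : ℕ) → ℕ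
patternCount d φ t₁ t₂ t₃ t₄ = overPartitions d [] φ value
  where
  value : List Weight → List Weight → ℕ
  value []      new = blockCount new t₁ t₂ t₃ t₄
  value (_ ∷ _) new = 0

total-patternCount : ∀ {n} (α : Fin n → ℕ) d φ →
  ∑v d (λ κ → ∏ λ c → free φ (bits c κ) (α c)) ≡ patternCount d φ (multiplicity α 1 []) (multiplicity α 2 []) (multiplicity α 3 []) (large α [])
total-patternCount α d φ = trans (total-overPartitions α d [] φ tt) (overPartitions-cong d [] φ pointwise)
  where
  pointwise : ∀ ps new → evs α [] ps * blocks α new [] ≡ _
  pointwise []       new = trans (+-identityʳ _) (blocks-blockCount α new [])
  pointwise (p ∷ ps) new = refl

-- Colourings of the fork graph

-- Turns a condition on all colours into a product of local weights, the form that
-- `total-patternCount` sums.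
⟦all⟧-∏ : ∀ {n} {P : Fin n → Set} (P? : ∀ c → Dec (P c)) → ⟦ allFin? P? ⟧ ≡ ∏ (λ c → ⟦ P? c ⟧)
⟦all⟧-∏ {zero}  P? = trans (⟦⟧-yes (allFin? P?) λ ()) (sym (∏-empty _))
⟦all⟧-∏ {suc n} P? = begin
  ⟦ allFin? P? ⟧                            ≡⟨ ⟦⟧-⇔ (allFin? P?) (P? zero ×-dec allFin? (P? ∘ suc)) (λ h → h zero , h ∘ suc) (λ { (h₀ , h) zero → h₀ ; (h₀ , h) (suc c) → h c }) ⟩
  ⟦ P? zero ×-dec allFin? (P? ∘ suc) ⟧      ≡⟨ ⟦⟧-× (P? zero) (allFin? (P? ∘ suc)) ⟩
  ⟦ P? zero ⟧ * ⟦ allFin? (P? ∘ suc) ⟧      ≡⟨ cong (⟦ P? zero ⟧ *_) (⟦all⟧-∏ (P? ∘ suc)) ⟩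
  ⟦ P? zero ⟧ * ∏ (λ c → ⟦ P? (suc c) ⟧)    ≡⟨ ∏-suc _ ⟨
  ∏ (λ c → ⟦ P? c ⟧)                        ∎

Allowed : ∀ {n d} → (Vec Bool d → ℕ → Bool) → (Fin n → ℕ) → Vec (Fin n) d → Set
Allowed ok α κ = ∀ c → T (ok (bits c κ) (α c))

allowed? : ∀ {n d} (ok : Vec Bool d → ℕ → Bool) (α : Fin n → ℕ) (κ : Vec (Fin n) d) → Dec (Allowed ok α κ)
allowed? ok α κ = allFin? λ c → T? (ok (bits c κ) (α c))

weights : ∀ {d} → (Vec Bool d → ℕ → Bool) → Φ d
weights ok bs = ind (ok bs 1) , ind (ok bs 2) , ind (ok bs 3)

-- Colours used by none of the distinguished vertices occur at most once; the others have multiplicity 1, 2 or 3.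
Admissible : ∀ {d} → (Vec Bool d → ℕ → Bool) → Set
Admissible ok = ∀ bs → if anyTrue bs then (ok bs 0 ≡ false × (∀ m → ok bs (4 + m) ≡ false)) else (∀ m → ok bs m ≡ (m ≤ᵇ 1))

∑-allowed : ∀ {n d} (ok : Vec Bool d → ℕ → Bool) → Admissible ok → (α : Fin n → ℕ) →
  ∑v d (λ κ → ⟦ allowed? ok α κ ⟧) ≡ patternCount d (weights ok) (multiplicity α 1 []) (multiplicity α 2 []) (multiplicity α 3 []) (large α [])
∑-allowed {d = d} ok admissible α = trans
  (∑v-cong d λ κ → trans (⟦all⟧-∏ (λ c → T? (ok (bits c κ) (α c)))) (∏-cong λ c → pointwise (bits c κ) (α c)))
  (total-patternCount α d (weights ok))
  where
  pointwise : ∀ bs m → ind (ok bs m) ≡ free (weights ok) bs m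
  pointwise bs m with anyTrue bs | admissible bs
  ... | false | unused = cong ind (unused m)
  pointwise bs 0 | true | ok₀ , _ = cong ind ok₀
  pointwise bs 1 | true | _ = refl
  pointwise bs 2 | true | _ = refl
  pointwise bs 3 | true | _ = refl
  pointwise bs (suc (suc (suc (suc m)))) | true | _ , ok₄ = cong ind (ok₄ m)

colourCount : ∀ {d} → Vec Bool d → ℕ
colourCount []       = 0
colourCount (b ∷ bs) = ind b + colourCount bs

cnt-bits : ∀ {n d} (c : Fin n) (κ : Vec (Fin n) d) → cnt c (toList κ) ≡ colourCount (bits c κ)
cnt-bits c []      = refl
cnt-bits c (a ∷ κ) = trans (cnt-∷ c a (toList κ)) (cong (ind (finEqᵇ c a) +_) (cnt-bits c κ))

-- The vertices u, v, x, y in this order; a colour of a vertex adjacent to the clique must not be used again.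
fork-ok : Vec Bool 4 → ℕ → Bool
fork-ok (u ∷ v ∷ x ∷ y ∷ []) m =
  not (u ∧ v) ∧ (colourCount (u ∷ v ∷ x ∷ y ∷ []) ≤ᵇ m)
    ∧ (m ≤ᵇ (if v ∨ x ∨ y then 0 else 1) + colourCount (u ∷ v ∷ x ∷ y ∷ []))

-- No multiplicity reaches 4: a stable subset of u, v, x, y has at most three vertices, and with at
-- least two it meets v, x or y and bars its colour from the clique.
fork-admissible : Admissible fork-ok
fork-admissible (true  ∷ true  ∷ x ∷ y ∷ []) = refl , λ _ → refl
fork-admissible (true  ∷ false ∷ true  ∷ true  ∷ []) = refl , λ _ → refl
fork-admissible (true  ∷ false ∷ true  ∷ false ∷ []) = refl , λ _ → refl
fork-admissible (true  ∷ false ∷ false ∷ true  ∷ []) = refl , λ _ → refl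
fork-admissible (true  ∷ false ∷ false ∷ false ∷ []) = refl , λ _ → refl
fork-admissible (false ∷ true  ∷ true  ∷ true  ∷ []) = refl , λ _ → refl
fork-admissible (false ∷ true  ∷ true  ∷ false ∷ []) = refl , λ _ → refl
fork-admissible (false ∷ true  ∷ false ∷ true  ∷ []) = refl , λ _ → refl
fork-admissible (false ∷ true  ∷ false ∷ false ∷ []) = refl , λ _ → refl
fork-admissible (false ∷ false ∷ true  ∷ true  ∷ []) = refl , λ _ → refl
fork-admissible (false ∷ false ∷ true  ∷ false ∷ []) = refl , λ _ → refl
fork-admissible (false ∷ false ∷ false ∷ true  ∷ []) = refl , λ _ → refl
fork-admissible (false ∷ false ∷ false ∷ false ∷ []) m = refl

cnt⁺₁ : ∀ {n p} (ws : Vec (Fin n) p) i → 1 ≤ cnt (lookup ws i) (toList ws)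
cnt⁺₁ (w ∷ ws) zero    = subst (1 ≤_) (sym (trans (cnt-∷ w w (toList ws)) (cong (_+ cnt w (toList ws)) (⟦⟧-yes (eq? w w) refl)))) (s≤s z≤n)
cnt⁺₁ (w ∷ ws) (suc i) = subst (1 ≤_) (sym (cnt-∷ (lookup ws i) w (toList ws))) (≤-trans (cnt⁺₁ ws i) (m≤n+m _ _))

cnt⁺₂ : ∀ {n p} (ws : Vec (Fin n) p) i j → toℕ i < toℕ j → lookup ws i ≡ lookup ws j → 2 ≤ cnt (lookup ws i) (toList ws)
cnt⁺₂ (w ∷ ws) zero    (suc j) _         eq = subst (2 ≤_)
  (sym (trans (cnt-∷ w w (toList ws)) (cong (_+ cnt w (toList ws)) (⟦⟧-yes (eq? w w) refl))))
  (s≤s (subst (λ c → 1 ≤ cnt c (toList ws)) (sym eq) (cnt⁺₁ ws j)))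
cnt⁺₂ (w ∷ ws) (suc i) (suc j) (s≤s i<j) eq = subst (2 ≤_) (sym (cnt-∷ (lookup ws i) w (toList ws))) (≤-trans (cnt⁺₂ ws i j i<j eq) (m≤n+m _ _))

cnt⁻₁ : ∀ {n p} (c : Fin n) (ws : Vec (Fin n) p) → 1 ≤ cnt c (toList ws) → ∃ λ i → lookup ws i ≡ c
cnt⁻₁ c (w ∷ ws) h with eq? c w
... | yes refl = zero , refl
... | no c≢w with cnt⁻₁ c ws (subst (1 ≤_) (trans (cnt-∷ c w (toList ws)) (cong (_+ cnt c (toList ws)) (⟦⟧-no (eq? c w) c≢w))) h)
...   | i , eq = suc i , eq

cnt⁻₂ : ∀ {n p} (c : Fin n) (ws : Vec (Fin n) p) → 2 ≤ cnt c (toList ws) → ∃₂ λ i j → toℕ i < toℕ j × lookup ws i ≡ lookup ws j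
cnt⁻₂ c (w ∷ ws) h with eq? c w
... | no c≢w with cnt⁻₂ c ws (subst (2 ≤_) (trans (cnt-∷ c w (toList ws)) (cong (_+ cnt c (toList ws)) (⟦⟧-no (eq? c w) c≢w))) h)
...   | i , j , i<j , eq = suc i , suc j , s≤s i<j , eq
cnt⁻₂ c (w ∷ ws) h | yes refl
  with cnt⁻₁ c ws (s≤s⁻¹ (subst (2 ≤_) (trans (cnt-∷ c c (toList ws)) (cong (_+ cnt c (toList ws)) (⟦⟧-yes (eq? c c) refl))) h))
...   | j , eq = zero , suc j , s≤s z≤n , sym eq

-- The adjacency of `forkBlowup` at an arbitrary size: `4 + p` exposes the first four vertices as
-- constructors, which `k + 5` does not.
forkGraph : ∀ d → Graph d
forkGraph d i j = isEdgeℕ (toℕ i) (toℕ j) ∨ isEdgeℕ (toℕ j) (toℕ i)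

Proper : ∀ {d n} → Graph d → Vec (Fin n) d → Set
Proper G κ = ∀ i j → T (G i j) → ¬ lookup κ i ≡ lookup κ j

proper⁻ : ∀ {d n} (G : Graph d) (κ : Vec (Fin n) d) → T (properᵇ G κ) → Proper G κ
proper⁻ G κ t i j edge eq = go (G i j) _ edge (subst T (sym (dec-true (eq? (lookup κ i) (lookup κ j)) eq)) tt)
    (allFin⁻ _ (allFin⁻ _ t i) j)
  where
  go : ∀ a b → T a → T b → T (not a ∨ not b) → ⊥
  go true true _ _ ()

proper⁺ : ∀ {d n} (G : Graph d) (κ : Vec (Fin n) d) → Proper G κ → T (properᵇ G κ)
proper⁺ G κ proper = allFin⁺ _ λ i → allFin⁺ _ λ j → go (G i j) (eq? (lookup κ i) (lookup κ j)) (proper i j)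
  where
  go : ∀ a {P} (P? : Dec P) → (T a → ¬ P) → T (not a ∨ not (does P?))
  go false P?      h = tt
  go true  (no _)  h = tt
  go true  (yes p) h = h tt p

module _ {n p : ℕ} (u v x y : Fin n) (ws : Vec (Fin n) p) where

  private
    κ : Vec (Fin n) (4 + p)
    κ = u ∷ v ∷ x ∷ y ∷ ws

  record ProperFork : Set where
    field
      u≢v      : ¬ u ≡ v
      v∉ws     : ∀ i → ¬ v ≡ lookup ws i
      x∉ws     : ∀ i → ¬ x ≡ lookup ws i
      y∉ws     : ∀ i → ¬ y ≡ lookup ws i
      distinct : ∀ i j → toℕ i < toℕ j → ¬ lookup ws i ≡ lookup ws j

  forkGraph⁻ : Proper (forkGraph (4 + p)) κ → ProperFork
  forkGraph⁻ proper = record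
    { u≢v      = proper zero (suc zero) tt
    ; v∉ws     = λ i → proper (suc zero) (suc (suc (suc (suc i)))) tt
    ; x∉ws     = λ i → proper (suc (suc zero)) (suc (suc (suc (suc i)))) tt
    ; y∉ws     = λ i → proper (suc (suc (suc zero))) (suc (suc (suc (suc i)))) tt
    ; distinct = λ i j i<j → proper (suc (suc (suc (suc i)))) (suc (suc (suc (suc j))))
                   (subst (λ b → T (b ∨ (toℕ j <ᵇ toℕ i))) (sym (Equivalence.to T-≡ (<⇒<ᵇ i<j))) tt)
    }

  forkGraph⁺ : ProperFork → Proper (forkGraph (4 + p)) κ
  forkGraph⁺ pf i j edge = [ edge≢ i j , (λ t → edge≢ j i t ∘ sym) ]′ (Equivalence.to T-∨ edge)
    where
    open ProperFork pf
    edge≢ : ∀ i j → T (isEdgeℕ (toℕ i) (toℕ j)) → ¬ lookup κ i ≡ lookup κ j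
    edge≢ zero zero ()
    edge≢ zero (suc zero) _ = u≢v
    edge≢ zero (suc (suc zero)) ()
    edge≢ zero (suc (suc (suc zero))) ()
    edge≢ zero (suc (suc (suc (suc j)))) ()
    edge≢ (suc zero) zero ()
    edge≢ (suc zero) (suc zero) ()
    edge≢ (suc zero) (suc (suc zero)) ()
    edge≢ (suc zero) (suc (suc (suc zero))) ()
    edge≢ (suc zero) (suc (suc (suc (suc j)))) _ = v∉ws j
    edge≢ (suc (suc zero)) zero ()
    edge≢ (suc (suc zero)) (suc zero) ()
    edge≢ (suc (suc zero)) (suc (suc zero)) ()
    edge≢ (suc (suc zero)) (suc (suc (suc zero))) ()
    edge≢ (suc (suc zero)) (suc (suc (suc (suc j)))) _ = x∉ws j
    edge≢ (suc (suc (suc zero))) zero ()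
    edge≢ (suc (suc (suc zero))) (suc zero) ()
    edge≢ (suc (suc (suc zero))) (suc (suc zero)) ()
    edge≢ (suc (suc (suc zero))) (suc (suc (suc zero))) ()
    edge≢ (suc (suc (suc zero))) (suc (suc (suc (suc j)))) _ = y∉ws j
    edge≢ (suc (suc (suc (suc i)))) zero ()
    edge≢ (suc (suc (suc (suc i)))) (suc zero) ()
    edge≢ (suc (suc (suc (suc i)))) (suc (suc zero)) ()
    edge≢ (suc (suc (suc (suc i)))) (suc (suc (suc zero))) ()
    edge≢ (suc (suc (suc (suc i)))) (suc (suc (suc (suc j)))) t = distinct i j (<ᵇ⇒< (toℕ i) (toℕ j) t)

module _ {n : ℕ} (α : Fin n → ℕ) (u v x y : Fin n) where

  private
    κ₄ : Vec (Fin n) 4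
    κ₄ = u ∷ v ∷ x ∷ y ∷ []
    zs : List (Fin n)
    zs = toList κ₄

  -- How often the clique may use a colour: its vertices are pairwise adjacent and adjacent to v, x,
  -- y, but not to u.
  slack : Fin n → ℕ
  slack c = if finEqᵇ c v ∨ finEqᵇ c x ∨ finEqᵇ c y then 0 else 1

  fork-ok⁻ : ∀ c → T (fork-ok (bits c κ₄) (α c)) →
    T (not (finEqᵇ c u ∧ finEqᵇ c v)) × cnt c zs ≤ α c × α c ≤ slack c + cnt c zs
  fork-ok⁻ c t rewrite cnt-bits c κ₄ = proj₁ t₁ , ≤ᵇ⇒≤ (colourCount (bits c κ₄)) (α c) (proj₁ t₂) , ≤ᵇ⇒≤ (α c) _ (proj₂ t₂)
    where
    t₁ = Equivalence.to (T-∧ {not (finEqᵇ c u ∧ finEqᵇ c v)}) t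
    t₂ = Equivalence.to (T-∧ {colourCount (bits c κ₄) ≤ᵇ α c}) (proj₂ t₁)

  fork-ok⁺ : ∀ c → T (not (finEqᵇ c u ∧ finEqᵇ c v)) → cnt c zs ≤ α c → α c ≤ slack c + cnt c zs →
    T (fork-ok (bits c κ₄) (α c))
  fork-ok⁺ c t lower upper rewrite cnt-bits c κ₄ =
    Equivalence.from (T-∧ {not (finEqᵇ c u ∧ finEqᵇ c v)}) (t , Equivalence.from (T-∧ {colourCount (bits c κ₄) ≤ᵇ α c}) (≤⇒≤ᵇ lower , ≤⇒≤ᵇ upper))

  slack≤1 : ∀ c → slack c ≤ 1
  slack≤1 c with finEqᵇ c v ∨ finEqᵇ c x ∨ finEqᵇ c y
  ... | true  = z≤n
  ... | false = ≤-refl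

  sub≤slack : Allowed fork-ok α κ₄ → ∀ c → sub α zs c ≤ slack c
  sub≤slack allowed c = m≤n+o⇒m∸n≤o (α c) (cnt c zs) (≤-trans (proj₂ (proj₂ (fork-ok⁻ c (allowed c)))) (≤-reflexive (+-comm (slack c) (cnt c zs))))

  module _ {p : ℕ} (ws : Vec (Fin n) p) where

    to-allowed : ProperFork u v x y ws → Content α (zs ++ toList ws) → Allowed fork-ok α κ₄
    to-allowed pf content c = fork-ok⁺ c (not-both (eq? c u) (eq? c v)) (≤-trans (m≤m+n _ _) (≤-reflexive split))
      (≤-trans (≤-reflexive (sym split)) (≤-trans (+-monoʳ-≤ (cnt c zs) cnt≤slack) (≤-reflexive (+-comm (cnt c zs) (slack c)))))
      where
      open ProperFork pf
      split : cnt c zs + cnt c (toList ws) ≡ α c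
      split = trans (sym (cnt-++ c zs (toList ws))) (content c)
      not-both : (P? : Dec (c ≡ u)) (Q? : Dec (c ≡ v)) → T (not (does P? ∧ does Q?))
      not-both (yes c≡u) (yes c≡v) = ⊥-elim (u≢v (trans (sym c≡u) c≡v))
      not-both (yes _)   (no _)    = tt
      not-both (no _)    _         = tt
      unused : ∀ {a} → (∀ i → ¬ a ≡ lookup ws i) → c ≡ a → cnt c (toList ws) ≤ 0
      unused a∉ws refl = ≮⇒≥ λ 1≤cnt → let i , eq = cnt⁻₁ c ws 1≤cnt in a∉ws i (sym eq)
      cnt≤slack : cnt c (toList ws) ≤ slack c
      cnt≤slack = go (eq? c v) (eq? c x) (eq? c y)
        where
        go : (P? : Dec (c ≡ v)) (Q? : Dec (c ≡ x)) (R? : Dec (c ≡ y)) → cnt c (toList ws) ≤ (if does P? ∨ does Q? ∨ does R? then 0 else 1)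
        go (yes c≡v) _ _ = unused v∉ws c≡v
        go (no _) (yes c≡x) _ = unused x∉ws c≡x
        go (no _) (no _) (yes c≡y) = unused y∉ws c≡y
        go (no _) (no _) (no _) = ≮⇒≥ λ 2≤cnt → let i , j , i<j , eq = cnt⁻₂ c ws 2≤cnt in distinct i j i<j eq

    from-allowed : Allowed fork-ok α κ₄ → Content (sub α zs) (toList ws) → ProperFork u v x y ws
    from-allowed allowed content = record
      { u≢v      = λ { refl → contradiction-both (proj₁ (fork-ok⁻ u (allowed u))) }
      ; v∉ws     = λ i → excluded v i (cong (λ b → if b ∨ finEqᵇ v x ∨ finEqᵇ v y then 0 else 1) (finEqᵇ-refl v))
      ; x∉ws     = λ i → excluded x i (trans (cong (λ b → if finEqᵇ x v ∨ b ∨ finEqᵇ x y then 0 else 1) (finEqᵇ-refl x))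
                     (cong (λ b → if b then 0 else 1) (∨-zeroʳ (finEqᵇ x v))))
      ; y∉ws     = λ i → excluded y i (trans (cong (λ b → if finEqᵇ y v ∨ finEqᵇ y x ∨ b then 0 else 1) (finEqᵇ-refl y))
                     (cong (λ b → if b then 0 else 1) (trans (cong (finEqᵇ y v ∨_) (∨-zeroʳ (finEqᵇ y x))) (∨-zeroʳ (finEqᵇ y v)))))
      ; distinct = λ i j i<j eq → <⇒≱ (cnt⁺₂ ws i j i<j eq) (≤-trans (cnt≤slack (lookup ws i)) (slack≤1 (lookup ws i)))
      }
      where
      cnt≤slack : ∀ c → cnt c (toList ws) ≤ slack c
      cnt≤slack c = ≤-trans (≤-reflexive (content c)) (sub≤slack allowed c)
      contradiction-both : ¬ T (not (finEqᵇ u u ∧ finEqᵇ u u))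
      contradiction-both t rewrite finEqᵇ-refl u = t
      excluded : ∀ a i → slack a ≡ 0 → ¬ a ≡ lookup ws i
      excluded a i eq refl = <⇒≱ (cnt⁺₁ ws i) (≤-trans (cnt≤slack a) (≤-reflexive eq))

    -- The clique must carry the residual content. Bounding that content by `slack` rules out
    -- repetitions within the clique as well as the colours of v, x, y, so properness becomes a
    -- condition on u, v, x, y alone.
    colouring : ind (properᵇ (forkGraph (4 + p)) (u ∷ v ∷ x ∷ y ∷ ws) ∧ hasContent α (zs ++ toList ws))
                ≡ ⟦ allowed? fork-ok α κ₄ ⟧ * H (sub α zs) (toList ws)
    colouring = trans
      (⟦⟧-⇔ (T? (properᵇ G κ ∧ hasContent α (zs ++ toList ws))) (allowed? fork-ok α κ₄ ×-dec content? (sub α zs) (toList ws))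
        (λ t → let t₁ , t₂ = Equivalence.to (T-∧ {properᵇ G κ}) t
                   content = hasContent⁻ α (zs ++ toList ws) t₂
                   allowed = to-allowed (forkGraph⁻ u v x y ws (proper⁻ G κ t₁)) content
               in allowed , λ c → trans (sym (m+n∸m≡n (cnt c zs) (cnt c (toList ws)))) (cong (_∸ cnt c zs) (trans (sym (cnt-++ c zs (toList ws))) (content c))))
        (λ { (allowed , content) → Equivalence.from (T-∧ {properᵇ G κ})
          ( proper⁺ G κ (forkGraph⁺ u v x y ws (from-allowed allowed content))
          , hasContent⁺ α (zs ++ toList ws) λ c → trans (cnt-++ c zs (toList ws)) (trans (cong (cnt c zs +_) (content c)) (m+[n∸m]≡n (proj₁ (proj₂ (fork-ok⁻ c (allowed c))))))) }))
      (⟦⟧-× (allowed? fork-ok α κ₄) (content? (sub α zs) (toList ws)))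
      where
      G = forkGraph (4 + p)
      κ = u ∷ v ∷ x ∷ y ∷ ws

  -- An allowed choice on u, v, x, y leaves a squarefree content, for which `words` counts p! clique
  -- colourings whatever the choice was.
  colourings : ∀ p → ∑v p (λ ws → ind (properᵇ (forkGraph (4 + p)) (u ∷ v ∷ x ∷ y ∷ ws) ∧ hasContent α (zs ++ toList ws)))
                     ≡ ⟦ ∑ α ≟ 4 + p ⟧ * p ! * ⟦ allowed? fork-ok α κ₄ ⟧
  colourings p = trans (∑v-cong p colouring) (trans (*-∑v p ⟦ allowed? fork-ok α κ₄ ⟧ _) (go (allowed? fork-ok α κ₄)))
    where
    go : (A? : Dec (Allowed fork-ok α κ₄)) → ⟦ A? ⟧ * ∑v p (H (sub α zs) ∘ toList) ≡ ⟦ ∑ α ≟ 4 + p ⟧ * p ! * ⟦ A? ⟧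
    go (no _) = sym (*-zeroʳ (⟦ ∑ α ≟ 4 + p ⟧ * p !))
    go (yes allowed) = begin
      1 * ∑v p (H (sub α zs) ∘ toList)    ≡⟨ *-identityˡ _ ⟩
      ∑v p (H (sub α zs) ∘ toList)        ≡⟨ words p (sub α zs) (λ c → ≤-trans (sub≤slack allowed c) (slack≤1 c)) ⟩
      ⟦ ∑ (sub α zs) ≟ p ⟧ * p !          ≡⟨ cong (_* p !) (⟦⟧-⇔ (∑ (sub α zs) ≟ p) (∑ α ≟ 4 + p)
                                               (λ eq → trans (∑-sub α zs zs≤α) (cong (4 +_) eq))
                                               (λ eq → +-cancelˡ-≡ 4 _ _ (trans (sym (∑-sub α zs zs≤α)) eq))) ⟩
      ⟦ ∑ α ≟ 4 + p ⟧ * p !               ≡⟨ *-identityʳ _ ⟨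
      ⟦ ∑ α ≟ 4 + p ⟧ * p ! * 1           ∎
      where
      zs≤α : ∀ c → cnt c zs ≤ α c
      zs≤α c = proj₁ (proj₂ (fork-ok⁻ c (allowed c)))

chromCoeff-fork : ∀ {n} (α : Fin n → ℕ) p →
  chromCoeff (forkGraph (4 + p)) n α ≡ ⟦ ∑ α ≟ 4 + p ⟧ * p ! *
    patternCount 4 (weights fork-ok) (multiplicity α 1 []) (multiplicity α 2 []) (multiplicity α 3 []) (large α [])
chromCoeff-fork {n} α p = begin
  chromCoeff (forkGraph (4 + p)) n α
    ≡⟨ countᵇ-sumL _ (allVecs n (4 + p)) ⟩
  sumL (λ κ → ind (properᵇ (forkGraph (4 + p)) κ ∧ hasContent α (toList κ))) (allVecs n (4 + p))
    ≡⟨ sumL-allVecs (4 + p) _ ⟩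
  ∑v (4 + p) (λ κ → ind (properᵇ (forkGraph (4 + p)) κ ∧ hasContent α (toList κ)))
    ≡⟨ ∑ⁿ-cong 4 (λ u v x y → colourings α u v x y p) ⟩
  ∑v 4 (λ κ → ⟦ ∑ α ≟ 4 + p ⟧ * p ! * ⟦ allowed? fork-ok α κ ⟧)
    ≡⟨ *-∑v 4 (⟦ ∑ α ≟ 4 + p ⟧ * p !) (λ κ → ⟦ allowed? fork-ok α κ ⟧) ⟩
  ⟦ ∑ α ≟ 4 + p ⟧ * p ! * ∑v 4 (λ κ → ⟦ allowed? fork-ok α κ ⟧)
    ≡⟨ cong (⟦ ∑ α ≟ 4 + p ⟧ * p ! *_) (∑-allowed fork-ok fork-admissible α) ⟩
  ⟦ ∑ α ≟ 4 + p ⟧ * p ! * patternCount 4 (weights fork-ok) (multiplicity α 1 []) (multiplicity α 2 []) (multiplicity α 3 []) (large α []) ∎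

-- Explicit counts

falling : ℕ → ℕ → ℕ
falling t zero    = 1
falling t (suc j) = t * falling (pred t) j

lower : (ℕ → ℕ) → ℕ → ℕ
lower f zero    = 0
lower f (suc m) = f m

-- The total weight of the ways to give b blocks a colour of multiplicity 2, c blocks one of multiplicity 3,
-- and the remaining ones a colour of multiplicity 1.
choices : List Weight → ℕ → ℕ → ℕ
choices []                 zero zero = 1
choices []                 _    _    = 0
choices ((p , q , r) ∷ ps) b    c    = p * choices ps b c + q * lower (λ b → choices ps b c) b + r * lower (choices ps b) c

-- `choices ps b c` is the coefficient of Y^b Z^c in a product of `length ps` factors p + q Y + r Z,
-- whose degree is at most `length ps`.
choices-zero : ∀ ps b c → length ps < b + c → choices ps b c ≡ 0
choices-zero []                 zero    (suc c) _ = refl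
choices-zero []                 (suc b) c       _ = refl
choices-zero ((p , q , r) ∷ ps) b c len<b+c = begin
  p * choices ps b c + q * lower (λ b → choices ps b c) b + r * lower (choices ps b) c
    ≡⟨ cong₂ _+_ (cong₂ _+_ (cong (p *_) (choices-zero ps b c (<-trans (n<1+n _) len<b+c))) (cong (q *_) (lower-b b len<b+c))) (cong (r *_) (lower-c c len<b+c)) ⟩
  p * 0 + q * 0 + r * 0
    ≡⟨ zeros p q r ⟩
  0 ∎
  where
  zeros : ∀ p q r → p * 0 + q * 0 + r * 0 ≡ 0
  zeros = solve-∀
  lower-b : ∀ b → suc (length ps) < b + c → lower (λ b → choices ps b c) b ≡ 0
  lower-b zero    _ = refl
  lower-b (suc b) h = choices-zero ps b c (s≤s⁻¹ h)
  lower-c : ∀ c → suc (length ps) < b + c → lower (choices ps b) c ≡ 0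
  lower-c zero    _ = refl
  lower-c (suc c) h = choices-zero ps b c (s≤s⁻¹ (subst (suc (length ps) <_) (+-suc b c) h))

blockCount-choices : ∀ ps t₁ t₂ t₃ →
  blockCount ps t₁ t₂ t₃ 0 ≡ choices ps t₂ t₃ * (falling t₁ (length ps ∸ (t₂ + t₃)) * (t₂ ! * t₃ !))
blockCount-choices []                 t₁ zero     zero     = refl
blockCount-choices []                 t₁ (suc t₂) zero     = refl
blockCount-choices []                 t₁ zero     (suc t₃) = refl
blockCount-choices []                 t₁ (suc t₂) (suc t₃) = refl
blockCount-choices ((p , q , r) ∷ ps) t₁ t₂       t₃       = begin
  p * (t₁ * blockCount ps (pred t₁) t₂ t₃ 0) + q * (t₂ * blockCount ps t₁ (pred t₂) t₃ 0) + r * (t₃ * blockCount ps t₁ t₂ (pred t₃) 0)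
    ≡⟨ cong₂ _+_ (cong₂ _+_ (cong (p *_) ones) (cong (q *_) (twos t₂))) (cong (r *_) (threes t₃)) ⟩
  p * (choices ps t₂ t₃ * X t₂ t₃) + q * (lower (λ b → choices ps b t₃) t₂ * X t₂ t₃) + r * (lower (choices ps t₂) t₃ * X t₂ t₃)
    ≡⟨ collect p q r (choices ps t₂ t₃) (lower (λ b → choices ps b t₃) t₂) (lower (choices ps t₂) t₃) (X t₂ t₃) ⟩
  choices ((p , q , r) ∷ ps) t₂ t₃ * X t₂ t₃ ∎
  where
  X : ℕ → ℕ → ℕ
  X t₂ t₃ = falling t₁ (suc (length ps) ∸ (t₂ + t₃)) * (t₂ ! * t₃ !)
  collect : ∀ p q r x y z w → p * (x * w) + q * (y * w) + r * (z * w) ≡ (p * x + q * y + r * z) * w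
  collect = solve-∀
  ones : t₁ * blockCount ps (pred t₁) t₂ t₃ 0 ≡ choices ps t₂ t₃ * X t₂ t₃
  -- With too few blocks the truncated subtraction would not step with `falling`, but `choices`
  -- vanishes there.
  ones with t₂ + t₃ ≤? length ps
  ... | yes small = begin
    t₁ * blockCount ps (pred t₁) t₂ t₃ 0
      ≡⟨ cong (t₁ *_) (blockCount-choices ps (pred t₁) t₂ t₃) ⟩
    t₁ * (choices ps t₂ t₃ * (falling (pred t₁) (length ps ∸ (t₂ + t₃)) * (t₂ ! * t₃ !)))
      ≡⟨ move t₁ (choices ps t₂ t₃) _ (t₂ ! * t₃ !) ⟩
    choices ps t₂ t₃ * (falling t₁ (suc (length ps ∸ (t₂ + t₃))) * (t₂ ! * t₃ !))
      ≡⟨ cong (λ j → choices ps t₂ t₃ * (falling t₁ j * (t₂ ! * t₃ !))) (+-∸-assoc 1 small) ⟨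
    choices ps t₂ t₃ * X t₂ t₃ ∎
    where
    move : ∀ t c f w → t * (c * (f * w)) ≡ c * (t * f * w)
    move = solve-∀
  ... | no large = begin
    t₁ * blockCount ps (pred t₁) t₂ t₃ 0
      ≡⟨ cong (t₁ *_) (trans (blockCount-choices ps (pred t₁) t₂ t₃) (cong (_* (falling (pred t₁) (length ps ∸ (t₂ + t₃)) * (t₂ ! * t₃ !))) none)) ⟩
    t₁ * 0
      ≡⟨ *-zeroʳ t₁ ⟩
    0
      ≡⟨ cong (_* X t₂ t₃) none ⟨
    choices ps t₂ t₃ * X t₂ t₃ ∎
    where
    none : choices ps t₂ t₃ ≡ 0
    none = choices-zero ps t₂ t₃ (≰⇒> large)
  move₂ : ∀ n c f w v → n * (c * (f * (w * v))) ≡ c * (f * (n * w * v))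
  move₂ = solve-∀
  move₃ : ∀ n c f w v → n * (c * (f * (w * v))) ≡ c * (f * (w * (n * v)))
  move₃ = solve-∀
  twos : ∀ t₂ → t₂ * blockCount ps t₁ (pred t₂) t₃ 0 ≡ lower (λ b → choices ps b t₃) t₂ * X t₂ t₃
  twos zero     = refl
  twos (suc t₂) = trans (cong (suc t₂ *_) (blockCount-choices ps t₁ t₂ t₃)) (move₂ (suc t₂) (choices ps t₂ t₃) (falling t₁ (length ps ∸ (t₂ + t₃))) (t₂ !) (t₃ !))
  threes : ∀ t₃ → t₃ * blockCount ps t₁ t₂ (pred t₃) 0 ≡ lower (choices ps t₂) t₃ * X t₂ t₃
  threes zero     = refl
  threes (suc t₃) = trans (cong (suc t₃ *_) (blockCount-choices ps t₁ t₂ t₃))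
    (trans (move₃ (suc t₃) (choices ps t₂ t₃) (falling t₁ (length ps ∸ (t₂ + t₃))) (t₂ !) (t₃ !))
           (cong (λ s → choices ps t₂ t₃ * (falling t₁ (suc (length ps) ∸ s) * (t₂ ! * (suc t₃) !))) (sym (+-suc t₂ t₃))))

-- Each vertex opens at most one block; this bounds the block numbers over which
-- `patternCount-falling` groups.
overPartitions-cong-≤ : ∀ d φs φ₀ {K L} → (∀ ps new → length new ≤ d → K ps new ≡ L ps new) → overPartitions d φs φ₀ K ≡ overPartitions d φs φ₀ L
overPartitions-cong-≤ zero    φs φ₀ eq = eq _ [] z≤n
overPartitions-cong-≤ (suc d) φs φ₀ {K} {L} eq = cong₂ _+_
  (sumL-cong (λ φs′ → overPartitions-cong-≤ d φs′ (φ₀ ▷ false) (λ ps new h → eq ps new (m≤n⇒m≤1+n h))) (marks φs))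
  (overPartitions-cong-≤ d _ _ openBlock-eq)
  where
  openBlock-eq : ∀ ps new → length new ≤ d → openBlock K ps new ≡ openBlock L ps new
  openBlock-eq []       new h = refl
  openBlock-eq (p ∷ ps) new h = eq ps (p ∷ new) (s≤s h)

sumL-+ : {A : Set} (f g : A → ℕ) (xs : List A) → sumL (λ x → f x + g x) xs ≡ sumL f xs + sumL g xs
sumL-+ f g []       = refl
sumL-+ f g (x ∷ xs) = trans (cong (f x + g x +_) (sumL-+ f g xs)) (interchange (f x) (g x) _ _)
  where
  interchange : ∀ a b c d → a + b + (c + d) ≡ a + c + (b + d)
  interchange = solve-∀

overPartitions-zero : ∀ d φs φ₀ {K} → (∀ ps new → K ps new ≡ 0) → overPartitions d φs φ₀ K ≡ 0
overPartitions-zero zero    φs φ₀ eq = eq _ []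
overPartitions-zero (suc d) φs φ₀ {K} eq = cong₂ _+_
  (trans (sumL-cong (λ φs′ → overPartitions-zero d φs′ (φ₀ ▷ false) eq) (marks φs)) (*-sumL 0 (λ _ → 0) (marks φs)))
  (overPartitions-zero d _ _ openBlock-zero)
  where
  openBlock-zero : ∀ ps new → openBlock K ps new ≡ 0
  openBlock-zero []       new = refl
  openBlock-zero (p ∷ ps) new = eq ps (p ∷ new)

overPartitions-linear : ∀ d φs φ₀ x K L →
  overPartitions d φs φ₀ (λ ps new → K ps new * x + L ps new) ≡ overPartitions d φs φ₀ K * x + overPartitions d φs φ₀ L
overPartitions-linear zero    φs φ₀ x K L = refl
overPartitions-linear (suc d) φs φ₀ x K L = begin
  sumL (λ φs′ → overPartitions d φs′ (φ₀ ▷ false) (λ ps new → K ps new * x + L ps new)) (marks φs)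
    + overPartitions d φs″ (φ₀ ▷ false) (openBlock (λ ps new → K ps new * x + L ps new))
    ≡⟨ cong₂ _+_
         (trans (sumL-cong (λ φs′ → trans (overPartitions-linear d φs′ (φ₀ ▷ false) x K L) (cong (_+ overPartitions d φs′ (φ₀ ▷ false) L) (*-comm _ x))) (marks φs))
           (trans (sumL-+ _ _ (marks φs)) (cong (_+ sumL (λ φs′ → overPartitions d φs′ (φ₀ ▷ false) L) (marks φs)) (*-sumL x _ (marks φs)))))
         (trans (overPartitions-cong d _ _ openBlock-linear) (overPartitions-linear d φs″ (φ₀ ▷ false) x (openBlock K) (openBlock L))) ⟩
  (x * A + B) + (C * x + D)
    ≡⟨ interchange x A B C D ⟩
  (A + C) * x + (B + D) ∎
  where
  φs″ = (φ₀ ▷ true) ∷ map (_▷ false) φs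
  A = sumL (λ φs′ → overPartitions d φs′ (φ₀ ▷ false) K) (marks φs)
  B = sumL (λ φs′ → overPartitions d φs′ (φ₀ ▷ false) L) (marks φs)
  C = overPartitions d φs″ (φ₀ ▷ false) (openBlock K)
  D = overPartitions d φs″ (φ₀ ▷ false) (openBlock L)
  interchange : ∀ x a b c d → (x * a + b) + (c * x + d) ≡ (a + c) * x + (b + d)
  interchange = solve-∀
  openBlock-linear : ∀ ps new → openBlock (λ ps new → K ps new * x + L ps new) ps new ≡ openBlock K ps new * x + openBlock L ps new
  openBlock-linear []       new = refl
  openBlock-linear (p ∷ ps) new = refl

-- For given t₂ and t₃, t₁ enters only through a falling factorial whose length depends on the
-- number of blocks. Fixing that number l leaves a factor free of t₁.
coefficient : ℕ → ℕ → ℕ → List Weight → List Weight → ℕ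
coefficient t₂ t₃ l []      new = ind (length new ≡ᵇ l) * choices new t₂ t₃
coefficient t₂ t₃ l (_ ∷ _) new = 0

-- Once t₂ and t₃ are numerals the coefficients compute, so that this is an explicit polynomial in t₁.
patternCount-falling : ∀ d φ t₁ t₂ t₃ → patternCount d φ t₁ t₂ t₃ 0
  ≡ sumL (λ l → overPartitions d [] φ (coefficient t₂ t₃ l) * (falling t₁ (l ∸ (t₂ + t₃)) * (t₂ ! * t₃ !))) (downFrom (suc d))
patternCount-falling d φ t₁ t₂ t₃ = trans (overPartitions-cong-≤ d [] φ grouped) (linear (downFrom (suc d)))
  where
  X : ℕ → ℕ
  X l = falling t₁ (l ∸ (t₂ + t₃)) * (t₂ ! * t₃ !)
  terms : List ℕ → List Weight → List Weight → ℕ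
  terms ls ps new = sumL (λ l → coefficient t₂ t₃ l ps new * X l) ls
  linear : ∀ ls → overPartitions d [] φ (terms ls) ≡ sumL (λ l → overPartitions d [] φ (coefficient t₂ t₃ l) * X l) ls
  linear []       = overPartitions-zero d [] φ λ _ _ → refl
  linear (l ∷ ls) = trans (overPartitions-linear d [] φ (X l) (coefficient t₂ t₃ l) (terms ls)) (cong (overPartitions d [] φ (coefficient t₂ t₃ l) * X l +_) (linear ls))
  beyond : ∀ m new → m ≤ length new → terms (downFrom m) [] new ≡ 0
  beyond zero    new h = refl
  beyond (suc m) new h = cong₂ _+_ (cong (λ b → b * choices new t₂ t₃ * X m) (⟦⟧-no (length new ≟ m) (λ eq → <-irrefl (sym eq) h))) (beyond m new (<⇒≤ h))
  select : ∀ m new → length new < m → terms (downFrom m) [] new ≡ choices new t₂ t₃ * X (length new)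
  select (suc m) new h with length new ≟ m
  ... | yes refl = trans (cong₂ _+_ (cong (λ b → b * choices new t₂ t₃ * X (length new)) (⟦⟧-yes (length new ≟ length new) refl)) (beyond (length new) new ≤-refl))
                         (trans (+-identityʳ _) (cong (_* X (length new)) (+-identityʳ (choices new t₂ t₃))))
  ... | no len≢m = cong₂ _+_ (cong (λ b → b * choices new t₂ t₃ * X m) (⟦⟧-no (length new ≟ m) len≢m)) (select m new (≤∧≢⇒< (s≤s⁻¹ h) len≢m))
  grouped : ∀ ps new → length new ≤ d → _ ≡ terms (downFrom (suc d)) ps new
  grouped []       new h = trans (blockCount-choices new t₁ t₂ t₃) (sym (select (suc d) new (s≤s h)))
  grouped (p ∷ ps) new h = sym (trans (*-sumL 0 (λ _ → 0) (downFrom (suc d))) refl)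

blockCount-large : ∀ ps t₁ t₂ t₃ t₄ → blockCount ps t₁ t₂ t₃ (suc t₄) ≡ 0
blockCount-large []                 t₁ t₂ t₃ t₄ = refl
blockCount-large ((p , q , r) ∷ ps) t₁ t₂ t₃ t₄
  rewrite blockCount-large ps (pred t₁) t₂ t₃ t₄ | blockCount-large ps t₁ (pred t₂) t₃ t₄ | blockCount-large ps t₁ t₂ (pred t₃) t₄ = zeros p q r t₁ t₂ t₃
  where
  zeros : ∀ p q r t₁ t₂ t₃ → p * (t₁ * 0) + q * (t₂ * 0) + r * (t₃ * 0) ≡ 0
  zeros = solve-∀

patternCount-large : ∀ d φ t₁ t₂ t₃ t₄ → patternCount d φ t₁ t₂ t₃ (suc t₄) ≡ 0
patternCount-large d φ t₁ t₂ t₃ t₄ = overPartitions-zero d [] φ zeros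
  where
  zeros : ∀ ps new → _ ≡ 0
  zeros []      new = blockCount-large new t₁ t₂ t₃ t₄
  zeros (_ ∷ _) new = refl

-- Coefficients of the products with e_p, and comparison with the fork

fit-ok : ∀ {d} → (Vec Bool d → Bool) → (Vec Bool d → ℕ) → Vec Bool d → ℕ → Bool
fit-ok excl load bs m = excl bs ∧ (load bs ≤ᵇ m) ∧ (m ≤ᵇ suc (load bs))

-- `load` is the exponent of a colour in the monomial `zs`, read off from which entries of κ equal
-- it, and `excl` expresses A colour by colour. The coefficient thus becomes a count to which
-- `∑-allowed` applies.
fits-allowed : ∀ {n d} (α : Fin n → ℕ) (excl : Vec Bool d → Bool) (load : Vec Bool d → ℕ) {A : Set} (A? : Dec A) zs (κ : Vec (Fin n) d) →
  (A → ∀ c → T (excl (bits c κ))) → ((∀ c → T (excl (bits c κ))) → A) → (∀ c → cnt c zs ≡ load (bits c κ)) →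
  ⟦ A? ⟧ * ⟦ fits? α zs ⟧ ≡ ⟦ allowed? (fit-ok excl load) α κ ⟧
fits-allowed α excl load A? zs κ to from eq = trans (sym (⟦⟧-× A? (fits? α zs))) (⟦⟧-⇔ (A? ×-dec fits? α zs) (allowed? (fit-ok excl load) α κ)
  (λ { (a , fits) c → Equivalence.from (T-∧ {excl (bits c κ)}) (to a c , Equivalence.from (T-∧ {load (bits c κ) ≤ᵇ α c})
        ( ≤⇒≤ᵇ (subst (_≤ α c) (eq c) (proj₁ (fits c))) , ≤⇒≤ᵇ (subst (λ l → α c ≤ suc l) (eq c) (proj₂ (fits c))))) })
  (λ allowed → from (λ c → proj₁ (Equivalence.to (T-∧ {excl (bits c κ)}) (allowed c)))
     , λ c → let t = Equivalence.to (T-∧ {load (bits c κ) ≤ᵇ α c}) (proj₂ (Equivalence.to (T-∧ {excl (bits c κ)}) (allowed c))) in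
         subst (_≤ α c) (sym (eq c)) (≤ᵇ⇒≤ _ (α c) (proj₁ t)) , subst (λ l → α c ≤ suc l) (sym (eq c)) (≤ᵇ⇒≤ (α c) _ (proj₂ t))))

ok-1 : Vec Bool 0 → ℕ → Bool
ok-1 = fit-ok (λ _ → true) (λ _ → 0)

ok-e₁ ok-p₂ : Vec Bool 1 → ℕ → Bool
ok-e₁ = fit-ok (λ _ → true) (λ { (b ∷ []) → colourCount (b ∷ []) })
ok-p₂ = fit-ok (λ _ → true) (λ { (b ∷ []) → colourCount (b ∷ b ∷ []) })

apart : Vec Bool 2 → Bool
apart (b ∷ c ∷ []) = not (b ∧ c)

ok-m₁₁ ok-m₂₁ : Vec Bool 2 → ℕ → Bool
ok-m₁₁ = fit-ok apart (λ { (b ∷ c ∷ []) → colourCount (b ∷ c ∷ []) })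
ok-m₂₁ = fit-ok apart (λ { (b ∷ c ∷ []) → colourCount (b ∷ b ∷ c ∷ []) })

admissible-1 : Admissible ok-1
admissible-1 [] m = refl

admissible-e₁ : Admissible ok-e₁
admissible-e₁ (true  ∷ []) = refl , λ _ → refl
admissible-e₁ (false ∷ []) m = refl

admissible-p₂ : Admissible ok-p₂
admissible-p₂ (true  ∷ []) = refl , λ _ → refl
admissible-p₂ (false ∷ []) m = refl

admissible-m₁₁ : Admissible ok-m₁₁
admissible-m₁₁ (true  ∷ true  ∷ []) = refl , λ _ → refl
admissible-m₁₁ (true  ∷ false ∷ []) = refl , λ _ → refl
admissible-m₁₁ (false ∷ true  ∷ []) = refl , λ _ → refl
admissible-m₁₁ (false ∷ false ∷ []) m = refl

admissible-m₂₁ : Admissible ok-m₂₁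
admissible-m₂₁ (true  ∷ true  ∷ []) = refl , λ _ → refl
admissible-m₂₁ (true  ∷ false ∷ []) = refl , λ _ → refl
admissible-m₂₁ (false ∷ true  ∷ []) = refl , λ _ → refl
admissible-m₂₁ (false ∷ false ∷ []) m = refl

apart⁺ : ∀ {n} {b d : Fin n} → ¬ b ≡ d → ∀ c → T (apart (bits c (b ∷ d ∷ [])))
apart⁺ {b = b} {d} b≢d c = go (eq? c b) (eq? c d)
  where
  go : (P? : Dec (c ≡ b)) (Q? : Dec (c ≡ d)) → T (not (does P? ∧ does Q?))
  go (yes c≡b) (yes c≡d) = ⊥-elim (b≢d (trans (sym c≡b) c≡d))
  go (yes _)   (no _)    = tt
  go (no _)    _         = tt

apart⁻ : ∀ {n} {b d : Fin n} → (∀ c → T (apart (bits c (b ∷ d ∷ [])))) → ¬ b ≡ d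
apart⁻ {b = b} h refl = subst (λ x → T (not (x ∧ x))) (finEqᵇ-refl b) (h b)

module _ {n : ℕ} (α : Fin n → ℕ) where

  count : ∀ {d} → (Vec Bool d → ℕ → Bool) → ℕ
  count {d} ok = patternCount d (weights ok) (multiplicity α 1 []) (multiplicity α 2 []) (multiplicity α 3 []) (large α [])

  module _ (k : ℕ) where

    private
      σ = ⟦ ∑ α ≟ 5 + k ⟧

    e-value : e (H α) (5 + k) [] ≡ σ * count ok-1
    e-value = trans (col-H-++ (5 + k) α []) (trans (*-comm ⟦ fits? α [] ⟧ σ) (cong (σ *_) (trans
      (trans (sym (+-identityʳ _)) (fits-allowed α (λ _ → true) (λ _ → 0) (yes tt) [] [] _ _ λ _ → refl)) (∑-allowed ok-1 admissible-1 α))))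

    single : ∀ (zs : Fin n → List (Fin n)) load → (∀ b c → cnt c (zs b) ≡ load (bits c (b ∷ []))) →
      Admissible (fit-ok (λ _ → true) load) → ∀ p → (∀ b → length (zs b) + p ≡ 5 + k) →
      ∑ (λ b → e (H α) p (zs b)) ≡ σ * count (fit-ok (λ _ → true) load)
    single zs load eq admissible p len = begin
      ∑ (λ b → e (H α) p (zs b))
        ≡⟨ ∑-cong (λ b → trans (col-H-++ p α (zs b)) (trans (*-comm ⟦ fits? α (zs b) ⟧ _) (cong₂ _*_ (cong (λ s → ⟦ ∑ α ≟ s ⟧) (len b))
             (trans (sym (+-identityʳ _)) (fits-allowed α (λ _ → true) load (yes tt) (zs b) (b ∷ []) _ _ (eq b)))))) ⟩
      ∑ (λ b → σ * ⟦ allowed? (fit-ok (λ _ → true) load) α (b ∷ []) ⟧)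
        ≡⟨ *-∑ σ _ ⟨
      σ * ∑ (λ b → ⟦ allowed? (fit-ok (λ _ → true) load) α (b ∷ []) ⟧)
        ≡⟨ cong (σ *_) (∑-allowed (fit-ok (λ _ → true) load) admissible α) ⟩
      σ * count (fit-ok (λ _ → true) load) ∎

    double : ∀ (zs : Fin n → Fin n → List (Fin n)) load → (∀ b d c → cnt c (zs b d) ≡ load (bits c (b ∷ d ∷ []))) →
      Admissible (fit-ok apart load) → ∀ p → (∀ b d → length (zs b d) + p ≡ 5 + k) →
      ∑ (λ b → ∑ λ d → ⟦ ¬? (eq? b d) ⟧ * e (H α) p (zs b d)) ≡ σ * count (fit-ok apart load)
    double zs load eq admissible p len = begin
      ∑ (λ b → ∑ λ d → ⟦ ¬? (eq? b d) ⟧ * e (H α) p (zs b d))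
        ≡⟨ ∑ⁿ-cong 2 (λ b d → trans (cong (⟦ ¬? (eq? b d) ⟧ *_) (col-H-++ p α (zs b d))) (trans (sym (*-assoc ⟦ ¬? (eq? b d) ⟧ _ _))
             (trans (*-comm (⟦ ¬? (eq? b d) ⟧ * ⟦ fits? α (zs b d) ⟧) _) (cong₂ _*_ (cong (λ s → ⟦ ∑ α ≟ s ⟧) (len b d))
               (fits-allowed α apart load (¬? (eq? b d)) (zs b d) (b ∷ d ∷ []) apart⁺ apart⁻ (eq b d)))))) ⟩
      ∑v 2 (λ κ → σ * ⟦ allowed? (fit-ok apart load) α κ ⟧)
        ≡⟨ *-∑v 2 σ (λ κ → ⟦ allowed? (fit-ok apart load) α κ ⟧) ⟩
      σ * ∑v 2 (λ κ → ⟦ allowed? (fit-ok apart load) α κ ⟧)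
        ≡⟨ cong (σ *_) (∑-allowed (fit-ok apart load) admissible α) ⟩
      σ * count (fit-ok apart load) ∎

    e₁-value : ∑ (λ b → e (H α) (4 + k) (b ∷ [])) ≡ σ * count ok-e₁
    e₁-value = single (λ b → b ∷ []) _ (λ b c → cnt-bits c (b ∷ [])) admissible-e₁ (4 + k) (λ _ → refl)

    p₂-value : ∑ (λ b → e (H α) (3 + k) (b ∷ b ∷ [])) ≡ σ * count ok-p₂
    p₂-value = single (λ b → b ∷ b ∷ []) _ (λ b c → cnt-bits c (b ∷ b ∷ [])) admissible-p₂ (3 + k) (λ _ → refl)

    m₁₁-value : ∑ (λ b → ∑ λ d → ⟦ ¬? (eq? b d) ⟧ * e (H α) (3 + k) (b ∷ d ∷ [])) ≡ σ * count ok-m₁₁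
    m₁₁-value = double (λ b d → b ∷ d ∷ []) _ (λ b d c → cnt-bits c (b ∷ d ∷ [])) admissible-m₁₁ (3 + k) (λ _ _ → refl)

    m₂₁-value : ∑ (λ b → ∑ λ d → ⟦ ¬? (eq? b d) ⟧ * e (H α) (2 + k) (b ∷ b ∷ d ∷ [])) ≡ σ * count ok-m₂₁
    m₂₁-value = double (λ b d → b ∷ b ∷ d ∷ []) _ (λ b d c → cnt-bits c (b ∷ b ∷ d ∷ [])) admissible-m₂₁ (2 + k) (λ _ _ → refl)

-- Outside five pairs (t₂, t₃) both sides vanish. In those five, the size equation expresses t₁
-- through k, and a polynomial identity in k remains.
fork-identity : ∀ k t₁ t₂ t₃ → t₁ + 2 * t₂ + 3 * t₃ ≡ 5 + k →
  patternCount 4 (weights fork-ok) t₁ t₂ t₃ 0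
    ≡ combination k (patternCount 2 (weights ok-m₂₁) t₁ t₂ t₃ 0) (patternCount 1 (weights ok-p₂) t₁ t₂ t₃ 0)
        (patternCount 2 (weights ok-m₁₁) t₁ t₂ t₃ 0) (patternCount 1 (weights ok-e₁) t₁ t₂ t₃ 0) (patternCount 0 (weights ok-1) t₁ t₂ t₃ 0)
fork-identity k t₁ t₂ t₃ size = begin
  patternCount 4 (weights fork-ok) t₁ t₂ t₃ 0
    ≡⟨ patternCount-falling 4 (weights fork-ok) t₁ t₂ t₃ ⟩
  byBlocks fork-ok t₁ t₂ t₃
    ≡⟨ cases t₂ t₃ size ⟩
  combination k (byBlocks ok-m₂₁ t₁ t₂ t₃) (byBlocks ok-p₂ t₁ t₂ t₃) (byBlocks ok-m₁₁ t₁ t₂ t₃) (byBlocks ok-e₁ t₁ t₂ t₃) (byBlocks ok-1 t₁ t₂ t₃)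
    ≡⟨ sym (combination-cong k (patternCount-falling 2 (weights ok-m₂₁) t₁ t₂ t₃) (patternCount-falling 1 (weights ok-p₂) t₁ t₂ t₃)
         (patternCount-falling 2 (weights ok-m₁₁) t₁ t₂ t₃) (patternCount-falling 1 (weights ok-e₁) t₁ t₂ t₃) (patternCount-falling 0 (weights ok-1) t₁ t₂ t₃)) ⟩
  combination k (patternCount 2 (weights ok-m₂₁) t₁ t₂ t₃ 0) (patternCount 1 (weights ok-p₂) t₁ t₂ t₃ 0)
    (patternCount 2 (weights ok-m₁₁) t₁ t₂ t₃ 0) (patternCount 1 (weights ok-e₁) t₁ t₂ t₃ 0) (patternCount 0 (weights ok-1) t₁ t₂ t₃ 0) ∎
  where
  byBlocks : ∀ {d} → (Vec Bool d → ℕ → Bool) → ℕ → ℕ → ℕ → ℕ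
  byBlocks {d} ok t₁ t₂ t₃ =
    sumL (λ l → overPartitions d [] (weights ok) (coefficient t₂ t₃ l) * (falling t₁ (l ∸ (t₂ + t₃)) * (t₂ ! * t₃ !))) (downFrom (suc d))
  Goal : ℕ → ℕ → ℕ → Set
  Goal t₂ t₃ t₁ = byBlocks fork-ok t₁ t₂ t₃
    ≡ combination k (byBlocks ok-m₂₁ t₁ t₂ t₃) (byBlocks ok-p₂ t₁ t₂ t₃) (byBlocks ok-m₁₁ t₁ t₂ t₃) (byBlocks ok-e₁ t₁ t₂ t₃) (byBlocks ok-1 t₁ t₂ t₃)
  cases : ∀ t₂ t₃ → t₁ + 2 * t₂ + 3 * t₃ ≡ 5 + k → Goal t₂ t₃ t₁
  -- The split goes as far as `choices` needs in order to reduce; in these cases every coefficient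
  -- then computes to 0.
  cases 0 (suc (suc t₃)) _ = sym (combination-zero k)
  cases 1 (suc (suc t₃)) _ = sym (combination-zero k)
  cases 2 (suc (suc t₃)) _ = sym (combination-zero k)
  cases (suc (suc (suc t₂))) 0 _ = sym (combination-zero k)
  cases (suc (suc (suc t₂))) 1 _ = sym (combination-zero k)
  cases (suc (suc (suc t₂))) (suc (suc t₃)) _ = sym (combination-zero k)
  cases 2 1 _ = sym (combination-zero k)
  cases 0 0 size = subst (Goal 0 0) (sym (+-cancelʳ-≡ 0 t₁ (5 + k) (trans (sym (trans (+-identityʳ (t₁ + 0)) refl)) (trans size (+-comm 0 (5 + k)))))) (poly₀₀ k)
    where
    poly₀₀ : ∀ k → 1 * (((5 + k) * ((4 + k) * ((3 + k) * ((2 + k) * 1)))) * 1) + 0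
      ≡ 0 + (k + 2) * 0 + (3 * k + 4) * (1 * (((5 + k) * ((4 + k) * 1)) * 1) + 0) + (k * k * k + 5 * (k * k) + 8 * k + 7) * (1 * (((5 + k) * 1) * 1) + 0) + (k + 1) * (k + 1) * (k + 5) * (1 * (1 * 1) + 0)
    poly₀₀ = solve-∀
  cases 1 0 size = subst (Goal 1 0) (sym (+-cancelʳ-≡ 2 t₁ (3 + k) (trans (sym (trans (+-identityʳ (t₁ + 2)) refl)) (trans size (+-comm 2 (3 + k)))))) (poly₁₀ k)
    where
    -- Four blocks: only u can share its colour with the clique. Three blocks: one of the 5
    -- non-adjacent pairs among u, v, x, y shares a colour.
    poly₁₀ : ∀ k → 1 * (((3 + k) * ((2 + k) * ((1 + k) * 1))) * 1) + (5 * (((3 + k) * ((2 + k) * 1)) * 1) + 0)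
      ≡ (1 * (((3 + k) * 1) * 1) + 0) + (k + 2) * (1 * (1 * 1) + 0) + (3 * k + 4) * (2 * (((3 + k) * 1) * 1) + 0) + (k * k * k + 5 * (k * k) + 8 * k + 7) * (1 * (1 * 1) + 0) + (k + 1) * (k + 1) * (k + 5) * 0
    poly₁₀ = solve-∀
  cases 2 0 size = subst (Goal 2 0) (sym (+-cancelʳ-≡ 4 t₁ (1 + k) (trans (sym (trans (+-identityʳ (t₁ + 4)) refl)) (trans size (+-comm 4 (1 + k)))))) (poly₂₀ k)
    where
    -- 3 counts the pairs inside {v, x, y}, with u sharing a clique colour; 2 counts the pairings
    -- ux|vy and uy|vx.
    poly₂₀ : ∀ k → 3 * (((1 + k) * 1) * 2) + (2 * (1 * 2) + 0)
      ≡ (1 * (1 * 2) + 0) + (k + 2) * 0 + (3 * k + 4) * (1 * (1 * 2) + 0) + (k * k * k + 5 * (k * k) + 8 * k + 7) * 0 + (k + 1) * (k + 1) * (k + 5) * 0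
    poly₂₀ = solve-∀
  cases 0 1 size = subst (Goal 0 1) (sym (+-cancelʳ-≡ 3 t₁ (2 + k) (trans (sym (+-assoc t₁ 0 3)) (trans size (+-comm 3 (2 + k)))))) (poly₀₁ k)
    where
    -- 2 counts the stable triples {u, x, y} and {v, x, y}.
    poly₀₁ : ∀ k → 2 * (((2 + k) * 1) * 1) + 0
      ≡ (1 * (((2 + k) * 1) * 1) + 0) + (k + 2) * (1 * (1 * 1) + 0) + (3 * k + 4) * 0 + (k * k * k + 5 * (k * k) + 8 * k + 7) * 0 + (k + 1) * (k + 1) * (k + 5) * 0
    poly₀₁ = solve-∀
  cases 1 1 size = subst (Goal 1 1) (sym (+-cancelʳ-≡ 5 t₁ (k) (trans (sym (+-assoc t₁ 2 3)) (trans size (+-comm 5 (k)))))) (poly₁₁ k)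
    where
    -- The triple {v, x, y}, with u sharing its colour with one clique vertex.
    poly₁₁ : ∀ k → 1 * (1 * 1) + 0
      ≡ (1 * (1 * 1) + 0) + (k + 2) * 0 + (3 * k + 4) * 0 + (k * k * k + 5 * (k * k) + 8 * k + 7) * 0 + (k + 1) * (k + 1) * (k + 5) * 0
    poly₁₁ = solve-∀

∑-multiplicity : ∀ {n} (α : Fin n → ℕ) → large α [] ≡ 0 → ∑ α ≡ multiplicity α 1 [] + 2 * multiplicity α 2 [] + 3 * multiplicity α 3 []
∑-multiplicity α none = begin
  ∑ α
    ≡⟨ ∑-cong (λ c → pointwise (α c) (∑≡0⇒≡0 _ none c)) ⟩
  ∑ (λ c → 1 * ind (α c ≡ᵇ 1) + 2 * (1 * ind (α c ≡ᵇ 2)) + 3 * (1 * ind (α c ≡ᵇ 3)))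
    ≡⟨ trans (∑-+ _ _) (cong₂ _+_ (∑-+ _ _) refl) ⟩
  multiplicity α 1 [] + ∑ (λ c → 2 * (1 * ind (α c ≡ᵇ 2))) + ∑ (λ c → 3 * (1 * ind (α c ≡ᵇ 3)))
    ≡⟨ cong₂ (λ x y → multiplicity α 1 [] + x + y) (*-∑ 2 _) (*-∑ 3 _) ⟨
  multiplicity α 1 [] + 2 * multiplicity α 2 [] + 3 * multiplicity α 3 [] ∎
  where
  pointwise : ∀ m → 1 * ind (4 ≤ᵇ m) ≡ 0 → m ≡ 1 * ind (m ≡ᵇ 1) + 2 * (1 * ind (m ≡ᵇ 2)) + 3 * (1 * ind (m ≡ᵇ 3))
  pointwise 0 _ = refl
  pointwise 1 _ = refl
  pointwise 2 _ = refl
  pointwise 3 _ = refl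
  pointwise (suc (suc (suc (suc m)))) ()

-- If the degree is wrong or some multiplicity exceeds 3, both sides are 0; otherwise
-- `∑-multiplicity` supplies the size equation of `fork-identity`.
chromCoeff-e : ∀ {n} (α : Fin n → ℕ) k →
  chromCoeff (forkGraph (5 + k)) n α ≡ suc k ! * e-form (H α) k
chromCoeff-e {n} α k = begin
  chromCoeff (forkGraph (5 + k)) n α
    ≡⟨ chromCoeff-fork α (suc k) ⟩
  σ * suc k ! * count α fork-ok
    ≡⟨ identity (∑ α ≟ 5 + k) ⟩
  suc k ! * combination k (σ * count α ok-m₂₁) (σ * count α ok-p₂) (σ * count α ok-m₁₁) (σ * count α ok-e₁) (σ * count α ok-1)
    ≡⟨ cong (suc k ! *_) (combination-cong k (m₂₁-value α k) (p₂-value α k) (m₁₁-value α k) (e₁-value α k) (e-value α k)) ⟨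
  suc k ! * e-form (H α) k ∎
  where
  σ = ⟦ ∑ α ≟ 5 + k ⟧
  t₁ = multiplicity α 1 []
  t₂ = multiplicity α 2 []
  t₃ = multiplicity α 3 []
  counts : ∀ t₄ → (t₄ ≡ 0 → ∑ α ≡ t₁ + 2 * t₂ + 3 * t₃) → ∑ α ≡ 5 + k →
    patternCount 4 (weights fork-ok) t₁ t₂ t₃ t₄
      ≡ combination k (patternCount 2 (weights ok-m₂₁) t₁ t₂ t₃ t₄) (patternCount 1 (weights ok-p₂) t₁ t₂ t₃ t₄)
          (patternCount 2 (weights ok-m₁₁) t₁ t₂ t₃ t₄) (patternCount 1 (weights ok-e₁) t₁ t₂ t₃ t₄) (patternCount 0 (weights ok-1) t₁ t₂ t₃ t₄)
  counts zero     size ∑α≡5+k = fork-identity k t₁ t₂ t₃ (trans (sym (size refl)) ∑α≡5+k)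
  counts (suc t₄) _    _      = trans (none 4 (weights fork-ok)) (trans (sym (combination-zero k)) (sym (combination-cong k
    (none 2 (weights ok-m₂₁)) (none 1 (weights ok-p₂)) (none 2 (weights ok-m₁₁)) (none 1 (weights ok-e₁)) (none 0 (weights ok-1)))))
    where
    none : ∀ d (φ : Φ d) → patternCount d φ t₁ t₂ t₃ (suc t₄) ≡ 0
    none d φ = patternCount-large d φ t₁ t₂ t₃ t₄
  identity : (D : Dec (∑ α ≡ 5 + k)) → ⟦ D ⟧ * suc k ! * count α fork-ok
    ≡ suc k ! * combination k (⟦ D ⟧ * count α ok-m₂₁) (⟦ D ⟧ * count α ok-p₂) (⟦ D ⟧ * count α ok-m₁₁) (⟦ D ⟧ * count α ok-e₁) (⟦ D ⟧ * count α ok-1)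
  identity (no _)       = trans (sym (*-zeroʳ (suc k !))) (cong (suc k ! *_) (sym (combination-zero k)))
  identity (yes ∑α≡5+k) = cong₂ _*_ (+-identityʳ (suc k !)) (trans (counts (large α []) (∑-multiplicity α) ∑α≡5+k)
    (sym (combination-cong k (*-identityˡ (count α ok-m₂₁)) (*-identityˡ (count α ok-p₂)) (*-identityˡ (count α ok-m₁₁)) (*-identityˡ (count α ok-e₁)) (*-identityˡ (count α ok-1)))))

-- The passage to ℤ: the product 2 f s₂₂₂ is added and subtracted, so that the equation in ℕ can be
-- inserted.
signed-sum : ∀ f y s₃₂ c₃ s₃ s₂₂₂ c₂₂ s₂₂ c₂ s₂ c₁ s₁ →
  y + 2 * s₂₂₂ ≡ s₃₂ + c₃ * s₃ + c₂₂ * s₂₂ + c₂ * s₂ + c₁ * s₁ →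
  pos (f * y) ≡ pos f ℤ.* pos s₃₂ ℤ.+ (pos (c₃ * f) ℤ.* pos s₃ ℤ.+ (ℤ.- (pos (2 * f)) ℤ.* pos s₂₂₂
    ℤ.+ (pos (c₂₂ * f) ℤ.* pos s₂₂ ℤ.+ (pos (c₂ * f) ℤ.* pos s₂ ℤ.+ (pos (c₁ * f) ℤ.* pos s₁ ℤ.+ pos 0)))))
signed-sum f y s₃₂ c₃ s₃ s₂₂₂ c₂₂ s₂₂ c₂ s₂ c₁ s₁ eq = begin
  pos (f * y)
    ≡⟨ cancel (pos (f * y)) (pos (2 * f * s₂₂₂)) ⟩
  (pos (f * y + 2 * f * s₂₂₂)) ℤ.- pos (2 * f * s₂₂₂)
    ≡⟨ cong (λ s → pos s ℤ.- pos (2 * f * s₂₂₂)) scaled ⟩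
  pos (f * s₃₂ + c₃ * f * s₃ + c₂₂ * f * s₂₂ + c₂ * f * s₂ + c₁ * f * s₁) ℤ.- pos (2 * f * s₂₂₂)
    ≡⟨ rearrange (pos (f * s₃₂)) (pos (c₃ * f * s₃)) (pos (2 * f * s₂₂₂)) (pos (c₂₂ * f * s₂₂)) (pos (c₂ * f * s₂)) (pos (c₁ * f * s₁)) ⟩
  pos (f * s₃₂) ℤ.+ (pos (c₃ * f * s₃) ℤ.+ (ℤ.- pos (2 * f * s₂₂₂) ℤ.+ (pos (c₂₂ * f * s₂₂) ℤ.+ (pos (c₂ * f * s₂) ℤ.+ (pos (c₁ * f * s₁) ℤ.+ pos 0)))))
    ≡⟨ cong₂ ℤ._+_ (ℤ.pos-* f s₃₂) (cong₂ ℤ._+_ (ℤ.pos-* (c₃ * f) s₃) (cong₂ ℤ._+_ (trans (cong ℤ.-_ (ℤ.pos-* (2 * f) s₂₂₂)) (ℤ.neg-distribˡ-* (pos (2 * f)) (pos s₂₂₂)))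
         (cong₂ ℤ._+_ (ℤ.pos-* (c₂₂ * f) s₂₂) (cong₂ ℤ._+_ (ℤ.pos-* (c₂ * f) s₂) (cong (ℤ._+ pos 0) (ℤ.pos-* (c₁ * f) s₁)))))) ⟩
  _ ∎
  where
  cancel : ∀ a b → a ≡ a ℤ.+ b ℤ.- b
  cancel = ℤ-Solver.solve-∀
  rearrange : ∀ a b c d e g → a ℤ.+ b ℤ.+ d ℤ.+ e ℤ.+ g ℤ.- c ≡ a ℤ.+ (b ℤ.+ (ℤ.- c ℤ.+ (d ℤ.+ (e ℤ.+ (g ℤ.+ pos 0)))))
  rearrange = ℤ-Solver.solve-∀
  expand : ∀ f s₃₂ c₃ s₃ c₂₂ s₂₂ c₂ s₂ c₁ s₁ →
    f * (s₃₂ + c₃ * s₃ + c₂₂ * s₂₂ + c₂ * s₂ + c₁ * s₁) ≡ f * s₃₂ + c₃ * f * s₃ + c₂₂ * f * s₂₂ + c₂ * f * s₂ + c₁ * f * s₁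
  expand = solve-∀
  factor : ∀ f y s → f * y + 2 * f * s ≡ f * (y + 2 * s)
  factor = solve-∀
  scaled : f * y + 2 * f * s₂₂₂ ≡ f * s₃₂ + c₃ * f * s₃ + c₂₂ * f * s₂₂ + c₂ * f * s₂ + c₁ * f * s₁
  scaled = trans (factor f y s₂₂₂) (trans (cong (f *_) eq) (expand f s₃₂ c₃ s₃ c₂₂ s₂₂ c₂ s₂ c₁ s₁))

fork-schur : ∀ q → ChromEqSchur (forkBlowup (suc q)) (forkExpansion (suc q))
fork-schur q n α = begin
  pos (chromCoeff (forkBlowup k) n α)
    ≡⟨ cong pos (cong (λ d → chromCoeff (forkGraph d) n α) (+-comm k 5)) ⟩
  pos (chromCoeff (forkGraph (5 + k)) n α)
    ≡⟨ cong pos (trans (chromCoeff-e α k) (cong (λ m → m ! * E) (+-comm 1 k))) ⟩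
  pos ((k + 1) ! * E)
    ≡⟨ signed-sum ((k + 1) !) E (schurCoeff (3 ∷ 2 ∷ replicate k 1) n α) (k + 3) (schurCoeff (3 ∷ replicate (k + 2) 1) n α)
         (schurCoeff (2 ∷ 2 ∷ 2 ∷ replicate q 1) n α) (5 * (k + 1)) (schurCoeff (2 ∷ 2 ∷ replicate (k + 1) 1) n α)
         (k * k * k + 5 * (k * k) + 14 * k + 14) (schurCoeff (2 ∷ replicate (k + 3) 1) n α)
         (2 * ((k + 2) * (k + 2) * (k + 2))) (schurCoeff (replicate (k + 5) 1) n α)
         (schur-values (schur-32 α k) (with-replicate (3 ∷_) 2 (schur-3 α (2 + k))) (schur-222 α q) (with-replicate (λ s → 2 ∷ 2 ∷ s) 1 (schur-22 α (1 + k)))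
           (with-replicate (2 ∷_) 3 (schur-2 α (3 + k))) (with-replicate id 5 (schur-1ᵐ α (4 + k)))) ⟩
  schurCombCoeff (forkExpansion k) n α ∎
  where
  k = suc q
  E = e-form (H α) k
  with-replicate : ∀ (shape : List ℕ → List ℕ) m {s} → schurCoeff (shape (replicate (m + k) 1)) n α ≡ s → schurCoeff (shape (replicate (k + m) 1)) n α ≡ s
  with-replicate shape m eq = trans (cong (λ j → schurCoeff (shape (replicate j 1)) n α) (+-comm k m)) eq
  schur-values : ∀ {s₃₂ s₃ s₂₂₂ s₂₂ s₂ s₁} → s₃₂ ≡ s-32 (H α) k → s₃ ≡ s-3 (H α) (2 + k) → s₂₂₂ ≡ s-222 (H α) q → s₂₂ ≡ s-22 (H α) (1 + k) →
    s₂ ≡ s-2 (H α) (3 + k) → s₁ ≡ e (H α) (5 + k) [] →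
    E + 2 * s₂₂₂ ≡ s₃₂ + (k + 3) * s₃ + 5 * (k + 1) * s₂₂ + (k * k * k + 5 * (k * k) + 14 * k + 14) * s₂ + 2 * ((k + 2) * (k + 2) * (k + 2)) * s₁
  schur-values refl refl refl refl refl refl = e-form-schur (H α) (H-↭ α) q

-- Failure of Schur positivity

countᵇ⁻ : {A : Set} (p : A → Bool) (xs : List A) {m : ℕ} → countᵇ p xs ≡ suc m → ∃ λ x → x ∈ xs × T (p x)
countᵇ⁻ p (x ∷ xs) eq with p x in px
... | true  = x , here refl , subst T (sym px) tt
... | false = let y , y∈xs , py = countᵇ⁻ p xs eq in y , there y∈xs , py

countᵇ⁺ : {A : Set} (p : A → Bool) {x : A} {xs : List A} → x ∈ xs → T (p x) → ¬ countᵇ p xs ≡ 0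
countᵇ⁺ p {x} (here refl) px eq with p x
... | true with () ← eq
countᵇ⁺ p {xs = y ∷ _} (there x∈xs) px eq with p y
... | true with () ← eq
... | false = countᵇ⁺ p x∈xs px eq

∈-allVecs : ∀ {n d} (v : Vec (Fin n) d) → v ∈ allVecs n d
∈-allVecs []      = here refl
∈-allVecs (a ∷ v) = ∈-concatMap⁺ _ (Any.map (λ { refl → ∈-map⁺ (a ∷_) (∈-allVecs v) }) (∈-allFin a))

fillings⁻ : ∀ {n} r rs {T} → T ∈ fillings n (r ∷ rs) → ∃ λ (row : Vec (Fin n) r) → ∃ λ T′ → T′ ∈ fillings n rs × T ≡ toList row ∷ T′
fillings⁻ {n} r rs T∈ with Any.satisfied (∈-concatMap⁻ (λ row → map (toList row ∷_) (fillings n rs)) {xs = allVecs n r} T∈)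
... | row , T∈row with ∈-map⁻ (toList row ∷_) T∈row
...   | T′ , T′∈ , eq = row , T′ , T′∈ , eq

fillings⁺ : ∀ {n r} rs {T′} (row : Vec (Fin n) r) → T′ ∈ fillings n rs → (toList row ∷ T′) ∈ fillings n (r ∷ rs)
fillings⁺ rs row T′∈ = ∈-concatMap⁺ _ (Any.map (λ { refl → ∈-map⁺ (toList row ∷_) T′∈ }) (∈-allVecs row))

module _ {n : ℕ} where

  colStrict⇒no-zero : ∀ (r r′ : List (Fin (suc n))) → T (colStrictᵇ r r′) → cnt zero r′ ≡ 0
  colStrict⇒no-zero r       []           t = refl
  colStrict⇒no-zero (a ∷ r) (suc b ∷ r′) t = colStrict⇒no-zero r r′ (proj₂ (Equivalence.to (T-∧ {toℕ a <ᵇ suc (toℕ b)}) t))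

  -- Entries grow strictly down the columns, so every 0 lies in the first row.
  ssyt⇒no-zero : ∀ (r : List (Fin (suc n))) rs → T (isSSYTᵇ (r ∷ rs)) → cnt zero (concat rs) ≡ 0
  ssyt⇒no-zero r []        t = refl
  ssyt⇒no-zero r (r′ ∷ rs) t = trans (cnt-++ zero r′ (concat rs)) (cong₂ _+_ (colStrict⇒no-zero r r′ (proj₁ t₂)) (ssyt⇒no-zero r′ rs (proj₂ t₂)))
    where
    t₂ = Equivalence.to (T-∧ {colStrictᵇ r r′}) (proj₂ (Equivalence.to (T-∧ {weaklyIncᵇ r}) t))

  weaklyInc-suc : ∀ (a : Fin n) xs → T (weaklyIncᵇ (suc a ∷ xs)) → cnt zero xs ≡ 0
  weaklyInc-suc a []           t = refl
  weaklyInc-suc a (suc b ∷ xs) t = weaklyInc-suc b xs (proj₂ (Equivalence.to (T-∧ {suc (toℕ a) ≤ᵇ suc (toℕ b)}) t))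

  isSSYT⇒weaklyInc : ∀ (r : List (Fin (suc n))) rs → T (isSSYTᵇ (r ∷ rs)) → T (weaklyIncᵇ r)
  isSSYT⇒weaklyInc r []       t = t
  isSSYT⇒weaklyInc r (_ ∷ rs) t = proj₁ (Equivalence.to (T-∧ {weaklyIncᵇ r}) t)

module _ {n : ℕ} where

  raise-weaklyInc : ∀ (r : List (Fin (2 + n))) → cnt zero r ≡ 0 → T (weaklyIncᵇ (zero ∷ r)) → T (weaklyIncᵇ (suc zero ∷ r))
  raise-weaklyInc []          _ t = tt
  raise-weaklyInc (suc a ∷ r) _ t = t

  -- An entry 1 under the raised box would force, by weak increase, the two entries to its left to
  -- be 1 as well: three 1s where at most one is available.
  raise-colStrict : ∀ (r r′ : List (Fin (2 + n))) → cnt (suc zero) r′ ≤ 1 → T (weaklyIncᵇ r′) →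
    T (colStrictᵇ (zero ∷ zero ∷ zero ∷ r) r′) → T (colStrictᵇ (zero ∷ zero ∷ suc zero ∷ r) r′)
  raise-colStrict r []           _ _ t = t
  raise-colStrict r (suc _ ∷ []) _ _ t = t
  raise-colStrict r (suc _ ∷ suc _ ∷ []) _ _ t = t
  raise-colStrict r (suc _ ∷ suc _ ∷ suc (suc _) ∷ _) _ _ t = t
  raise-colStrict r (suc zero ∷ suc zero ∷ suc zero ∷ _) (s≤s ()) _ t
  raise-colStrict r (suc (suc a) ∷ suc (suc b) ∷ suc zero ∷ _) _ inc t with () ← proj₂ (Equivalence.to (T-∧ {toℕ a <ᵇ suc (toℕ b)}) inc)

  -- Three entries 0 and one entry 1 force the third 0 of the first row to be replaceable by 1.
  raise : ∀ (r : List (Fin (2 + n))) rs → cnt zero r ≡ 0 → cnt (suc zero) (concat rs) ≤ 1 →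
    T (isSSYTᵇ ((zero ∷ zero ∷ zero ∷ r) ∷ rs)) → T (isSSYTᵇ ((zero ∷ zero ∷ suc zero ∷ r) ∷ rs))
  raise r []        no-zero few t = raise-weaklyInc r no-zero t
  raise r (r′ ∷ rs) no-zero few t = Equivalence.from (T-∧ {weaklyIncᵇ (suc zero ∷ r)})
    ( raise-weaklyInc r no-zero (proj₁ t₁)
    , Equivalence.from (T-∧ {colStrictᵇ (zero ∷ zero ∷ suc zero ∷ r) r′})
        ( raise-colStrict r r′ (≤-trans (≤-trans (m≤m+n _ _) (≤-reflexive (sym (cnt-++ (suc zero) r′ (concat rs))))) few)
            (isSSYT⇒weaklyInc r′ rs (proj₂ t₂)) (proj₁ t₂)
        , proj₂ t₂))
    where
    t₁ = Equivalence.to (T-∧ {weaklyIncᵇ (zero ∷ r)}) t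
    t₂ = Equivalence.to (T-∧ {colStrictᵇ (zero ∷ zero ∷ zero ∷ r) r′}) (proj₂ t₁)

-- In the order 3, 1, 2 the contents differ by a single 0 turned into a 1, and there is only one 1
-- to obstruct that change. Both have total 6 + q = k + 5.
content₃₁₂ content₂₂₂ : ∀ {q} → Fin (3 + q) → ℕ
content₃₁₂ zero             = 3
content₃₁₂ (suc zero)       = 1
content₃₁₂ (suc (suc zero)) = 2
content₃₁₂ (suc (suc (suc _))) = 1
content₂₂₂ zero             = 2
content₂₂₂ (suc zero)       = 2
content₂₂₂ (suc (suc zero)) = 2
content₂₂₂ (suc (suc (suc _))) = 1

module _ {q : ℕ} where

  raise-filling : ∀ {r} rs {T′} (row : Vec (Fin (3 + q)) r) → T′ ∈ fillings (3 + q) rs → T (isSSYTᵇ (toList row ∷ T′)) →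
    Content content₃₁₂ (toList row ++ concat T′) →
    ∃ λ S → S ∈ fillings (3 + q) (r ∷ rs) × T (isSSYTᵇ S) × Content content₂₂₂ (concat S)
  raise-filling rs {T′} row T′∈ ssyt content = go row T′∈ ssyt content
      (trans (sym (+-identityʳ _)) (trans (cong (λ m → cnt zero (toList row) + m) (sym (ssyt⇒no-zero (toList row) T′ ssyt))) (trans (sym (cnt-++ zero (toList row) (concat T′))) (content zero))))
      (isSSYT⇒weaklyInc (toList row) T′ ssyt)
    where
    go : ∀ {r T′} (row : Vec (Fin (3 + q)) r) → T′ ∈ fillings (3 + q) rs → T (isSSYTᵇ (toList row ∷ T′)) →
      Content content₃₁₂ (toList row ++ concat T′) → cnt zero (toList row) ≡ 3 → T (weaklyIncᵇ (toList row)) →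
      ∃ λ S → S ∈ fillings (3 + q) (r ∷ rs) × T (isSSYTᵇ S) × Content content₂₂₂ (concat S)
    go (suc a ∷ r) _ _ _ three inc with () ← trans (sym three) (weaklyInc-suc a (toList r) inc)
    go (zero ∷ suc a ∷ r) _ _ _ three inc with () ← trans (sym (suc-injective three)) (weaklyInc-suc a (toList r) inc)
    go (zero ∷ zero ∷ suc a ∷ r) _ _ _ three inc with () ← trans (sym (suc-injective (suc-injective three))) (weaklyInc-suc a (toList r) inc)
    go {T′ = T′} (zero ∷ zero ∷ zero ∷ r) T′∈ ssyt content three inc =
      _ , fillings⁺ rs (zero ∷ zero ∷ suc zero ∷ r) T′∈
      , raise (toList r) T′ (suc-injective (suc-injective (suc-injective three)))
          (≤-trans (m≤n+m _ (cnt (suc zero) (toList r))) (≤-reflexive (trans (sym (cnt-++ (suc zero) (toList r) (concat T′))) (content (suc zero))))) ssyt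
      , raised
      where
      raised : Content content₂₂₂ (zero ∷ zero ∷ suc zero ∷ toList r ++ concat T′)
      raised zero                = suc-injective (content zero)
      raised (suc zero)          = cong suc (content (suc zero))
      raised (suc (suc zero))    = content (suc (suc zero))
      raised (suc (suc (suc c))) = content (suc (suc (suc c)))

  -- By contradiction: a tableau of content `content₃₁₂` would be raised to one of content
  -- `content₂₂₂`.
  schurCoeff-raise : ∀ shape → schurCoeff shape (3 + q) content₂₂₂ ≡ 0 → schurCoeff shape (3 + q) content₃₁₂ ≡ 0
  schurCoeff-raise []       _    = refl
  schurCoeff-raise (r ∷ rs) none with schurCoeff (r ∷ rs) (3 + q) content₃₁₂ in some
  ... | zero  = refl
  ... | suc _ with countᵇ⁻ _ (fillings (3 + q) (r ∷ rs)) some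
  ...   | T₀ , T₀∈ , t with fillings⁻ r rs T₀∈
  ...     | row , T′ , T′∈ , refl with Equivalence.to (T-∧ {isSSYTᵇ (toList row ∷ T′)}) t
  ...       | ssyt , has with raise-filling rs row T′∈ ssyt (hasContent⁻ content₃₁₂ (toList row ++ concat T′) has)
  ...         | S , S∈ , ssyt′ , content′ = ⊥-elim (countᵇ⁺ _ S∈ (Equivalence.from (T-∧ {isSSYTᵇ S}) (ssyt′ , hasContent⁺ content₂₂₂ (concat S) content′)) none)

  -- Here non-negativity enters: a sum of naturals vanishes only if each of its terms does.
  schurSum-raise : ∀ (L : List (ℕ × List ℕ)) →
    foldr (λ t acc → proj₁ t * schurCoeff (proj₂ t) (3 + q) content₂₂₂ + acc) 0 L ≡ 0 →
    foldr (λ t acc → proj₁ t * schurCoeff (proj₂ t) (3 + q) content₃₁₂ + acc) 0 L ≡ 0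
  schurSum-raise []                _    = refl
  schurSum-raise ((c , shape) ∷ L) none = cong₂ _+_ (term (m*n≡0⇒m≡0∨n≡0 c (m+n≡0⇒m≡0 _ none))) (schurSum-raise L (m+n≡0⇒n≡0 (c * schurCoeff shape (3 + q) content₂₂₂) none))
    where
    term : c ≡ 0 ⊎ schurCoeff shape (3 + q) content₂₂₂ ≡ 0 → c * schurCoeff shape (3 + q) content₃₁₂ ≡ 0
    term (inj₁ refl) = refl
    term (inj₂ eq)   = trans (cong (c *_) (schurCoeff-raise shape eq)) (*-zeroʳ c)

∑-ones : ∀ n → ∑ {n} (λ _ → 1) ≡ n
∑-ones zero    = ∑-empty _
∑-ones (suc n) = trans (∑-suc _) (cong suc (∑-ones n))

∑-3+ : ∀ {q} (f : Fin (3 + q) → ℕ) → ∑ f ≡ f zero + (f (suc zero) + (f (suc (suc zero)) + ∑ (λ c → f (suc (suc (suc c))))))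
∑-3+ f = trans (∑-suc f) (cong (f zero +_) (trans (∑-suc _) (cong (f (suc zero) +_) (∑-suc _))))

multiplicity-content₂₂₂ : ∀ q → multiplicity (content₂₂₂ {q}) 2 [] ≡ 3
multiplicity-content₂₂₂ q = trans (∑-3+ _) (cong (3 +_) (∑-zero _ λ _ → refl))

-- A colour of multiplicity 2 takes two of the vertices u, v, x, y, or u alone together with a
-- clique vertex. Three such colours would take at least five of these four vertices.
patternCount-triple : ∀ t₁ t₂ t₃ t₄ → patternCount 4 (weights fork-ok) t₁ (3 + t₂) t₃ t₄ ≡ 0
patternCount-triple t₁ t₂ t₃ (suc t₄) = patternCount-large 4 (weights fork-ok) t₁ (3 + t₂) t₃ t₄
-- `choices` reduces only for t₃ in these forms; then all coefficients compute to 0.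
patternCount-triple t₁ t₂ 0             0 = patternCount-falling 4 (weights fork-ok) t₁ (3 + t₂) 0
patternCount-triple t₁ t₂ 1             0 = patternCount-falling 4 (weights fork-ok) t₁ (3 + t₂) 1
patternCount-triple t₁ t₂ (suc (suc t₃)) 0 = patternCount-falling 4 (weights fork-ok) t₁ (3 + t₂) (suc (suc t₃))

chromCoeff-content₂₂₂ : ∀ q → chromCoeff (forkGraph (6 + q)) (3 + q) content₂₂₂ ≡ 0
chromCoeff-content₂₂₂ q = trans (chromCoeff-fork (content₂₂₂ {q}) (2 + q)) (trans (cong (C *_) none) (*-zeroʳ C))
  where
  C = ⟦ ∑ (content₂₂₂ {q}) ≟ 6 + q ⟧ * (2 + q) !
  none : count (content₂₂₂ {q}) fork-ok ≡ 0
  none = trans (cong (λ t → patternCount 4 (weights fork-ok) t₁ t t₃ t₄) (multiplicity-content₂₂₂ q)) (patternCount-triple t₁ 0 t₃ t₄)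
    where
    t₁ = multiplicity (content₂₂₂ {q}) 1 []
    t₃ = multiplicity (content₂₂₂ {q}) 3 []
    t₄ = large (content₂₂₂ {q}) []

-- The only pattern gives colour 0 to v, x, y and colour 2 to u; the clique then carries each of the
-- 2 + q nonzero colours once.
chromCoeff-content₃₁₂ : ∀ q → chromCoeff (forkGraph (6 + q)) (3 + q) content₃₁₂ ≡ (2 + q) !
chromCoeff-content₃₁₂ q = begin
  chromCoeff (forkGraph (6 + q)) (3 + q) content₃₁₂
    ≡⟨ chromCoeff-fork α (2 + q) ⟩
  ⟦ ∑ α ≟ 6 + q ⟧ * (2 + q) ! * count α fork-ok
    ≡⟨ cong₂ _*_ (cong (_* (2 + q) !) (⟦⟧-yes (∑ α ≟ 6 + q) (trans (∑-3+ α) (cong (6 +_) (∑-ones q))))) one ⟩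
  1 * (2 + q) ! * 1
    ≡⟨ trans (*-identityʳ _) (*-identityˡ _) ⟩
  (2 + q) ! ∎
  where
  α = content₃₁₂ {q}
  t₁ = multiplicity α 1 []
  one : count α fork-ok ≡ 1
  one = begin
    patternCount 4 (weights fork-ok) t₁ (multiplicity α 2 []) (multiplicity α 3 []) (large α [])
      ≡⟨ cong₂ (λ t₂ t₃ → patternCount 4 (weights fork-ok) t₁ t₂ t₃ (large α [])) (trans (∑-3+ _) (cong (1 +_) (∑-zero _ λ _ → refl))) (trans (∑-3+ _) (cong (1 +_) (∑-zero _ λ _ → refl))) ⟩
    patternCount 4 (weights fork-ok) t₁ 1 1 (large α [])
      ≡⟨ cong (patternCount 4 (weights fork-ok) t₁ 1 1) (trans (∑-3+ _) (∑-zero _ λ _ → refl)) ⟩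
    patternCount 4 (weights fork-ok) t₁ 1 1 0
      ≡⟨ patternCount-falling 4 (weights fork-ok) t₁ 1 1 ⟩
    1 ∎

fork-not-schur-positive : ∀ q → ¬ SPositive (forkBlowup (suc q))
fork-not-schur-positive q (L , _ , eq) = n!≢0 (2 + q) (begin
  (2 + q) !
    ≡⟨ trans (cong (λ d → chromCoeff (forkGraph d) (3 + q) content₃₁₂) (+-comm (suc q) 5)) (chromCoeff-content₃₁₂ q) ⟨
  chromCoeff (forkBlowup (suc q)) (3 + q) content₃₁₂
    ≡⟨ eq (3 + q) content₃₁₂ ⟩
  foldr (λ t acc → proj₁ t * schurCoeff (proj₂ t) (3 + q) content₃₁₂ + acc) 0 L
    ≡⟨ schurSum-raise L (trans (sym (eq (3 + q) content₂₂₂))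
         (trans (cong (λ d → chromCoeff (forkGraph d) (3 + q) content₂₂₂) (+-comm (suc q) 5)) (chromCoeff-content₂₂₂ q))) ⟩
  0 ∎)
  where
  n!≢0 : ∀ n → ¬ n ! ≡ 0
  n!≢0 n eq = <-irrefl (sym eq) (1≤n! n)

theorem4p1 : (k : ℕ) → 1 ≤ k →
    ChromEqSchur (forkBlowup k) (forkExpansion k) × ¬ SPositive (forkBlowup k)
theorem4p1 (suc q) _ = fork-schur q , fork-not-schur-positive q
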